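{- Let $G$ be a finite simple quasi 5-connected graph. If $d_G(x)+d_G(y)\ge 9$ for every pair $x,y$ of vertices of $G$ at distance one or two, then $G$ contains a quasi 5-contractible edge.
   Context: All graphs are finite, simple and undirected; $d_G(x)$ is the degree of $x$, and the distance between two vertices is the length of a shortest path between them. For an edge $e=xy$, $G/e$ denotes the graph obtained by deleting $e$, identifying $x$ and $y$, and replacing any resulting multiple edges by single edges. A cut of a connected graph $G$ is a set $T\subseteq V(G)$ with $G-T$ disconnected; a $k$-cut is a cut with $k$ vertices. A $k$-cut $T$ is nontrivial if the components of $G-T$ can be partitioned into two subgraphs $G_1,G_2$ with $|V(G_1)|\ge 2$ and $|V(G_2)|\ge 2$. A graph is quasi $k$-connected if it is $(k-1)$-connected and has no nontrivial $(k-1)$-cut. An edge $e$ of a quasi $k$-connected graph $G$ is quasi $k$-contractible if $G/e$ is quasi $k$-connected. -}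

module Defs where

open import Data.Nat using (ℕ; zero; suc; _<_; _≤_; _∸_; _+_)
open import Data.Bool using (Bool; true; false; T; not; _∧_; _∨_)
open import Data.Fin using (Fin; punchIn; _≟_)
open import Data.Fin.Subset using (Subset; _∈_; _∉_; ∁; _∪_; ∣_∣)
open import Data.Vec using (tabulate)
open import Data.Product using (Σ; ∃; ∃-syntax; _×_)
open import Data.Sum using (_⊎_)
open import Relation.Nullary using (¬_)
open import Relation.Nullary.Decidable using (⌊_⌋)
open import Relation.Binary.PropositionalEquality using (_≡_; _≢_)

Graph : ℕ → Set
Graph n = Fin n → Fin n → Bool

E : {n : ℕ} → Graph n → Fin n → Fin n → Set
E G u v = T (G u v)

IsSimple : {n : ℕ} → Graph n → Set
IsSimple {n} G = (∀ u v → G u v ≡ G v u) × (∀ u → G u u ≡ false)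

deg : {n : ℕ} → Graph n → Fin n → ℕ
deg G x = ∣ tabulate (G x) ∣

Dist12 : {n : ℕ} → Graph n → Fin n → Fin n → Set
Dist12 G x y = x ≢ y × (E G x y ⊎ ∃[ z ] (E G x z × E G z y))

data Reach {n : ℕ} (G : Graph n) (S : Subset n) (u : Fin n) : Fin n → Set where
  here : u ∉ S → Reach G S u u
  step : ∀ {w v} → Reach G S u w → E G w v → v ∉ S → Reach G S u v

IsCut : {n : ℕ} → Graph n → Subset n → Set
IsCut G S = ∃[ u ] ∃[ v ] (u ∉ S × v ∉ S × ¬ Reach G S u v)

KConnected : {n : ℕ} → ℕ → Graph n → Set
KConnected {n} k G = k < n × (∀ S → ∣ S ∣ < k → ¬ IsCut G S)

-- S is a nontrivial cut: the components of G − S can be split into two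
-- parts A and (V ∖ S) ∖ A (i.e. no edges between them), each with ≥ 2 vertices
NontrivialCut : {n : ℕ} → Graph n → Subset n → Set
NontrivialCut {n} G S =
  IsCut G S ×
  Σ (Subset n) λ A →
    (∀ v → v ∈ A → v ∉ S) ×
    (∀ u v → u ∈ A → v ∉ A → v ∉ S → ¬ E G u v) ×
    2 ≤ ∣ A ∣ ×
    2 ≤ ∣ ∁ (A ∪ S) ∣

QuasiConnected : {n : ℕ} → ℕ → Graph n → Set
QuasiConnected k G =
  KConnected (k ∸ 1) G × (∀ S → ∣ S ∣ ≡ k ∸ 1 → ¬ NontrivialCut G S)

-- G / xy : vertex y is deleted (vertices ≠ y renumbered via punchIn y),
-- x becomes the merged vertex, multiple edges/loops discarded.
contract : {m : ℕ} → Graph (suc m) → Fin (suc m) → Fin (suc m) → Graph m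
contract G x y a b =
  not ⌊ a ≟ b ⌋ ∧
  (G a' b' ∨ (⌊ a' ≟ x ⌋ ∧ G y b') ∨ (⌊ b' ≟ x ⌋ ∧ G a' y))
  where
  a' = punchIn y a
  b' = punchIn y b

QuasiContractible : {n : ℕ} → ℕ → Graph n → Fin n → Fin n → Set
QuasiContractible {suc m} k G x y = QuasiConnected k (contract G x y)

{-# OPTIONS --safe #-}
module Submission where

-- An edge xy fails to be quasi 5-contractible only if x and y have a common neighbour of degree 4, or
-- both lie in a 5-vertex cut T with at least two vertices on either side. Suppose this holds for every edge.
-- Crossing two such cuts gives four corners, opposite ones having boundaries of total size 10, so small corners
-- abound; a corner with boundary of size at most 4 has at most one vertex, and that vertex has degree 4.
-- The degree condition keeps vertices of degree 4 at distance at least three.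
-- If v has degree 4, every edge vy lies in such a T, and a side meeting N(v) in one vertex y must be a pair
-- {y , y₂}. Two pairs {y , y₂}, {m , m₂} arising in this way form a rigid configuration, which the cuts
-- through the edges y₂m and y₂q (q in the cut, not adjacent to y) contradict.
-- So there is no vertex of degree 4, G is 5-connected, and crossing shows that a smallest side of such a T
-- has at most four vertices; sides of size 4, 3 and 2 are excluded in turn.

open import Defs
open import Data.Nat using (ℕ; zero; suc; _+_; _*_; _∸_; _≤_; _<_; _≥_; _<ᵇ_; _≤ᵇ_; _≡ᵇ_; z≤n; s≤s; s≤s⁻¹)
open import Data.Nat.Properties
open import Data.Nat.Induction using (<-wellFounded; Acc; acc)
open import Data.Nat.Tactic.RingSolver using (solve-∀)
open import Data.Bool using (Bool; true; false; T; _∧_; _∨_; not; if_then_else_)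
open import Data.Bool.Properties using (T?; T-∧; T-∨; T-≡; ∧-zeroʳ)
open import Data.Fin as Fin using (Fin; zero; suc; punchIn; punchOut)
open import Data.Fin.Properties using (any?; all?; punchOut-cong; punchIn-punchOut; punchInᵢ≢i; punchOut-punchIn)
open import Data.Fin.Subset as Subset using (Subset; ∣_∣; ∁; _∪_)
open import Data.Fin.Subset.Properties using (x∈p∪q⁺; x∈∁p⇒x∉p) renaming (_∈?_ to _∈ˢ?_)
open import Data.Vec as Vec using (Vec; []; _∷_; tabulate)
open import Data.Vec.Properties using (lookup∘tabulate; tabulate∘lookup; []=⇒lookup; lookup⇒[]=)
open import Data.List using (List; []; _∷_; _++_; concatMap; length)
open import Data.List.Properties using (++-assoc)
open import Data.List.Membership.Propositional using (_∈_; _∉_)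
import Data.List.Membership.DecPropositional as DecMembership
open import Data.List.Relation.Unary.All as All using (All; []; _∷_)
open import Data.List.Relation.Unary.All.Properties using (++⁺)
open import Data.List.Relation.Unary.Any using (here; there)
open import Data.List.Relation.Unary.AllPairs using (AllPairs; []; _∷_)
open import Data.Product using (∃; ∃-syntax; _×_; _,_; proj₁; proj₂)
open import Data.Sum using (_⊎_; inj₁; inj₂) renaming (swap to swap-⊎)
open import Data.Empty using (⊥; ⊥-elim)
open import Data.Unit using (tt)
open import Function using (_∘_; Equivalence)
open import Relation.Nullary using (¬_; yes; no; Dec; ¬?)
open import Relation.Nullary.Decidable using (⌊_⌋; _×-dec_; _→-dec_; toWitness; fromWitness)
open import Relation.Binary.PropositionalEquality

-- Linear arithmetic by Fourier–Motzkin elimination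

-- The size 5 comes from lifting: a 4-cut of the contraction through the merged vertex is, in `G`, a
-- cut of 5 vertices containing both ends of the edge. A 3-cut through the merged vertex lifts to a
-- 4-cut of `G` through both ends; this must be trivial, so it isolates a vertex, which is the
-- common neighbour of degree 4. The number 10 is a double count: the boundaries of two opposite
-- corners together count each of the two 5-vertex cuts once. Two crossing separations divide the
-- vertices into nine cells, and most counting steps are linear statements about the nine cell
-- sizes. A verified elimination procedure settles these, so a step only lists the inequalities that
-- it uses. The obstacle is that a corner boundary of exactly 5 vertices gives no contradiction by
-- itself. The remedy is to find a boundary vertex without neighbours inside the corner: moved to
-- the other side, it turns 5 into 4. Applied to both vertices of a two-vertex side, the same device
-- handles boundaries of 6.

infixl 7 _⊕_
infix 6 _≼_ _≐_

data Expr (m : ℕ) : Set where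
  con : ℕ → Expr m
  var : Fin m → Expr m
  _⊕_ : Expr m → Expr m → Expr m

data Constraint (m : ℕ) : Set where
  _≼_ _≐_ : Expr m → Expr m → Constraint m

⟦_⟧ : ∀ {m} → Expr m → Vec ℕ m → ℕ
⟦ con k ⟧ ρ = k
⟦ var i ⟧ ρ = Vec.lookup ρ i
⟦ e ⊕ f ⟧ ρ = ⟦ e ⟧ ρ + ⟦ f ⟧ ρ

Sat : ∀ {m} → Vec ℕ m → Constraint m → Set
Sat ρ (e ≼ f) = ⟦ e ⟧ ρ ≤ ⟦ f ⟧ ρ
Sat ρ (e ≐ f) = ⟦ e ⟧ ρ ≡ ⟦ f ⟧ ρ

infixr 3 _⊢⊥_
_⊢⊥_ : ∀ {m} → Vec ℕ m → List (Constraint m) → Set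
ρ ⊢⊥ [] = ⊥
ρ ⊢⊥ (h ∷ hs) = Sat ρ h → ρ ⊢⊥ hs

-- ((l , a) , (r , b)) stands for a + l·ρ ≤ b + r·ρ; keeping both sides
-- avoids negative coefficients.
Form : ℕ → Set
Form m = Vec ℕ m × ℕ

Ineq : ℕ → Set
Ineq m = Form m × Form m

dot : ∀ {m} → Vec ℕ m → Vec ℕ m → ℕ
dot []      []      = 0
dot (k ∷ l) (x ∷ ρ) = k * x + dot l ρ

value : ∀ {m} → Form m → Vec ℕ m → ℕ
value (l , a) ρ = a + dot l ρ

Holds : ∀ {m} → Vec ℕ m → Ineq m → Set
Holds ρ (f , g) = value f ρ ≤ value g ρ

add : ∀ {m} → Form m → Form m → Form m
add (l , a) (r , b) = Vec.zipWith _+_ l r , a + b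

scale : ∀ {m} → ℕ → Form m → Form m
scale k (l , a) = Vec.map (k *_) l , k * a

dot-+ : ∀ {m} (l r ρ : Vec ℕ m) → dot (Vec.zipWith _+_ l r) ρ ≡ dot l ρ + dot r ρ
dot-+ [] [] [] = refl
dot-+ (k ∷ l) (j ∷ r) (x ∷ ρ) rewrite dot-+ l r ρ = shuffle k j x (dot l ρ) (dot r ρ)
  where
  shuffle : ∀ k j x p q → (k + j) * x + (p + q) ≡ k * x + p + (j * x + q)
  shuffle = solve-∀

dot-* : ∀ {m} k (l ρ : Vec ℕ m) → dot (Vec.map (k *_) l) ρ ≡ k * dot l ρ
dot-* k [] [] = sym (*-zeroʳ k)
dot-* k (j ∷ l) (x ∷ ρ) rewrite dot-* k l ρ = shuffle k j x (dot l ρ)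
  where
  shuffle : ∀ k j x p → k * j * x + k * p ≡ k * (j * x + p)
  shuffle = solve-∀

value-add : ∀ {m} (f g : Form m) ρ → value (add f g) ρ ≡ value f ρ + value g ρ
value-add (l , a) (r , b) ρ rewrite dot-+ l r ρ = shuffle a b (dot l ρ) (dot r ρ)
  where
  shuffle : ∀ a b p q → a + b + (p + q) ≡ a + p + (b + q)
  shuffle = solve-∀

value-scale : ∀ {m} k (f : Form m) ρ → value (scale k f) ρ ≡ k * value f ρ
value-scale k (l , a) ρ rewrite dot-* k l ρ = sym (*-distribˡ-+ k a (dot l ρ))

-- The first inequality bounds the leading variable from above, with net coefficient `suc p`, the
-- second from below, with net coefficient `suc q`; the crosswise multiples make the leading
-- coefficients of the two sides equal.
combine : ∀ {m} → Ineq (suc m) → Ineq (suc m) → List (Ineq (suc m))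
combine ((k ∷ l , a) , (j ∷ r , b)) ((k' ∷ l' , a') , (j' ∷ r' , b')) with k ∸ j | j' ∸ k'
... | suc p | suc q = (add (scale (suc q) (k ∷ l , a)) (scale (suc p) (k' ∷ l' , a')) ,
                       add (scale (suc q) (j ∷ r , b)) (scale (suc p) (j' ∷ r' , b'))) ∷ []
... | suc _ | zero  = []
... | zero  | _     = []

combine-sound : ∀ {m} (ρ : Vec ℕ (suc m)) i j → Holds ρ i → Holds ρ j → All (Holds ρ) (combine i j)
combine-sound ρ ((k ∷ l , a) , (j ∷ r , b)) ((k' ∷ l' , a') , (j' ∷ r' , b')) hi hj with k ∸ j | j' ∸ k'
... | suc p | suc q = subst₂ _≤_ (expand (k ∷ l , a) (k' ∷ l' , a')) (expand (j ∷ r , b) (j' ∷ r' , b'))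
    (+-mono-≤ (*-monoʳ-≤ (suc q) hi) (*-monoʳ-≤ (suc p) hj)) ∷ []
  where
  expand : ∀ f g → suc q * value f ρ + suc p * value g ρ ≡ value (add (scale (suc q) f) (scale (suc p) g)) ρ
  expand f g = sym (trans (value-add (scale (suc q) f) (scale (suc p) g) ρ)
                          (cong₂ _+_ (value-scale (suc q) f ρ) (value-scale (suc p) g ρ)))
... | suc _ | zero  = []
... | zero  | _     = []

trivial : ∀ {m} → Ineq m → Bool
trivial ((l , a) , (r , b)) = Vec.foldr _ _∧_ (a ≤ᵇ b) (Vec.zipWith _≤ᵇ_ l r)

-- Variables are natural numbers, so a leading variable that weighs at least as much on the left may
-- be dropped; this is the combination with `0 ≤ x`. Pure lower bounds are discarded, and
-- inequalities true coefficient by coefficient are pruned to keep the list short.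
project : ∀ {m} → Ineq (suc m) → List (Ineq m)
project ((k ∷ l , a) , (j ∷ r , b)) with j ≤? k
... | no _  = []
... | yes _ = if trivial ((l , a) , (r , b)) then [] else ((l , a) , (r , b)) ∷ []

project-sound : ∀ {m} x (ρ : Vec ℕ m) i → Holds (x ∷ ρ) i → All (Holds ρ) (project i)
project-sound x ρ ((k ∷ l , a) , (j ∷ r , b)) h with j ≤? k
... | no _ = []
... | yes j≤k with trivial ((l , a) , (r , b))
...   | true  = []
...   | false = +-cancelˡ-≤ (k * x) _ _ (begin
  k * x + (a + dot l ρ) ≡⟨ shuffle (k * x) a (dot l ρ) ⟩
  a + (k * x + dot l ρ) ≤⟨ h ⟩
  b + (j * x + dot r ρ) ≡⟨ shuffle (j * x) b (dot r ρ) ⟨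
  j * x + (b + dot r ρ) ≤⟨ +-monoˡ-≤ _ (*-monoˡ-≤ x j≤k) ⟩
  k * x + (b + dot r ρ) ∎) ∷ []
  where
  open ≤-Reasoning
  shuffle : ∀ p q r → p + (q + r) ≡ q + (p + r)
  shuffle = solve-∀

all-bind : ∀ {A B : Set} {P : A → Set} {Q : B → Set} (f : A → List B) →
  (∀ x → P x → All Q (f x)) → ∀ {xs} → All P xs → All Q (concatMap f xs)
all-bind f sound [] = []
all-bind f sound (p ∷ ps) = ++⁺ (sound _ p) (all-bind f sound ps)

eliminate : ∀ {m} → List (Ineq (suc m)) → List (Ineq m)
eliminate hs = concatMap project (hs ++ concatMap (λ i → concatMap (combine i) hs) hs)

eliminate-sound : ∀ {m} x (ρ : Vec ℕ m) hs → All (Holds (x ∷ ρ)) hs → All (Holds ρ) (eliminate hs)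
eliminate-sound x ρ hs h = all-bind project (project-sound x ρ)
  (++⁺ h (all-bind _ (λ i hi → all-bind (combine i) (λ j → combine-sound (x ∷ ρ) i j hi) h) h))

refutes : ∀ m → List (Ineq m) → Bool
refutes zero [] = false
refutes zero (((_ , a) , (_ , b)) ∷ hs) = (b <ᵇ a) ∨ refutes zero hs
refutes (suc m) hs = refutes m (eliminate hs)

refutes-sound : ∀ m hs → T (refutes m hs) → (ρ : Vec ℕ m) → All (Holds ρ) hs → ⊥
refutes-sound zero ((([] , a) , ([] , b)) ∷ hs) t [] (h ∷ ps) with b <ᵇ a in eq
... | true  = <⇒≱ (<ᵇ⇒< b a (subst T (sym eq) tt)) (subst₂ _≤_ (+-identityʳ a) (+-identityʳ b) h)
... | false = refutes-sound zero hs t [] ps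
refutes-sound (suc m) hs t (x ∷ ρ) h = refutes-sound m (eliminate hs) t ρ (eliminate-sound x ρ hs h)

unit : ∀ {m} → Fin m → Vec ℕ m
unit {suc m} zero = 1 ∷ Vec.replicate m 0
unit (suc i) = 0 ∷ unit i

dot-0 : ∀ {m} (ρ : Vec ℕ m) → dot (Vec.replicate m 0) ρ ≡ 0
dot-0 [] = refl
dot-0 (x ∷ ρ) = dot-0 ρ

dot-unit : ∀ {m} (i : Fin m) ρ → dot (unit i) ρ ≡ Vec.lookup ρ i
dot-unit zero (x ∷ ρ) rewrite dot-0 ρ = trans (+-identityʳ _) (+-identityʳ x)
dot-unit (suc i) (x ∷ ρ) = dot-unit i ρ

linear : ∀ {m} → Expr m → Form m
linear (con k) = Vec.replicate _ 0 , k
linear (var i) = unit i , 0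
linear (e ⊕ f) = add (linear e) (linear f)

linear-value : ∀ {m} (e : Expr m) ρ → value (linear e) ρ ≡ ⟦ e ⟧ ρ
linear-value (con k) ρ rewrite dot-0 ρ = +-identityʳ k
linear-value (var i) ρ = dot-unit i ρ
linear-value (e ⊕ f) ρ = trans (value-add (linear e) (linear f) ρ) (cong₂ _+_ (linear-value e ρ) (linear-value f ρ))

ineqs : ∀ {m} → Constraint m → List (Ineq m)
ineqs (e ≼ f) = (linear e , linear f) ∷ []
ineqs (e ≐ f) = (linear e , linear f) ∷ (linear f , linear e) ∷ []

ineqs-sound : ∀ {m} (ρ : Vec ℕ m) h → Sat ρ h → All (Holds ρ) (ineqs h)
ineqs-sound ρ (e ≼ f) p = subst₂ _≤_ (sym (linear-value e ρ)) (sym (linear-value f ρ)) p ∷ []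
ineqs-sound ρ (e ≐ f) p = ≤-reflexive q ∷ ≤-reflexive (sym q) ∷ []
  where q = trans (linear-value e ρ) (trans p (sym (linear-value f ρ)))

-- A record rather than a definition, so that refutes is not evaluated on open terms.
record Refutable {m : ℕ} (hs : List (Constraint m)) : Set where
  constructor refutable
  field
    check : T (refutes m (concatMap ineqs hs))

-- Opaque, to keep with-abstractions from normalising its proofs.
opaque
  fourier-motzkin : ∀ {m} (ρ : Vec ℕ m) hs → Refutable hs → ρ ⊢⊥ hs
  fourier-motzkin {m} ρ hs (refutable t) = curried [] [] hs t
    where
    curried : ∀ ks → All (Holds ρ) ks → ∀ hs → T (refutes m (ks ++ concatMap ineqs hs)) → ρ ⊢⊥ hs
    curried ks ps [] t = refutes-sound m _ t ρ (++⁺ ps [])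
    curried ks ps (h ∷ hs) t p = curried (ks ++ ineqs h) (++⁺ ps (ineqs-sound ρ h p)) hs
      (subst (λ z → T (refutes m z)) (sym (++-assoc ks (ineqs h) (concatMap ineqs hs))) t)

-- Counting vertices

≡⇒≥ : ∀ {m n} → m ≡ n → n ≤ m
≡⇒≥ e = ≤-reflexive (sym e)

bit : Bool → ℕ
bit true  = 1
bit false = 0

∑ : ∀ {n} → (Fin n → ℕ) → ℕ
∑ {zero}  f = 0
∑ {suc n} f = f zero + ∑ (f ∘ suc)

∑-cong : ∀ {n} {f g : Fin n → ℕ} → (∀ v → f v ≡ g v) → ∑ f ≡ ∑ g
∑-cong {zero} eq = refl
∑-cong {suc n} eq = cong₂ _+_ (eq zero) (∑-cong (eq ∘ suc))

∑-0 : ∀ {n} → ∑ {n} (λ _ → 0) ≡ 0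
∑-0 {zero} = refl
∑-0 {suc n} = ∑-0 {n}

∑-+ : ∀ {n} (f g : Fin n → ℕ) → ∑ (λ v → f v + g v) ≡ ∑ f + ∑ g
∑-+ {zero} f g = refl
∑-+ {suc n} f g rewrite ∑-+ (f ∘ suc) (g ∘ suc) = shuffle (f zero) (g zero) _ _
  where
  shuffle : ∀ a b p q → a + b + (p + q) ≡ a + p + (b + q)
  shuffle = solve-∀

∑-mono : ∀ {n} {f g : Fin n → ℕ} → (∀ v → f v ≤ g v) → ∑ f ≤ ∑ g
∑-mono {zero} le = z≤n
∑-mono {suc n} le = +-mono-≤ (le zero) (∑-mono (le ∘ suc))

∑-punchIn : ∀ {n} (y : Fin (suc n)) (f : Fin (suc n) → ℕ) → ∑ f ≡ f y + ∑ (f ∘ punchIn y)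
∑-punchIn zero f = refl
∑-punchIn {suc n} (suc y) f rewrite ∑-punchIn y (f ∘ suc) = shuffle (f zero) (f (suc y)) _
  where
  shuffle : ∀ a b p → a + (b + p) ≡ b + (a + p)
  shuffle = solve-∀

bit-mono : ∀ {a b} → (T a → T b) → bit a ≤ bit b
bit-mono {false} h = z≤n
bit-mono {true} {true} h = s≤s z≤n
bit-mono {true} {false} h = ⊥-elim (h tt)

T-not : ∀ b → T b → ¬ T (not b)
T-not true _ ()

bit-¬T : ∀ {a} → ¬ T a → bit a ≡ 0
bit-¬T {true} h = ⊥-elim (h tt)
bit-¬T {false} h = refl

∑-one : ∀ {n} (x : Fin n) → ∑ (λ v → bit ⌊ v Fin.≟ x ⌋) ≡ 1
∑-one {suc n} zero = cong suc (∑-0 {n})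
∑-one {suc n} (suc x) = trans (∑-cong shift) (∑-one x)
  where
  shift : ∀ v → bit ⌊ suc v Fin.≟ suc x ⌋ ≡ bit ⌊ v Fin.≟ x ⌋
  shift v with v Fin.≟ x
  ... | yes _ = refl
  ... | no _ = refl

-- Opaque, so that the predicate can be inferred from its count.
opaque
  # : ∀ {n} → (Fin n → Bool) → ℕ
  # p = ∑ (bit ∘ p)

  ∣tabulate∣ : ∀ {n} (p : Fin n → Bool) → ∣ tabulate p ∣ ≡ # p
  ∣tabulate∣ {zero} p = refl
  ∣tabulate∣ {suc n} p with p zero
  ... | true  = cong suc (∣tabulate∣ (p ∘ suc))
  ... | false = ∣tabulate∣ (p ∘ suc)

  #-mono : ∀ {n} {p q : Fin n → Bool} → (∀ v → T (p v) → T (q v)) → # p ≤ # q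
  #-mono h = ∑-mono (λ v → bit-mono (h v))

  #-cong : ∀ {n} {p q : Fin n → Bool} → (∀ v → p v ≡ q v) → # p ≡ # q
  #-cong h = ∑-cong (cong bit ∘ h)

  #-⊎ : ∀ {n} (p q r : Fin n → Bool) → (∀ v → bit (p v) ≡ bit (q v) + bit (r v)) → # p ≡ # q + # r
  #-⊎ p q r h = trans (∑-cong h) (∑-+ (bit ∘ q) (bit ∘ r))

  #-one : ∀ {n} (x : Fin n) → # (λ v → ⌊ v Fin.≟ x ⌋) ≡ 1
  #-one = ∑-one

  #-all : ∀ n → # {n} (λ _ → true) ≡ n
  #-all zero = refl
  #-all (suc n) = cong suc (#-all n)

  #-none : ∀ {n} {p : Fin n → Bool} → (∀ v → ¬ T (p v)) → # p ≡ 0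
  #-none {n} h = trans (∑-cong (bit-¬T ∘ h)) (∑-0 {n})

  #-punchIn : ∀ {n} (y : Fin (suc n)) (p : Fin (suc n) → Bool) → # p ≡ bit (p y) + # (p ∘ punchIn y)
  #-punchIn y p = ∑-punchIn y (bit ∘ p)

  -- Meant for `p` the symmetric difference of `q` and `r`, and `t` their union.
  #-balance : ∀ {n} (p q r t : Fin n → Bool) → (∀ v → bit (p v) + (bit (q v) + bit (r v)) ≡ bit (t v) + bit (t v)) →
    # p + (# q + # r) ≡ # t + # t
  #-balance p q r t h = trans (cong (# p +_) (sym (∑-+ (bit ∘ q) (bit ∘ r)))) (trans (sym (∑-+ (bit ∘ p) _))
    (trans (∑-cong h) (∑-+ (bit ∘ t) (bit ∘ t))))

infixl 6 _∖_
_∖_ : ∀ {n} → (Fin n → Bool) → Fin n → Fin n → Bool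
(p ∖ x) v = p v ∧ not ⌊ v Fin.≟ x ⌋

∖⁺ : ∀ {n} (p : Fin n → Bool) {x v} → T (p v) → v ≢ x → T ((p ∖ x) v)
∖⁺ p {x} {v} t ne with v Fin.≟ x | p v
... | yes e | _ = ⊥-elim (ne e)
... | no _ | true = tt

∖⁻ : ∀ {n} (p : Fin n → Bool) {x v} → T ((p ∖ x) v) → T (p v) × v ≢ x
∖⁻ p {x} {v} t with v Fin.≟ x | p v
... | no ne | true = tt , ne

#-∖ : ∀ {n} (p : Fin n → Bool) x → T (p x) → # p ≡ suc (# (p ∖ x))
#-∖ p x t = trans (#-⊎ p (λ v → ⌊ v Fin.≟ x ⌋) (p ∖ x) split) (cong (_+ # (p ∖ x)) (#-one x))
  where
  split : ∀ v → bit (p v) ≡ bit ⌊ v Fin.≟ x ⌋ + bit ((p ∖ x) v)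
  split v with v Fin.≟ x
  split v | yes refl with p v
  ... | true = refl
  split v | no _ with p v
  ... | true = refl
  ... | false = refl

module _ {n : ℕ} where
  open DecMembership (Fin._≟_ {n}) using (_∈?_) public

Distinct : ∀ {n} → List (Fin n) → Set
Distinct = AllPairs _≢_

#-distinct : ∀ {n} (p : Fin n → Bool) {xs} → Distinct xs → All (T ∘ p) xs → length xs ≤ # p
#-distinct p [] [] = z≤n
#-distinct p {x ∷ xs} (d ∷ ds) (t ∷ ts) rewrite #-∖ p x t =
  s≤s (#-distinct (p ∖ x) ds (All.zipWith (λ (ne , u) → ∖⁺ p u (ne ∘ sym)) (d , ts)))

#-cover : ∀ {n} (p : Fin n → Bool) xs → (∀ v → T (p v) → v ∈ xs) → # p ≤ length xs
#-cover p [] h = ≤-reflexive (#-none λ v t → case-∈ (h v t))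
  where
  case-∈ : ∀ {v} → v ∉ []
  case-∈ ()
#-cover p (x ∷ xs) h with T? (p x)
... | yes t rewrite #-∖ p x t = s≤s (#-cover (p ∖ x) xs (λ v u → rest (∖⁻ p u)))
  where
  rest : ∀ {v} → T (p v) × v ≢ x → v ∈ xs
  rest {v} (u , ne) with h v u
  ... | here e = ⊥-elim (ne e)
  ... | there m = m
... | no ¬t = ≤-trans (#-cover p xs rest) (n≤1+n _)
  where
  rest : ∀ v → T (p v) → v ∈ xs
  rest v u with h v u
  ... | here refl = ⊥-elim (¬t u)
  ... | there m = m

#-fresh : ∀ {n} (p : Fin n → Bool) xs → length xs < # p → ∃[ v ] (T (p v) × v ∉ xs)
#-fresh p xs lt with any? (λ v → T? (p v) ×-dec ¬? (v ∈? xs))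
... | yes w = w
... | no none = ⊥-elim (<⇒≱ lt (#-cover p xs covered))
  where
  covered : ∀ v → T (p v) → v ∈ xs
  covered v t with v ∈? xs
  ... | yes m = m
  ... | no nm = ⊥-elim (none (v , t , nm))

∉⇒All≢ : ∀ {n} {v : Fin n} {xs} → v ∉ xs → All (v ≢_) xs
∉⇒All≢ {xs = []} _ = []
∉⇒All≢ {xs = x ∷ xs} nm = (λ e → nm (here e)) ∷ ∉⇒All≢ (nm ∘ there)

#-closed : ∀ {n} (p : Fin n → Bool) {xs} → Distinct xs → All (T ∘ p) xs → # p ≤ length xs →
  ∀ {v} → T (p v) → v ∈ xs
#-closed p {xs} ds ts le {v} t with v ∈? xs
... | yes m = m
... | no nm = ⊥-elim (<⇒≱ (#-distinct p (∉⇒All≢ nm ∷ ds) (t ∷ ts)) le)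

-- A separation is coded as a colouring: M is the cut, L and R are the two sides.
data Side : Set where
  L M R : Side

is : Side → Side → Bool
is L L = true
is M M = true
is R R = true
is _ _ = false

is⁺ : ∀ {i j} → j ≡ i → T (is i j)
is⁺ {L} refl = tt
is⁺ {M} refl = tt
is⁺ {R} refl = tt

is⁻ : ∀ {i j} → T (is i j) → j ≡ i
is⁻ {L} {L} _ = refl
is⁻ {M} {M} _ = refl
is⁻ {R} {R} _ = refl

_≟ˢ_ : (i j : Side) → Dec (i ≡ j)
L ≟ˢ L = yes refl
L ≟ˢ M = no λ ()
L ≟ˢ R = no λ ()
M ≟ˢ L = no λ ()
M ≟ˢ M = yes refl
M ≟ˢ R = no λ ()
R ≟ˢ L = no λ ()
R ≟ˢ M = no λ ()
R ≟ˢ R = yes refl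

op : Side → Side
op L = R
op M = M
op R = L

op-involutive : ∀ i → op (op i) ≡ i
op-involutive L = refl
op-involutive M = refl
op-involutive R = refl

is-op : ∀ i j → is i (op j) ≡ is (op i) j
is-op L L = refl
is-op L M = refl
is-op L R = refl
is-op M L = refl
is-op M M = refl
is-op M R = refl
is-op R L = refl
is-op R M = refl
is-op R R = refl

Colouring : ℕ → Set
Colouring n = Fin n → Side

flip : ∀ {n} → Colouring n → Colouring n
flip s = op ∘ s

opaque
  size : ∀ {n} → Colouring n → Side → ℕ
  size s i = # (λ v → is i (s v))

  cell : ∀ {n} → Colouring n → Colouring n → Side → Side → ℕ
  cell s s' i j = # (λ v → is i (s v) ∧ is j (s' v))

  size≡# : ∀ {n} (s : Colouring n) i → size s i ≡ # (λ v → is i (s v))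
  size≡# s i = refl

  cell≡# : ∀ {n} (s s' : Colouring n) i j → cell s s' i j ≡ # (λ v → is i (s v) ∧ is j (s' v))
  cell≡# s s' i j = refl

size-mono : ∀ {n} {s s' : Colouring n} {i j} → (∀ v → s v ≡ i → s' v ≡ j) → size s i ≤ size s' j
size-mono {s = s} {s'} {i} {j} h = subst₂ _≤_ (sym (size≡# s i)) (sym (size≡# s' j)) (#-mono λ v t → is⁺ (h v (is⁻ t)))

module _ {n : ℕ} (s : Colouring n) (i : Side) where
  size-distinct : ∀ {xs} → Distinct xs → All (λ v → s v ≡ i) xs → length xs ≤ size s i
  size-distinct ds es = ≤-trans (#-distinct _ ds (All.map is⁺ es)) (≡⇒≥ (size≡# s i))

  size-fresh : ∀ xs → length xs < size s i → ∃[ v ] (s v ≡ i × v ∉ xs)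
  size-fresh xs lt with v , t , nm ← #-fresh (λ v → is i (s v)) xs (≤-trans lt (≤-reflexive (size≡# s i))) = v , is⁻ t , nm

  size-closed : ∀ {xs} → Distinct xs → All (λ v → s v ≡ i) xs → size s i ≤ length xs →
    ∀ {v} → s v ≡ i → v ∈ xs
  size-closed ds es le e = #-closed (λ v → is i (s v)) ds (All.map is⁺ es) (≤-trans (≡⇒≥ (size≡# s i)) le) (is⁺ e)

  size-cover : ∀ xs → (∀ v → s v ≡ i → v ∈ xs) → size s i ≤ length xs
  size-cover xs h = ≤-trans (≤-reflexive (size≡# s i)) (#-cover _ xs (λ v t → h v (is⁻ t)))

both⁺ : ∀ {i j a b} → a ≡ i → b ≡ j → T (is i a ∧ is j b)
both⁺ e f = Equivalence.from T-∧ (is⁺ e , is⁺ f)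

both⁻ : ∀ {i j a b} → T (is i a ∧ is j b) → a ≡ i × b ≡ j
both⁻ {i} {j} {a} {b} t with p , q ← Equivalence.to (T-∧ {is i a} {is j b}) t = is⁻ p , is⁻ q

module _ {n : ℕ} (s s' : Colouring n) (i j : Side) where
  cell-distinct : ∀ {xs} → Distinct xs → All (λ v → s v ≡ i × s' v ≡ j) xs → length xs ≤ cell s s' i j
  cell-distinct ds es = ≤-trans (#-distinct _ ds (All.map (λ (e , f) → both⁺ e f) es)) (≡⇒≥ (cell≡# s s' i j))

  cell-fresh : ∀ xs → length xs < cell s s' i j → ∃[ v ] (s v ≡ i × s' v ≡ j × v ∉ xs)
  cell-fresh xs lt with v , t , nm ← #-fresh (λ v → is i (s v) ∧ is j (s' v)) xs (≤-trans lt (≤-reflexive (cell≡# s s' i j)))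
    with e , f ← both⁻ {i} {j} t = v , e , f , nm

  cell-closed : ∀ {xs} → Distinct xs → All (λ v → s v ≡ i × s' v ≡ j) xs → cell s s' i j ≤ length xs →
    ∀ {v} → s v ≡ i → s' v ≡ j → v ∈ xs
  cell-closed ds es le e f = #-closed (λ v → is i (s v) ∧ is j (s' v)) ds (All.map (λ (e , f) → both⁺ e f) es)
    (≤-trans (≡⇒≥ (cell≡# s s' i j)) le) (both⁺ e f)

-- The nine cells of two colourings

pattern LL = (L , L)
pattern LM = (L , M)
pattern LR = (L , R)
pattern ML = (M , L)
pattern MM = (M , M)
pattern MR = (M , R)
pattern RL = (R , L)
pattern RM = (R , M)
pattern RR = (R , R)

multiplicity : Side → Side → List (Side × Side) → ℕ
multiplicity a b [] = 0
multiplicity a b ((i , j) ∷ ks) = bit (is i a ∧ is j b) + multiplicity a b ks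

total : ∀ {n} → Colouring n → Colouring n → List (Side × Side) → ℕ
total s s' [] = 0
total s s' ((i , j) ∷ ks) = cell s s' i j + total s s' ks

every : (Side → Bool) → Bool
every f = f L ∧ (f M ∧ f R)

matches : (Side → Side → Bool) → List (Side × Side) → Side → Side → Bool
matches P ks a b = bit (P a b) ≡ᵇ multiplicity a b ks

lists : (Side → Side → Bool) → List (Side × Side) → Bool
lists P ks = every (λ a → every (matches P ks a))

lists-sound : ∀ P ks → T (lists P ks) → ∀ a b → bit (P a b) ≡ multiplicity a b ks
lists-sound P ks t a b = ≡ᵇ⇒≡ _ _ (pick b {matches P ks a} (pick a {λ a → every (matches P ks a)} t))
  where
  pick : ∀ a {f : Side → Bool} → T (every f) → T (f a)
  pick L {f} t = proj₁ (Equivalence.to (T-∧ {f L}) t)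
  pick M {f} t = proj₁ (Equivalence.to (T-∧ {f M}) (proj₂ (Equivalence.to (T-∧ {f L}) t)))
  pick R {f} t = proj₂ (Equivalence.to (T-∧ {f M}) (proj₂ (Equivalence.to (T-∧ {f L}) t)))

opaque
  unfolding #

  -- The predicate sees only the two colours of a vertex, so the identity can be tested on the nine
  -- colour pairs; `lists` does this by evaluation.
  by-cells : ∀ {n} (s s' : Colouring n) (P : Side → Side → Bool) ks → T (lists P ks) →
    # (λ v → P (s v) (s' v)) ≡ total s s' ks
  by-cells {n} s s' P ks t = trans (∑-cong (λ v → lists-sound P ks t (s v) (s' v))) (expand ks)
    where
    expand : ∀ ks → ∑ (λ v → multiplicity (s v) (s' v) ks) ≡ total s s' ks
    expand [] = ∑-0 {n}
    expand ((i , j) ∷ ks) = trans (∑-+ (λ v → bit (is i (s v) ∧ is j (s' v))) _)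
      (cong₂ _+_ (sym (cell≡# s s' i j)) (expand ks))

cells : ∀ {n} → Colouring n → Colouring n → Vec ℕ 9
cells s s' = cell s s' L L ∷ cell s s' L M ∷ cell s s' L R ∷ cell s s' M L ∷ cell s s' M M ∷
  cell s s' M R ∷ cell s s' R L ∷ cell s s' R M ∷ cell s s' R R ∷ []

pattern 0F = zero
pattern 1F = suc zero
pattern 2F = suc (suc zero)
pattern 3F = suc (suc (suc zero))
pattern 4F = suc (suc (suc (suc zero)))
pattern 5F = suc (suc (suc (suc (suc zero))))
pattern 6F = suc (suc (suc (suc (suc (suc zero)))))
pattern 7F = suc (suc (suc (suc (suc (suc (suc zero))))))
pattern 8F = suc (suc (suc (suc (suc (suc (suc (suc zero)))))))

ll lm lr ml mm mr rl rm rr : Expr 9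
ll = var 0F
lm = var 1F
lr = var 2F
ml = var 3F
mm = var 4F
mr = var 5F
rl = var 6F
rm = var 7F
rr = var 8F

Σᵉ : ∀ {m} → List (Expr m) → Expr m
Σᵉ [] = con 0
Σᵉ (e ∷ es) = e ⊕ Σᵉ es

-- The summands stand in the order used by `total` and `boundary`, so that facts about those sums
-- satisfy the constraints by computation alone.
rowᴸ rowᴹ rowᴿ colᴸ colᴹ colᴿ bᴸᴸ bᴸᴿ bᴿᴸ bᴿᴿ : Expr 9
rowᴸ = Σᵉ (ll ∷ lm ∷ lr ∷ [])
rowᴹ = Σᵉ (ml ∷ mm ∷ mr ∷ [])
rowᴿ = Σᵉ (rl ∷ rm ∷ rr ∷ [])
colᴸ = Σᵉ (ll ∷ ml ∷ rl ∷ [])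
colᴹ = Σᵉ (lm ∷ mm ∷ rm ∷ [])
colᴿ = Σᵉ (lr ∷ mr ∷ rr ∷ [])
bᴸᴸ = Σᵉ (lm ∷ mm ∷ ml ∷ [])
bᴸᴿ = Σᵉ (lm ∷ mm ∷ mr ∷ [])
bᴿᴸ = Σᵉ (rm ∷ mm ∷ ml ∷ [])
bᴿᴿ = Σᵉ (rm ∷ mm ∷ mr ∷ [])

module Rows {n : ℕ} (s s' : Colouring n) where
  rowL : size s L ≡ total s s' (LL ∷ LM ∷ LR ∷ [])
  rowL = trans (size≡# s L) (by-cells s s' (λ a _ → is L a) (LL ∷ LM ∷ LR ∷ []) tt)
  rowM : size s M ≡ total s s' (ML ∷ MM ∷ MR ∷ [])
  rowM = trans (size≡# s M) (by-cells s s' (λ a _ → is M a) (ML ∷ MM ∷ MR ∷ []) tt)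
  rowR : size s R ≡ total s s' (RL ∷ RM ∷ RR ∷ [])
  rowR = trans (size≡# s R) (by-cells s s' (λ a _ → is R a) (RL ∷ RM ∷ RR ∷ []) tt)
  colL : size s' L ≡ total s s' (LL ∷ ML ∷ RL ∷ [])
  colL = trans (size≡# s' L) (by-cells s s' (λ _ b → is L b) (LL ∷ ML ∷ RL ∷ []) tt)
  colM : size s' M ≡ total s s' (LM ∷ MM ∷ RM ∷ [])
  colM = trans (size≡# s' M) (by-cells s s' (λ _ b → is M b) (LM ∷ MM ∷ RM ∷ []) tt)
  colR : size s' R ≡ total s s' (LR ∷ MR ∷ RR ∷ [])
  colR = trans (size≡# s' R) (by-cells s s' (λ _ b → is R b) (LR ∷ MR ∷ RR ∷ []) tt)

opaque
  ≤-by-contra : ∀ {m n} → (suc n ≤ m → ⊥) → m ≤ n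
  ≤-by-contra h = ≮⇒≥ h

  ≡-by-contra : ∀ {m n} → (suc n ≤ m → ⊥) → (suc m ≤ n → ⊥) → m ≡ n
  ≡-by-contra h k = ≤-antisym (≮⇒≥ h) (≮⇒≥ k)

cell-empty : ∀ {n} (s s' : Colouring n) {i j} → (∀ {v} → s v ≡ i → s' v ≡ j → ⊥) → cell s s' i j ≡ 0
cell-empty s s' {i} {j} h = trans (cell≡# s s' i j) (#-none λ v t → h (proj₁ (both⁻ {i} {j} t)) (proj₂ (both⁻ {i} {j} t)))

cell-member : ∀ {n} (s s' : Colouring n) {i j v} → s v ≡ i → s' v ≡ j → 1 ≤ cell s s' i j
cell-member s s' {i} {j} e f = cell-distinct s s' i j ([] ∷ []) ((e , f) ∷ [])

side-≢ : ∀ {n} (s : Colouring n) {i j u v} → s u ≡ i → s v ≡ j → {T (not (is i j))} → u ≢ v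
side-≢ s {L} {L} e f {()} refl
side-≢ s {M} {M} e f {()} refl
side-≢ s {R} {R} e f {()} refl
side-≢ s {L} {M} e f refl with () ← trans (sym e) f
side-≢ s {L} {R} e f refl with () ← trans (sym e) f
side-≢ s {M} {L} e f refl with () ← trans (sym e) f
side-≢ s {M} {R} e f refl with () ← trans (sym e) f
side-≢ s {R} {L} e f refl with () ← trans (sym e) f
side-≢ s {R} {M} e f refl with () ← trans (sym e) f

cell-flip : ∀ {n} (s s' : Colouring n) i j → cell s (op ∘ s') i j ≡ cell s s' i (op j)
cell-flip s s' i j = trans (cell≡# s (op ∘ s') i j) (trans (#-cong λ v → cong (is i (s v) ∧_) (is-op j (s' v))) (sym (cell≡# s s' i (op j))))

cell-unique : ∀ {n} (s s' : Colouring n) {i j a} → (∀ {v} → s v ≡ i → s' v ≡ j → v ≡ a) → cell s s' i j ≤ 1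
cell-unique s s' {i} {j} {a} h = ≤-by-contra λ lt → other (cell-fresh s s' i j (a ∷ []) lt)
  where
  other : ∃[ v ] (s v ≡ i × s' v ≡ j × v ∉ a ∷ []) → ⊥
  other (v , e , f , new) = new (here (h e f))

-- Crossing separations

∈-tabulate⁺ : ∀ {n} (f : Fin n → Bool) {v} → T (f v) → v Subset.∈ tabulate f
∈-tabulate⁺ f {v} t = lookup⇒[]= v (tabulate f) (trans (lookup∘tabulate f v) (Equivalence.to T-≡ t))

∈-tabulate⁻ : ∀ {n} (f : Fin n → Bool) {v} → v Subset.∈ tabulate f → T (f v)
∈-tabulate⁻ f {v} m = Equivalence.from T-≡ (trans (sym (lookup∘tabulate f v)) ([]=⇒lookup m))

∁∪-tabulate : ∀ {n} (f g : Fin n → Bool) →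
  ∁ (tabulate f ∪ tabulate g) ≡ tabulate (λ v → not (f v ∨ g v))
∁∪-tabulate {zero} f g = refl
∁∪-tabulate {suc n} f g = cong (not (f zero ∨ g zero) ∷_) (∁∪-tabulate (f ∘ suc) (g ∘ suc))

absurd : ∀ {A : Set} {i j : Side} {a : Side} → a ≡ i → a ≡ j → {T (not (is i j))} → A
absurd {i = L} {L} refl refl {()}
absurd {i = M} {M} refl refl {()}
absurd {i = R} {R} refl refl {()}

data End : Set where
  left right : End

side : End → Side
side left  = L
side right = R

opp : End → End
opp left  = right
opp right = left

orient : End → Side → Side
orient left  i = i
orient right i = op i

infixl 6 _⊓ˢ_
-- The maximum for the order `L` < `M` < `R`: a corner needs `L` twice, while a single `R` already
-- puts a vertex beyond the boundary.
_⊓ˢ_ : Side → Side → Side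
L ⊓ˢ L = L
R ⊓ˢ _ = R
_ ⊓ˢ R = R
_ ⊓ˢ _ = M

-- Colour of a vertex in the separation cutting off the corner (e , e') of two crossing separations.
join : End → End → Side → Side → Side
join e e' a b = orient e a ⊓ˢ orient e' b

corner : ∀ {n} → End → End → Colouring n → Colouring n → Colouring n
corner e e' s s' v = join e e' (s v) (s' v)

boundary : ∀ {n} → End → End → Colouring n → Colouring n → ℕ
boundary e e' s s' = total s s' ((side e , M) ∷ (M , M) ∷ (M , side e') ∷ [])

module _ {n : ℕ} (s s' : Colouring n) where
  corner-L : ∀ e e' → size (corner e e' s s') L ≡ cell s s' (side e) (side e')
  corner-L left left = trans (size≡# _ _) (trans (by-cells s s' (λ a b → is L (join left left a b)) (LL ∷ []) tt) (+-identityʳ _))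
  corner-L left right = trans (size≡# _ _) (trans (by-cells s s' (λ a b → is L (join left right a b)) (LR ∷ []) tt) (+-identityʳ _))
  corner-L right left = trans (size≡# _ _) (trans (by-cells s s' (λ a b → is L (join right left a b)) (RL ∷ []) tt) (+-identityʳ _))
  corner-L right right = trans (size≡# _ _) (trans (by-cells s s' (λ a b → is L (join right right a b)) (RR ∷ []) tt) (+-identityʳ _))

  corner-M : ∀ e e' → size (corner e e' s s') M ≡ boundary e e' s s'
  corner-M left left = trans (size≡# _ _) (by-cells s s' (λ a b → is M (join left left a b)) (LM ∷ MM ∷ ML ∷ []) tt)
  corner-M left right = trans (size≡# _ _) (by-cells s s' (λ a b → is M (join left right a b)) (LM ∷ MM ∷ MR ∷ []) tt)
  corner-M right left = trans (size≡# _ _) (by-cells s s' (λ a b → is M (join right left a b)) (RM ∷ MM ∷ ML ∷ []) tt)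
  corner-M right right = trans (size≡# _ _) (by-cells s s' (λ a b → is M (join right right a b)) (RM ∷ MM ∷ MR ∷ []) tt)

orient-side : ∀ e → orient e (side e) ≡ L
orient-side left = refl
orient-side right = refl

orient-opp : ∀ e → orient e (side (opp e)) ≡ R
orient-opp left = refl
orient-opp right = refl

orient-M : ∀ e → orient e M ≡ M
orient-M left = refl
orient-M right = refl

orient-L⁻ : ∀ e {a} → orient e a ≡ L → a ≡ side e
orient-L⁻ left refl = refl
orient-L⁻ right {R} refl = refl

orient-R⁻ : ∀ e {a} → orient e a ≡ R → a ≡ side (opp e)
orient-R⁻ left refl = refl
orient-R⁻ right {L} refl = refl

⊓ˢ-L⁻ : ∀ {a b} → a ⊓ˢ b ≡ L → a ≡ L × b ≡ L
⊓ˢ-L⁻ {L} {L} _ = refl , refl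
⊓ˢ-L⁻ {L} {M} ()
⊓ˢ-L⁻ {L} {R} ()
⊓ˢ-L⁻ {M} {L} ()
⊓ˢ-L⁻ {M} {M} ()
⊓ˢ-L⁻ {M} {R} ()

⊓ˢ-R⁻ : ∀ {a b} → a ⊓ˢ b ≡ R → a ≡ R ⊎ b ≡ R
⊓ˢ-R⁻ {R} _ = inj₁ refl
⊓ˢ-R⁻ {L} {R} _ = inj₂ refl
⊓ˢ-R⁻ {M} {R} _ = inj₂ refl
⊓ˢ-R⁻ {L} {L} ()
⊓ˢ-R⁻ {L} {M} ()
⊓ˢ-R⁻ {M} {L} ()
⊓ˢ-R⁻ {M} {M} ()

join-L⁺ : ∀ e e' {a b} → a ≡ side e → b ≡ side e' → join e e' a b ≡ L
join-L⁺ e e' refl refl = cong₂ _⊓ˢ_ (orient-side e) (orient-side e')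

join-L⁻ : ∀ e e' {a b} → join e e' a b ≡ L → a ≡ side e × b ≡ side e'
join-L⁻ e e' p with i , j ← ⊓ˢ-L⁻ p = orient-L⁻ e i , orient-L⁻ e' j

join-MM : ∀ e e' {a b} → a ≡ M → b ≡ M → join e e' a b ≡ M
join-MM e e' refl refl = cong₂ _⊓ˢ_ (orient-M e) (orient-M e')

join-LM : ∀ e e' {a b} → a ≡ side e → b ≡ M → join e e' a b ≡ M
join-LM e e' refl refl = cong₂ _⊓ˢ_ (orient-side e) (orient-M e')

join-R⁺ : ∀ e e' {a b} → a ≡ side (opp e) → join e e' a b ≡ R
join-R⁺ e e' {b = b} refl = cong (_⊓ˢ orient e' b) (orient-opp e)

join-R⁻ : ∀ e e' {a b} → join e e' a b ≡ R → a ≡ side (opp e) ⊎ b ≡ side (opp e')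
join-R⁻ e e' p with ⊓ˢ-R⁻ p
... | inj₁ i = inj₁ (orient-R⁻ e i)
... | inj₂ j = inj₂ (orient-R⁻ e' j)

-- Recolouring one vertex

opaque
  recolour : ∀ {n} → Colouring n → Fin n → Side → Colouring n
  recolour s x i v with v Fin.≟ x
  ... | yes _ = i
  ... | no _  = s v

  recolour-at : ∀ {n} (s : Colouring n) x i → recolour s x i x ≡ i
  recolour-at s x i with x Fin.≟ x
  ... | yes _ = refl
  ... | no ne = ⊥-elim (ne refl)

  recolour-off : ∀ {n} (s : Colouring n) x i {v} → v ≢ x → recolour s x i v ≡ s v
  recolour-off s x i {v} ne with v Fin.≟ x
  ... | yes e = ⊥-elim (ne e)
  ... | no _ = refl

  recolour⁻ : ∀ {n} (s : Colouring n) x i v {j} → recolour s x i v ≡ j → (v ≡ x × i ≡ j) ⊎ (v ≢ x × s v ≡ j)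
  recolour⁻ s x i v e with v Fin.≟ x
  ... | yes p = inj₁ (p , e)
  ... | no p = inj₂ (p , e)

  #-others : ∀ {n} (s : Colouring n) x i j →
    # ((λ v → is j (recolour s x i v)) ∖ x) ≡ # ((λ v → is j (s v)) ∖ x)
  #-others s x i j = #-cong same
    where
    same : ∀ v → ((λ v → is j (recolour s x i v)) ∖ x) v ≡ ((λ v → is j (s v)) ∖ x) v
    same v with v Fin.≟ x
    ... | yes _ = trans (∧-zeroʳ (is j i)) (sym (∧-zeroʳ (is j (s v))))
    ... | no _ = refl

module _ {n : ℕ} (s : Colouring n) (x : Fin n) where
  private
    drop : ∀ (p : Fin n → Bool) → ¬ T (p x) → # (p ∖ x) ≡ # p
    drop p ¬t = #-cong same
      where
      same : ∀ v → (p ∖ x) v ≡ p v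
      same v with v Fin.≟ x | p v in eq
      ... | yes refl | true = ⊥-elim (¬t (subst T (sym eq) tt))
      ... | yes _ | false = refl
      ... | no _ | true = refl
      ... | no _ | false = refl

  recolour-lose : ∀ {i j} → s x ≡ j → i ≢ j → size s j ≡ suc (size (recolour s x i) j)
  recolour-lose {i} {j} e ne = trans (size≡# s j) (trans (#-∖ (λ v → is j (s v)) x (is⁺ e))
    (cong suc (trans (sym (#-others s x i j)) (trans
      (drop _ (λ t → ne (trans (sym (recolour-at s x i)) (is⁻ t)))) (sym (size≡# (recolour s x i) j))))))

  recolour-gain : ∀ {i} → s x ≢ i → size (recolour s x i) i ≡ suc (size s i)
  recolour-gain {i} ne = trans (size≡# (recolour s x i) i)
    (trans (#-∖ (λ v → is i (recolour s x i v)) x (is⁺ (recolour-at s x i)))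
      (cong suc (trans (#-others s x i i) (trans (drop _ (λ t → ne (is⁻ t))) (sym (size≡# s i))))))

  recolour-≤ : ∀ {i j} → i ≢ j → size (recolour s x i) j ≤ size s j
  recolour-≤ {i} {j} ne = size-mono keep
    where
    keep : ∀ v → recolour s x i v ≡ j → s v ≡ j
    keep v e with recolour⁻ s x i v e
    ... | inj₁ (_ , p) = ⊥-elim (ne p)
    ... | inj₂ (_ , p) = p

  recolour-≤suc : ∀ {i} → size (recolour s x i) i ≤ suc (size s i)
  recolour-≤suc {i} with s x ≟ˢ i
  ... | no ne = ≤-reflexive (recolour-gain ne)
  ... | yes e = ≤-trans (size-mono keep) (n≤1+n _)
    where
    keep : ∀ v → recolour s x i v ≡ i → s v ≡ i
    keep v f with recolour⁻ s x i v f
    ... | inj₁ (refl , _) = e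
    ... | inj₂ (_ , g) = g

flip-size : ∀ {n} (s : Colouring n) i → size (flip s) i ≡ size s (op i)
flip-size s i = trans (size≡# (flip s) i) (trans (#-cong (λ v → is-op i (s v))) (sym (size≡# s (op i))))

op-injective : ∀ {i j} → op i ≡ op j → i ≡ j
op-injective {i} {j} e = trans (sym (op-involutive i)) (trans (cong op e) (op-involutive j))

size-1-unique : ∀ {n} (s : Colouring n) {i g} → s g ≡ i → size s i ≤ 1 → ∀ x → s x ≡ i → x ≡ g
size-1-unique s {i} e le x ex with size-closed s i ([] ∷ []) (e ∷ []) le ex
... | here p = p

-- Separations of order at most five

module Separation {n : ℕ} (G : Graph n) (simple : IsSimple G) (quasi : QuasiConnected 5 G)
  (degrees : ∀ x y → Dist12 G x y → deg G x + deg G y ≥ 9) where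

  infix 4 _~_
  _~_ : Fin n → Fin n → Set
  u ~ v = E G u v

  ~-sym : ∀ {u v} → u ~ v → v ~ u
  ~-sym {u} {v} = subst T (proj₁ simple u v)

  ~-irrefl : ∀ {u} → ¬ u ~ u
  ~-irrefl {u} t = subst T (proj₂ simple u) t

  ~⇒≢ : ∀ {u v} → u ~ v → u ≢ v
  ~⇒≢ t refl = ~-irrefl t

  _~?_ : ∀ u v → Dec (u ~ v)
  u ~? v = T? (G u v)

  deg≡ : ∀ x → deg G x ≡ # (G x)
  deg≡ x = ∣tabulate∣ (G x)

  deg-distinct : ∀ x {xs} → Distinct xs → All (x ~_) xs → length xs ≤ deg G x
  deg-distinct x ds ts = ≤-trans (#-distinct (G x) ds ts) (≡⇒≥ (deg≡ x))

  deg-cover : ∀ x xs → (∀ u → x ~ u → u ∈ xs) → deg G x ≤ length xs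
  deg-cover x xs h = ≤-trans (≤-reflexive (deg≡ x)) (#-cover (G x) xs h)

  nbr-fresh : ∀ x xs → length xs < deg G x → ∃[ u ] (x ~ u × u ∉ xs)
  nbr-fresh x xs lt = #-fresh (G x) xs (≤-trans lt (≤-reflexive (deg≡ x)))

  saturated : ∀ (q : Fin n → Bool) y → (∀ u → y ~ u → T (q u)) → # q ≤ deg G y → ∀ {x} → T (q x) → y ~ x
  saturated q y h le {x} t with y ~? x
  ... | yes a = a
  ... | no ¬a = ⊥-elim (<⇒≱ (≤-trans (s≤s (≤-trans (≤-reflexive (deg≡ y))
      (#-mono {q = q ∖ x} (λ u a → ∖⁺ q (h u a) (λ e → ¬a (subst (y ~_) e a))))))
      (≡⇒≥ (#-∖ q x t))) le)

  deg-M : ∀ (s : Colouring n) {y} → (∀ {u} → y ~ u → s u ≡ M) → deg G y ≤ size s M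
  deg-M s {y} h = ≤-trans (≤-reflexive (deg≡ y)) (≤-trans (#-mono λ u a → is⁺ (h a)) (≡⇒≥ (size≡# s M)))

  M-deg : ∀ (s : Colouring n) {y} → (∀ {u} → s u ≡ M → y ~ u) → size s M ≤ deg G y
  M-deg s {y} h = ≤-trans (≤-reflexive (size≡# s M)) (≤-trans (#-mono λ u t → h (is⁻ t)) (≡⇒≥ (deg≡ y)))

  saturated-M : ∀ (s : Colouring n) {y} → (∀ {u} → y ~ u → s u ≡ M) → size s M ≤ deg G y → ∀ {x} → s x ≡ M → y ~ x
  saturated-M s {y} h le e = saturated (λ u → is M (s u)) y (λ u a → is⁺ (h a)) (≤-trans (≡⇒≥ (size≡# s M)) le) (is⁺ e)

  Valid : Colouring n → Set
  Valid s = ∀ {u v} → u ~ v → s u ≡ L → s v ≡ R → ⊥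

  flip-valid : ∀ {s} → Valid s → Valid (flip s)
  flip-valid val a e f = val (~-sym a) (op-injective f) (op-injective e)

  valid-end : ∀ {s} → Valid s → ∀ e {u v} → u ~ v → s u ≡ side e → s v ≡ side (opp e) → ⊥
  valid-end val left a p q = val a p q
  valid-end val right a p q = val (~-sym a) q p

  -- A vertex coloured `R` lies on the opposite side of at least one of the two separations, so an
  -- edge to it from the corner would cross that one.
  corner-valid : ∀ {s s'} → Valid s → Valid s' → ∀ e e' → Valid (corner e e' s s')
  corner-valid val val' e e' a p q with join-L⁻ e e' p | join-R⁻ e e' q
  ... | i , j | inj₁ k = valid-end val e a i k
  ... | i , j | inj₂ k = valid-end val' e' a j k

  private
    cut : Colouring n → Subset n
    cut s = tabulate (λ v → is M (s v))

    ∣cut∣ : ∀ s → ∣ cut s ∣ ≡ size s M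
    ∣cut∣ s = trans (∣tabulate∣ _) (sym (size≡# s M))

    ∉cut : ∀ s {v i} → s v ≡ i → i ≢ M → v Subset.∉ cut s
    ∉cut s e ne m = ne (trans (sym e) (is⁻ (∈-tabulate⁻ (λ v → is M (s v)) m)))

    reach-L : ∀ {s} → Valid s → ∀ {u v} → s u ≡ L → Reach G (cut s) u v → s v ≡ L
    reach-L val e (here _) = e
    reach-L {s} val e (step {w} {v} r a ∉S) with s v in eq
    ... | L = refl
    ... | M = ⊥-elim (∉S (∈-tabulate⁺ (λ v → is M (s v)) (is⁺ eq)))
    ... | R = ⊥-elim (val a (reach-L val e r) eq)

    is-cut : ∀ {s} → Valid s → ∀ {u v} → s u ≡ L → s v ≡ R → IsCut G (cut s)
    is-cut {s} val {u} {v} e f = u , v , ∉cut s e (λ ()) , ∉cut s f (λ ()) ,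
      (λ r → absurd (reach-L val e r) f)

  no-3-cut : ∀ {s} → Valid s → size s M ≤ 3 → ∀ {u v} → s u ≡ L → s v ≡ R → ⊥
  no-3-cut {s} val le e f =
    proj₂ (proj₁ quasi) (cut s) (s≤s (≤-trans (≤-reflexive (∣cut∣ s)) le)) (is-cut val e f)

  no-nontrivial-4-cut : ∀ {s} → Valid s → size s M ≡ 4 → 2 ≤ size s L → 2 ≤ size s R → ⊥
  no-nontrivial-4-cut {s} val eq l r with size-fresh s L [] (≤-trans (n≤1+n 1) l) | size-fresh s R [] (≤-trans (n≤1+n 1) r)
  ... | u , e , _ | v , f , _ = proj₂ quasi (cut s) (trans (∣cut∣ s) eq)
    (is-cut val e f , tabulate (λ v → is L (s v)) ,
     (λ v m → ∉cut s (is⁻ (∈-tabulate⁻ (λ v → is L (s v)) m)) (λ ())) ,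
     separated ,
     ≤-trans l (≤-reflexive (trans (size≡# s L) (sym (∣tabulate∣ (λ v → is L (s v)))))) ,
     ≤-trans r (≡⇒≥ rest))
    where
    separated : ∀ u v → u Subset.∈ tabulate (λ v → is L (s v)) → v Subset.∉ tabulate (λ v → is L (s v)) →
      v Subset.∉ cut s → ¬ u ~ v
    separated u v mu nv nv' a with s v in eq
    ... | L = nv (∈-tabulate⁺ (λ v → is L (s v)) (is⁺ eq))
    ... | M = nv' (∈-tabulate⁺ (λ v → is M (s v)) (is⁺ eq))
    ... | R = val a (is⁻ (∈-tabulate⁻ (λ v → is L (s v)) mu)) eq
    neither : ∀ i → not (is L i ∨ is M i) ≡ is R i
    neither L = refl
    neither M = refl
    neither R = refl
    rest : ∣ ∁ (tabulate (λ v → is L (s v)) ∪ cut s) ∣ ≡ size s R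
    rest = trans (cong ∣_∣ (∁∪-tabulate (λ v → is L (s v)) (λ v → is M (s v))))
      (trans (∣tabulate∣ (λ v → not (is L (s v) ∨ is M (s v)))) (trans (#-cong (λ v → neither (s v))) (sym (size≡# s R))))

  -- The neighbourhood of `u` would be a cut with at most 3 vertices, unless `u` and its neighbours
  -- are the whole graph, which has more than 4 vertices.
  4≤deg : ∀ u → 4 ≤ deg G u
  4≤deg u = ≤-by-contra few
    where
    t star : Colouring n
    t v with u ~? v
    ... | yes _ = M
    ... | no _ = R
    star = recolour t u L
    t-M : ∀ {v} → t v ≡ M → u ~ v
    t-M {v} e with u ~? v
    ... | yes a = a
    t-R : ∀ {v} → t v ≡ R → ¬ u ~ v
    t-R {v} e with u ~? v
    ... | no na = na
    not-L : ∀ {v} → t v ≢ L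
    not-L {v} e with u ~? v
    not-L {v} () | yes _
    not-L {v} () | no _
    size-t : size t M ≤ deg G u
    size-t = M-deg t t-M
    star-valid : Valid star
    star-valid {a} {b} ab e f with recolour⁻ t u L a e | recolour⁻ t u L b f
    ... | inj₁ (refl , _) | inj₂ (_ , g) = t-R g ab
    ... | inj₂ (_ , g) | _ = not-L g
    few : suc (deg G u) ≤ 4 → ⊥
    few lt with any? (λ v → star v ≟ˢ R)
    ... | yes (v , e) = no-3-cut star-valid (≤-trans (≤-trans (recolour-≤ t u (λ ())) size-t) (s≤s⁻¹ lt)) (recolour-at t u L) e
    ... | no none = <⇒≱ (proj₁ (proj₁ quasi)) (≤-trans (≡⇒≥ (#-all n))
      (≤-trans (#-mono λ v _ → is⁺ (everything v)) (≤-trans (≡⇒≥ (size≡# (recolour t u M) M))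
        (≤-trans (recolour-≤suc t u) (≤-trans (s≤s size-t) lt)))))
      where
      everything : ∀ v → recolour t u M v ≡ M
      everything v with v Fin.≟ u
      ... | yes refl = recolour-at t u M
      ... | no ne with t v in e
      ...   | L = ⊥-elim (not-L e)
      ...   | M = trans (recolour-off t u M ne) e
      ...   | R = ⊥-elim (none (v , trans (recolour-off t u L ne) e))

  -- All neighbours of `g` lie in a cut with at most 4 vertices, and there are at least 4 of them,
  -- so they are the whole cut.
  singleton-side : ∀ {s} → Valid s → size s M ≤ 4 → ∀ {g} → s g ≡ L → (∀ x → s x ≡ L → x ≡ g) →
    deg G g ≡ 4 × (∀ y → s y ≡ M → g ~ y)
  singleton-side {s} val le {g} e uniq =
    ≤-antisym (≤-trans (deg-M s within) le) (4≤deg g) , λ y f → saturated-M s within (≤-trans le (4≤deg g)) f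
    where
    within : ∀ {v} → g ~ v → s v ≡ M
    within {v} a with s v in eq
    ... | L = ⊥-elim (~⇒≢ a (sym (uniq v eq)))
    ... | M = refl
    ... | R = ⊥-elim (val a e eq)

  record SmallCut (s : Colouring n) (g : Fin n) : Set where
    constructor small-cut
    field
      unique : ∀ x → s x ≡ L → x ≡ g
      deg4   : deg G g ≡ 4
      nbrs   : ∀ y → s y ≡ M → g ~ y

  -- Three vertices do not separate, so the cut has exactly 4; being trivial, with two vertices on
  -- side `R`, it leaves a single vertex on side `L`.
  small : ∀ {s} → Valid s → size s M ≤ 4 → 2 ≤ size s R → ∀ {g} → s g ≡ L → SmallCut s g
  small {s} val le r {g} e = small-cut uniq (proj₁ core) (proj₂ core)
    where
    uniq : ∀ x → s x ≡ L → x ≡ g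
    uniq x f with x Fin.≟ g
    ... | yes p = p
    ... | no ne with size s M ≤? 3
    ...   | yes le3 = ⊥-elim (no-3-cut val le3 e (proj₁ (proj₂ (size-fresh s R [] (≤-trans (n≤1+n 1) r)))))
    ...   | no gt3 = ⊥-elim (no-nontrivial-4-cut val (≤-antisym le (≰⇒> gt3))
            (size-distinct s L ((ne ∷ []) ∷ [] ∷ []) (f ∷ e ∷ [])) r)
    core : deg G g ≡ 4 × (∀ y → s y ≡ M → g ~ y)
    core = singleton-side val le e uniq

  -- The degree sum would be 8, below the required 9.
  close-4 : ∀ {g v} → deg G g ≡ 4 → deg G v ≡ 4 → g ≢ v → g ~ v ⊎ ∃[ z ] (g ~ z × z ~ v) → ⊥
  close-4 {g} {v} p q ne c = <⇒≱ (≤-refl {9}) (subst₂ (λ a b → 9 ≤ a + b) p q (degrees g v (ne , c)))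

  record Sep5 (s : Colouring n) : Set where
    constructor sep5
    field
      valid  : Valid s
      size-M : size s M ≡ 5
      size-L : 2 ≤ size s L
      size-R : 2 ≤ size s R

  open Sep5 public

  flip-sep : ∀ {s} → Sep5 s → Sep5 (flip s)
  flip-sep {s} p = sep5 (flip-valid {s} (valid p)) (trans (flip-size s M) (size-M p))
    (≤-trans (size-R p) (≡⇒≥ (flip-size s L)))
    (≤-trans (size-L p) (≡⇒≥ (flip-size s R)))

  missing-one : ∀ {s x y v} → Sep5 s → s x ≡ L → s y ≡ L → (∀ {u} → s u ≡ L → u ≡ x ⊎ u ≡ y) → s v ≡ M → ¬ y ~ v →
    5 ≤ deg G y → ∀ {u} → s u ≡ M → u ≢ v → y ~ u
  missing-one {s} {x} {y} {v} p s-x s-y closed s-v y≁v five e ne = saturated-M t within (≤-trans (≤-reflexive size-5) five) (on-cut e ne)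
    where
    s⁺ t : Colouring n
    s⁺ = recolour s x M
    t = recolour s⁺ v R
    s⁺v : s⁺ v ≡ M
    s⁺v = trans (recolour-off s x M (side-≢ s s-v s-x)) s-v
    size-5 : size t M ≡ 5
    size-5 = suc-injective (trans (sym (recolour-lose s⁺ v s⁺v (λ ())))
      (trans (recolour-gain s x (λ e → absurd s-x e)) (cong suc (size-M p))))
    on-cut : ∀ {w} → s w ≡ M → w ≢ v → t w ≡ M
    on-cut e ne = trans (recolour-off s⁺ v R ne) (trans (recolour-off s x M (side-≢ s e s-x)) e)
    within : ∀ {w} → y ~ w → t w ≡ M
    within {w} yw with s w in e
    ... | M = on-cut e (λ { refl → y≁v yw })
    ... | R = ⊥-elim (valid p yw s-y e)
    ... | L with closed e
    ...   | inj₁ refl = trans (recolour-off s⁺ v R (side-≢ s s-x s-v)) (recolour-at s x M)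
    ...   | inj₂ refl = ⊥-elim (~-irrefl yw)

  end-size : ∀ {s} → Sep5 s → ∀ e → 2 ≤ size s (side e)
  end-size p left = size-L p
  end-size p right = size-R p

  corner-R : ∀ {s} → Sep5 s → ∀ s' e e' → 2 ≤ size (corner e e' s s') R
  corner-R {s} p s' e e' = ≤-trans (end-size p (opp e)) (size-mono (λ v f → join-R⁺ e e' f))

  drop-valid : ∀ {s u} → Valid s → (∀ {y} → u ~ y → s y ≡ L → ⊥) → Valid (recolour s u R)
  drop-valid {s} {u} val none {a} {b} ab i j with recolour⁻ s u R a i | recolour⁻ s u R b j
  ... | inj₂ (_ , k) | inj₁ (refl , _) = none (~-sym ab) k
  ... | inj₂ (_ , k) | inj₂ (_ , l) = val ab k l

  -- Moving a vertex of the cut with no neighbour in L into R leaves a nontrivial 4-cut.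
  nbr-L : ∀ {s} → Sep5 s → ∀ {u} → s u ≡ M → ∃[ y ] (u ~ y × s y ≡ L)
  nbr-L {s} p {u} e with any? (λ y → u ~? y ×-dec (s y ≟ˢ L))
  ... | yes w = w
  ... | no none = ⊥-elim (no-nontrivial-4-cut {recolour s u R}
      (drop-valid {s} (valid p) λ a f → none (_ , a , f))
      (suc-injective (trans (sym (recolour-lose s u e (λ ()))) (size-M p)))
      (≤-trans (size-L p) (size-mono (λ v f → trans (recolour-off s u R (λ q → absurd (trans (cong s (sym q)) f) e)) f)))
      (≤-trans (size-R p) (≤-trans (n≤1+n _) (≡⇒≥ (recolour-gain s u (λ q → absurd e q))))))

  nbr-R : ∀ {s} → Sep5 s → ∀ {u} → s u ≡ M → ∃[ y ] (u ~ y × s y ≡ R)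
  nbr-R p e with y , a , f ← nbr-L (flip-sep p) (cong op e) = y , a , op-injective f

  -- How contracting xy can fail to keep G quasi 5-connected.
  Common4 : Fin n → Fin n → Set
  Common4 x y = ∃[ g ] (deg G g ≡ 4 × g ~ x × g ~ y)

  Separated : Fin n → Fin n → Set
  Separated x y = ∃[ s ] (Sep5 s × s x ≡ M × s y ≡ M)

  Uncontractible : Set
  Uncontractible = ∀ x y → x ~ y → Common4 x y ⊎ Separated x y

  corner-small : ∀ {s s'} → Sep5 s → Sep5 s' → ∀ e e' → boundary e e' s s' ≤ 4 →
    ∀ {g} → s g ≡ side e → s' g ≡ side e' → SmallCut (corner e e' s s') g
  corner-small {s} {s'} p p' e e' le i j =
    small (corner-valid {s} {s'} (valid p) (valid p') e e')
      (≤-trans (≤-reflexive (corner-M s s' e e')) le) (corner-R p s' e e') (join-L⁺ e e' i j)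

  row-M : ∀ {s} → Sep5 s → ∀ s' → total s s' (ML ∷ MM ∷ MR ∷ []) ≡ 5
  row-M {s} p s' = trans (sym (Rows.rowM s s')) (size-M p)

  col-M : ∀ {s'} → Sep5 s' → ∀ s → total s s' (LM ∷ MM ∷ RM ∷ []) ≡ 5
  col-M {s'} p s = trans (sym (Rows.colM s s')) (size-M p)

  -- The two equations saying that each cut has 5 vertices enter every refutation; together they
  -- give the sum 10 for opposite boundaries.
  refute₅ : ∀ {s s'} → Sep5 s → Sep5 s' → ∀ hs → Refutable (rowᴹ ≐ con 5 ∷ colᴹ ≐ con 5 ∷ hs) →
    cells s s' ⊢⊥ hs
  refute₅ {s} {s'} p p' hs t = fourier-motzkin (cells s s') (rowᴹ ≐ con 5 ∷ colᴹ ≐ con 5 ∷ hs) t (row-M p s') (col-M p' s)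

  row-L : ∀ {s} → Sep5 s → ∀ s' → 2 ≤ total s s' (LL ∷ LM ∷ LR ∷ [])
  row-L {s} p s' = ≤-trans (size-L p) (≤-reflexive (Rows.rowL s s'))

  row-R : ∀ {s} → Sep5 s → ∀ s' → 2 ≤ total s s' (RL ∷ RM ∷ RR ∷ [])
  row-R {s} p s' = ≤-trans (size-R p) (≤-reflexive (Rows.rowR s s'))

  col-L : ∀ {s'} → Sep5 s' → ∀ s → 2 ≤ total s s' (LL ∷ ML ∷ RL ∷ [])
  col-L {s'} p s = ≤-trans (size-L p) (≤-reflexive (Rows.colL s s'))

  col-R : ∀ {s'} → Sep5 s' → ∀ s → 2 ≤ total s s' (LR ∷ MR ∷ RR ∷ [])
  col-R {s'} p s = ≤-trans (size-R p) (≤-reflexive (Rows.colR s s'))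

-- A vertex of degree 4

module DegreeFour {n : ℕ} (G : Graph n) (simple : IsSimple G) (quasi : QuasiConnected 5 G)
  (degrees : ∀ x y → Dist12 G x y → deg G x + deg G y ≥ 9)
  (uncontractible : Separation.Uncontractible G simple quasi degrees)
  where
  open Separation G simple quasi degrees

  -- A common neighbour of degree 4 would be adjacent to `v`, itself of degree 4.
  separated-at : ∀ {v} → deg G v ≡ 4 → ∀ {y} → v ~ y → Separated v y
  separated-at {v} v4 {y} a with uncontractible v y a
  ... | inj₁ (g , g4 , gv , gy) = ⊥-elim (close-4 g4 v4 (~⇒≢ gv) (inj₁ gv))
  ... | inj₂ w = w

  record Crossing4 (s s' : Colouring n) : Set where
    constructor crossing4
    field
      LL≡0 : cell s s' L L ≡ 0
      LR≡0 : cell s s' L R ≡ 0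
      LM≡2 : cell s s' L M ≡ 2
      ML≡2 : cell s s' M L ≡ 2
      MR≡2 : cell s s' M R ≡ 2
      RM≡2 : cell s s' R M ≡ 2
      MM≡1 : cell s s' M M ≡ 1

  module At {v : Fin n} (v4 : deg G v ≡ 4) where

    -- A vertex alone in a corner would have degree 4 and be at distance at most two from v.
    crossing : ∀ {s s' y} → Sep5 s → Sep5 s' → s v ≡ M → s' v ≡ M → v ~ y → s y ≡ L → s' y ≡ M →
      (∀ {m} → v ~ m → s m ≡ L → m ≡ y) → Crossing4 s s'
    crossing {s} {s'} {y} p p' sv s'v vy sy s'y uniq = conclude
      where
      -- The only neighbour of `v` on side `L` of `s` is `y`, which lies in the cut of `s'`. So `v`
      -- has no neighbour in a left corner and can leave its boundary; this is why 5 is allowed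
      -- here. The lone corner vertex is then adjacent to `y`, at distance two from `v`.
      near : ∀ e' → boundary left e' s s' ≤ 5 → cell s s' L (side e') ≡ 0
      near e' le = cell-empty s s' impossible
        where
        κ = corner left e' s s'
        κ-v : κ v ≡ M
        κ-v = join-MM left e' sv s'v
        κ-y : κ y ≡ M
        κ-y = join-LM left e' sy s'y
        impossible : ∀ {g} → s g ≡ L → s' g ≡ side e' → ⊥
        impossible {g} i j = close-4 (SmallCut.deg4 cut) v4 (side-≢ s i sv) (inj₂ (y , SmallCut.nbrs cut y at-y , ~-sym vy))
          where
          at-y : recolour κ v R y ≡ M
          at-y = trans (recolour-off κ v R (side-≢ s sy sv)) κ-y
          no-nbr : ∀ {m} → v ~ m → κ m ≡ L → ⊥
          no-nbr {m} a f with k , l ← join-L⁻ left e' {s m} {s' m} f with refl ← uniq a k = M≢side e' (trans (sym s'y) l)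
            where
            M≢side : ∀ e' → M ≡ side e' → ⊥
            M≢side left ()
            M≢side right ()
          cut : SmallCut (recolour κ v R) g
          cut = small (drop-valid {κ} (corner-valid {s} {s'} (valid p) (valid p') left e') no-nbr)
            (s≤s⁻¹ (≤-trans (≤-reflexive (trans (sym (recolour-lose κ v κ-v (λ ()))) (corner-M s s' left e'))) le))
            (≤-trans (corner-R p s' left e') (size-mono (λ u f → trans (recolour-off κ v R (side-≢ κ f κ-v)) f)))
            (trans (recolour-off κ v R (side-≢ s i sv)) (join-L⁺ left e' i j))
      -- In a right corner `v` stays in the boundary, so the bound is 4 and the lone vertex is
      -- adjacent to `v` itself.
      far : ∀ e' → boundary right e' s s' ≤ 4 → cell s s' R (side e') ≡ 0
      far e' le = cell-empty s s' impossible
        where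
        impossible : ∀ {g} → s g ≡ R → s' g ≡ side e' → ⊥
        impossible {g} i j with cut ← corner-small p p' right e' le i j =
          close-4 (SmallCut.deg4 cut) v4 (side-≢ s i sv) (inj₁ (SmallCut.nbrs cut v (join-MM right e' sv s'v)))
      fm = refute₅ p p'
      a≥1 = cell-member s s' sy s'y
      t≥1 = cell-member s s' sv s'v
      conclude : Crossing4 s s'
      conclude with boundary left left s s' ≤? 5 | boundary left right s s' ≤? 5
      -- The two left boundaries add up to `5 + 2·lm + mm`, which is at most 10, while `lm ≥ 2`
      -- since both left corners are empty, and `mm ≥ 1`. Hence equality everywhere.
      ... | yes le | yes le' = crossing4 LL0 LR0
          (≡-by-contra (refute (con 3 ≼ lm) _) (refute (con 1 ⊕ lm ≼ con 2) _))
          (≡-by-contra (refute (con 3 ≼ ml) _) (refute (con 1 ⊕ ml ≼ con 2) _))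
          (≡-by-contra (refute (con 3 ≼ mr) _) (refute (con 1 ⊕ mr ≼ con 2) _))
          (≡-by-contra (refute (con 3 ≼ rm) _) (refute (con 1 ⊕ rm ≼ con 2) _))
          (≡-by-contra (refute (con 2 ≼ mm) _) (refute (con 1 ⊕ mm ≼ con 1) _))
        where
        LL0 = near left le
        LR0 = near right le'
        H : List (Constraint 9)
        H = con 1 ≼ mm ∷ con 2 ≼ rowᴸ ∷ ll ≐ con 0 ∷ lr ≐ con 0 ∷ bᴸᴸ ≼ con 5 ∷ bᴸᴿ ≼ con 5 ∷ []
        refute : ∀ c → Refutable (rowᴹ ≐ con 5 ∷ colᴹ ≐ con 5 ∷ c ∷ H) → Sat (cells s s') c → ⊥
        refute c t h = fm (c ∷ H) t h t≥1 (row-L p s') LL0 LR0 le le'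
      -- A boundary of 6 empties the opposite corner. Column `R` is then confined to `MR`, which
      -- makes the boundary at `RL` small and that corner empty too. Row `R`, now confined to `RM`,
      -- overfills the cut of `s'`. The next case is the mirror image.
      ... | no gt | yes le' = ⊥-elim (fm
          (con 6 ≼ bᴸᴸ ∷ con 1 ≼ mm ∷ lr ≐ con 0 ∷ rr ≐ con 0 ∷ rl ≐ con 0 ∷
           con 2 ≼ colᴿ ∷ con 2 ≼ rowᴿ ∷ []) _
          (≰⇒> gt) t≥1 LR0 RR0 RL0 (col-R p' s) (row-R p s'))
        where
        LR0 = near right le'
        RR0 = far right (≤-by-contra λ h → fm (con 6 ≼ bᴸᴸ ∷ con 5 ≼ bᴿᴿ ∷ []) _ (≰⇒> gt) h)
        RL0 = far left (≤-by-contra λ h → fm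
          (con 6 ≼ bᴸᴸ ∷ con 1 ≼ mm ∷ lr ≐ con 0 ∷ rr ≐ con 0 ∷ con 2 ≼ colᴿ ∷ con 5 ≼ bᴿᴸ ∷ []) _
          (≰⇒> gt) t≥1 LR0 RR0 (col-R p' s) h)
      ... | yes le | no gt = ⊥-elim (fm
          (con 6 ≼ bᴸᴿ ∷ con 1 ≼ mm ∷ ll ≐ con 0 ∷ rl ≐ con 0 ∷ rr ≐ con 0 ∷
           con 2 ≼ colᴸ ∷ con 2 ≼ rowᴿ ∷ []) _
          (≰⇒> gt) t≥1 LL0 RL0 RR0 (col-L p' s) (row-R p s'))
        where
        LL0 = near left le
        RL0 = far left (≤-by-contra λ h → fm (con 6 ≼ bᴸᴿ ∷ con 5 ≼ bᴿᴸ ∷ []) _ (≰⇒> gt) h)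
        RR0 = far right (≤-by-contra λ h → fm
          (con 6 ≼ bᴸᴿ ∷ con 1 ≼ mm ∷ ll ≐ con 0 ∷ rl ≐ con 0 ∷ con 2 ≼ colᴸ ∷ con 5 ≼ bᴿᴿ ∷ []) _
          (≰⇒> gt) t≥1 LL0 RL0 (col-L p' s) h)
      ... | no gt | no gt' = ⊥-elim (fm
          (con 6 ≼ bᴸᴸ ∷ con 6 ≼ bᴸᴿ ∷ con 1 ≼ mm ∷ rl ≐ con 0 ∷ rr ≐ con 0 ∷ con 2 ≼ rowᴿ ∷ []) _
          (≰⇒> gt) (≰⇒> gt') t≥1 RL0 RR0 (row-R p s'))
        where
        RR0 = far right (≤-by-contra λ h → fm (con 6 ≼ bᴸᴸ ∷ con 5 ≼ bᴿᴿ ∷ []) _ (≰⇒> gt) h)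
        RL0 = far left (≤-by-contra λ h → fm (con 6 ≼ bᴸᴿ ∷ con 5 ≼ bᴿᴸ ∷ []) _ (≰⇒> gt') h)

    record OneSided (s : Colouring n) : Set where
      field
        {s₁} : Colouring n
        {m}  : Fin n
        sep  : Sep5 s₁
        same : ∀ {u} → s u ≡ M → s₁ u ≡ M
        adj  : v ~ m
        at-m : s₁ m ≡ L
        only : ∀ {u} → v ~ u → s₁ u ≡ L → u ≡ m

    -- Of the three neighbours of v other than y, each side of the cut has at least one.
    one-sided : ∀ {s y} → Sep5 s → s v ≡ M → v ~ y → s y ≡ M → OneSided s
    one-sided {s} {y} p sv vy sy with nbr-L p sv | nbr-R p sv
    ... | a , va , sa | b , vb , sb
      with any? (λ c → v ~? c ×-dec ((s c ≟ˢ L) ×-dec ¬? (c Fin.≟ a)))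
         | any? (λ c → v ~? c ×-dec ((s c ≟ˢ R) ×-dec ¬? (c Fin.≟ b)))
    ... | no none | _ = record { sep = p ; same = λ e → e ; adj = va ; at-m = sa ; only = λ {u} vu su → unique u vu su }
      where
      unique : ∀ u → v ~ u → s u ≡ L → u ≡ a
      unique u vu su with u Fin.≟ a
      ... | yes e = e
      ... | no ne = ⊥-elim (none (u , vu , su , ne))
    ... | yes _ | no none = record { sep = flip-sep p ; same = cong op ; adj = vb ; at-m = cong op sb ; only = λ {u} vu su → unique u vu (op-injective su) }
      where
      unique : ∀ u → v ~ u → s u ≡ R → u ≡ b
      unique u vu su with u Fin.≟ b
      ... | yes e = e
      ... | no ne = ⊥-elim (none (u , vu , su , ne))
    ... | yes (a' , va' , sa' , a'≢a) | yes (b' , vb' , sb' , b'≢b) =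
      ⊥-elim (<⇒≱ (≤-refl {5}) (≤-trans (deg-distinct v
        ((side-≢ s sy sa ∷ side-≢ s sy sa' ∷ side-≢ s sy sb ∷ side-≢ s sy sb' ∷ []) ∷
         (a'≢a ∘ sym ∷ side-≢ s sa sb ∷ side-≢ s sa sb' ∷ []) ∷
         (side-≢ s sa' sb ∷ side-≢ s sa' sb' ∷ []) ∷
         (b'≢b ∘ sym ∷ []) ∷ [] ∷ [])
        (vy ∷ va ∷ va' ∷ vb ∷ vb' ∷ [])) (≤-reflexive v4)))

    -- Side `L` is the pair of `y` and `c`. Where the adjacency of the two matters, the alternative
    -- of degree 4 in `c~y` is refuted by a path of length two from `c` to `v` through the cut.
    record Pendant (s : Colouring n) (y : Fin n) : Set where
      field
        {c}    : Fin n
        c≢y    : c ≢ y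
        at-c   : s c ≡ L
        closed : ∀ {u} → s u ≡ L → u ≡ y ⊎ u ≡ c
        v≁c    : ¬ v ~ c
        c~cut  : ∀ {u} → s u ≡ M → u ≢ v → c ~ u
        c~y    : c ~ y ⊎ deg G c ≡ 4

    -- Crossing with the cut through `v` and `y` leaves 0 + 2 + 0 vertices on side `L`. The
    -- neighbours of `c` are among `y` and the four cut vertices other than `v`: if `c` misses `y`,
    -- degree at least 4 forces all four; if not, `c` is at distance two from `v` and has degree at
    -- least 5, which forces all four again.
    pendant : ∀ {s y} → Sep5 s → s v ≡ M → v ~ y → s y ≡ L → (∀ {m} → v ~ m → s m ≡ L → m ≡ y) → Pendant s y
    pendant {s} {y} p sv vy sy uniq with separated-at v4 vy
    ... | s' , p' , s'v , s'y = record
      { c≢y = c≢y ; at-c = sc ; closed = closed ; v≁c = v≁c ; c~cut = c~cut ; c~y = c~y }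
      where
      X = crossing p p' sv s'v vy sy s'y uniq
      size-2 : size s L ≡ 2
      size-2 = trans (Rows.rowL s s') (cong₂ _+_ (Crossing4.LL≡0 X) (cong₂ _+_ (Crossing4.LM≡2 X) (cong (_+ 0) (Crossing4.LR≡0 X))))
      second = size-fresh s L (y ∷ []) (≡⇒≥ size-2)
      c = proj₁ second
      sc = proj₁ (proj₂ second)
      c≢y : c ≢ y
      c≢y e = proj₂ (proj₂ second) (here e)
      closed : ∀ {u} → s u ≡ L → u ≡ y ⊎ u ≡ c
      closed e with size-closed s L ((c≢y ∘ sym ∷ []) ∷ [] ∷ []) (sy ∷ sc ∷ []) (≤-reflexive size-2) e
      ... | here q = inj₁ q
      ... | there (here q) = inj₂ q
      v≁c : ¬ v ~ c
      v≁c a = c≢y (uniq a sc)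
      c≢v : c ≢ v
      c≢v = side-≢ s sc sv
      nbrs : ∀ u → c ~ u → u ≡ y ⊎ (s u ≡ M × u ≢ v)
      nbrs u a with s u in su
      ... | M = inj₂ (refl , λ e → v≁c (~-sym (subst (c ~_) e a)))
      ... | R = ⊥-elim (valid p a sc su)
      ... | L with closed su
      ...   | inj₁ q = inj₁ q
      ...   | inj₂ q = ⊥-elim (~⇒≢ a (sym q))
      alone : ¬ c ~ y → ∀ {u} → c ~ u → recolour s v R u ≡ M
      alone c≁y {u} a with nbrs u a
      ... | inj₁ refl = ⊥-elim (c≁y a)
      ... | inj₂ (su , u≢v) = trans (recolour-off s v R u≢v) su
      size-4 : size (recolour s v R) M ≡ 4
      size-4 = suc-injective (trans (sym (recolour-lose s v sv (λ ()))) (size-M p))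
      c~y : c ~ y ⊎ deg G c ≡ 4
      c~y with c ~? y
      ... | yes a = inj₁ a
      ... | no na = inj₂ (≤-antisym (≤-trans (deg-M _ (alone na)) (≤-reflexive size-4)) (4≤deg c))
      c~cut : ∀ {u} → s u ≡ M → u ≢ v → c ~ u
      c~cut {u} su u≢v with c ~? y
      ... | no na = saturated-M _ (alone na) (≤-trans (≤-reflexive size-4) (4≤deg c)) (trans (recolour-off s v R u≢v) su)
      ... | yes cy = missing-one p sy sc closed sv (λ a → v≁c (~-sym a)) 5≤deg su u≢v
        where
        5≤deg : 5 ≤ deg G c
        5≤deg = ≤-by-contra λ lt → close-4 (≤-antisym (s≤s⁻¹ lt) (4≤deg c)) v4 c≢v (inj₂ (y , cy , ~-sym vy))

    record Configuration : Set where
      field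
        {s s'}       : Colouring n
        {y y₂ m m₂}  : Fin n
        sep          : Sep5 s
        sep'         : Sep5 s'
        s-v          : s v ≡ M
        s'-v         : s' v ≡ M
        s-y          : s y ≡ L
        s-y₂         : s y₂ ≡ L
        s-closed     : ∀ {u} → s u ≡ L → u ≡ y ⊎ u ≡ y₂
        s'-m         : s' m ≡ L
        s'-m₂        : s' m₂ ≡ L
        s'-closed    : ∀ {u} → s' u ≡ L → u ≡ m ⊎ u ≡ m₂
        s-m          : s m ≡ M
        s-m₂         : s m₂ ≡ M
        s'-y         : s' y ≡ M
        s'-y₂        : s' y₂ ≡ M
        meet         : ∀ {u} → s u ≡ M → s' u ≡ M → u ≡ v
        MR≡2         : cell s s' M R ≡ 2
        RM≡2         : cell s s' R M ≡ 2
        v~y          : v ~ y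
        v~m          : v ~ m
        v≁y₂         : ¬ v ~ y₂
        v≁m₂         : ¬ v ~ m₂
        y₂~y         : y₂ ~ y
        m₂~m         : m₂ ~ m
        y₂~cut       : ∀ {u} → s u ≡ M → u ≢ v → y₂ ~ u
        m₂~cut       : ∀ {u} → s' u ≡ M → u ≢ v → m₂ ~ u

    -- The pendant side {y , y₂} at a cut through v yields, via the edge vy, a second cut through v
    -- with pendant side {m , m₂} that lies inside the first cut.
    configuration : Configuration
    configuration with nbr-fresh v [] (≤-trans (s≤s z≤n) (4≤deg v))
    ... | w , vw , _ with separated-at v4 vw
    ... | σ , pσ , σv , σw with one-sided pσ σv vw σw
    ... | o with separated-at v4 (OneSided.adj o)
    ... | τ , pτ , τv , τy with one-sided pτ τv (OneSided.adj o) τy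
    ... | o' = record
      { sep = sep o ; sep' = sep o' ; s-v = s-v ; s'-v = s'-v ; s-y = at-m o ; s-y₂ = at-c P ; s-closed = closed P
      ; s'-m = at-m o' ; s'-m₂ = at-c P' ; s'-closed = closed P' ; s-m = proj₁ s-mm₂ ; s-m₂ = proj₂ s-mm₂
      ; s'-y = s'-y ; s'-y₂ = s'-y₂ ; meet = meet ; MR≡2 = Crossing4.MR≡2 X ; RM≡2 = Crossing4.RM≡2 X
      ; v~y = adj o ; v~m = adj o' ; v≁y₂ = v≁c P ; v≁m₂ = v≁c P'
      ; y₂~y = y₂~y ; m₂~m = m₂~m ; y₂~cut = c~cut P ; m₂~cut = c~cut P' }
      where
      open OneSided
      open Pendant
      s-v = same o σv
      s'-v = same o' τv
      s'-y = same o' τy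
      P = pendant (sep o) s-v (adj o) (at-m o) (only o)
      P' = pendant (sep o') s'-v (adj o') (at-m o') (only o')
      X = crossing (sep o) (sep o') s-v s'-v (adj o) (at-m o) s'-y (only o)
      -- Cell `LM` has two vertices and so has side `L` of the first cut, so the whole pair lies in
      -- the second cut; likewise cell `ML` is the pair of the second cut.
      s'-y₂ : s₁ o' (c P) ≡ M
      s'-y₂ with size-fresh-M ← cell-fresh (s₁ o) (s₁ o') L M (m o ∷ []) (≡⇒≥ (Crossing4.LM≡2 X))
        with u , su , s'u , new ← size-fresh-M with closed P su
      ... | inj₁ refl = ⊥-elim (new (here refl))
      ... | inj₂ refl = s'u
      meet : ∀ {u} → s₁ o u ≡ M → s₁ o' u ≡ M → u ≡ v
      meet e f with cell-closed (s₁ o) (s₁ o') M M ([] ∷ []) ((s-v , s'-v) ∷ []) (≤-reflexive (Crossing4.MM≡1 X)) e f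
      ... | here q = q
      s-mm₂ : s₁ o (m o') ≡ M × s₁ o (c P') ≡ M
      s-mm₂ with a , sa , s'a , _ ← cell-fresh (s₁ o) (s₁ o') M L [] (≤-trans (s≤s z≤n) (≡⇒≥ (Crossing4.ML≡2 X)))
        with b , sb , s'b , new ← cell-fresh (s₁ o) (s₁ o') M L (a ∷ []) (≡⇒≥ (Crossing4.ML≡2 X))
        with closed P' s'a | closed P' s'b
      ... | inj₁ refl | inj₁ refl = ⊥-elim (new (here refl))
      ... | inj₁ refl | inj₂ refl = sa , sb
      ... | inj₂ refl | inj₁ refl = sb , sa
      ... | inj₂ refl | inj₂ refl = ⊥-elim (new (here refl))
      y₂~y : c P ~ m o
      y₂~y with c~y P
      ... | inj₁ a = a
      ... | inj₂ d = ⊥-elim (close-4 d v4 (side-≢ (s₁ o) (at-c P) s-v)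
        (inj₂ (m o' , c~cut P (proj₁ s-mm₂) (side-≢ (s₁ o') (at-m o') s'-v) , ~-sym (adj o'))))
      m₂~m : c P' ~ m o'
      m₂~m with c~y P'
      ... | inj₁ a = a
      ... | inj₂ d = ⊥-elim (close-4 d v4 (side-≢ (s₁ o') (at-c P') s'-v)
        (inj₂ (m o , c~cut P' s'-y (side-≢ (s₁ o) (at-m o) s-v) , ~-sym (adj o))))

    far-degree : ∀ {g} → g ≢ v → g ~ v ⊎ ∃[ z ] (g ~ z × z ~ v) → 5 ≤ deg G g
    far-degree {g} ne c = ≤-by-contra λ lt → close-4 (≤-antisym (s≤s⁻¹ lt) (4≤deg g)) v4 ne c

-- Two crossing pendant pairs

module Configured {n : ℕ} (G : Graph n) (simple : IsSimple G) (quasi : QuasiConnected 5 G)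
  (degrees : ∀ x y → Dist12 G x y → deg G x + deg G y ≥ 9)
  (uncontractible : Separation.Uncontractible G simple quasi degrees)
  {v : Fin n} (v4 : deg G v ≡ 4) (C : DegreeFour.At.Configuration G simple quasi degrees uncontractible v4)
  where
  open Separation G simple quasi degrees
  open DegreeFour G simple quasi degrees uncontractible
  open At v4
  open Configuration C

  y≢v : y ≢ v
  y≢v = side-≢ s s-y s-v
  y₂≢v : y₂ ≢ v
  y₂≢v = side-≢ s s-y₂ s-v
  m≢v : m ≢ v
  m≢v = side-≢ s' s'-m s'-v
  m₂≢v : m₂ ≢ v
  m₂≢v = side-≢ s' s'-m₂ s'-v
  y₂~m : y₂ ~ m
  y₂~m = y₂~cut s-m m≢v
  m₂~y : m₂ ~ y
  m₂~y = m₂~cut s'-y y≢v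

  data Nbr-y (u : Fin n) : Set where
    is-y₂ : u ≡ y₂ → Nbr-y u
    is-v  : u ≡ v → Nbr-y u
    is-m  : u ≡ m → Nbr-y u
    is-m₂ : u ≡ m₂ → Nbr-y u
    is-q  : s u ≡ M → s' u ≡ R → Nbr-y u

  cut-cases : ∀ {u} → s u ≡ M → Nbr-y u
  cut-cases {u} e with s' u in f
  ... | M = is-v (meet e f)
  ... | R = is-q e f
  ... | L with s'-closed f
  ...   | inj₁ p = is-m p
  ...   | inj₂ p = is-m₂ p

  nbr-y : ∀ {u} → y ~ u → Nbr-y u
  nbr-y {u} a with s u in e
  ... | M = cut-cases e
  ... | R = ⊥-elim (valid sep a s-y e)
  ... | L with s-closed e
  ...   | inj₁ p = ⊥-elim (~⇒≢ a (sym p))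
  ...   | inj₂ p = is-y₂ p

  data Nbr-y₂ (u : Fin n) : Set where
    is-y  : u ≡ y → Nbr-y₂ u
    is-m  : u ≡ m → Nbr-y₂ u
    is-m₂ : u ≡ m₂ → Nbr-y₂ u
    is-q  : s u ≡ M → s' u ≡ R → Nbr-y₂ u

  nbr-y₂ : ∀ {u} → y₂ ~ u → Nbr-y₂ u
  nbr-y₂ {u} a with s u in e
  ... | R = ⊥-elim (valid sep a s-y₂ e)
  ... | L with s-closed e
  ...   | inj₁ p = is-y p
  ...   | inj₂ p = ⊥-elim (~⇒≢ a (sym p))
  nbr-y₂ {u} a | M with cut-cases e
  ...   | is-v refl = ⊥-elim (v≁y₂ (~-sym a))
  ...   | is-y₂ refl = absurd s-y₂ e
  ...   | is-m p = is-m p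
  ...   | is-m₂ p = is-m₂ p
  ...   | is-q p q = is-q p q

  data Nbr-m (u : Fin n) : Set where
    is-m₂ : u ≡ m₂ → Nbr-m u
    is-v  : u ≡ v → Nbr-m u
    is-y  : u ≡ y → Nbr-m u
    is-y₂ : u ≡ y₂ → Nbr-m u
    is-r  : s u ≡ R → s' u ≡ M → Nbr-m u

  nbr-m : ∀ {u} → m ~ u → Nbr-m u
  nbr-m {u} a with s' u in f
  ... | R = ⊥-elim (valid sep' a s'-m f)
  ... | L with s'-closed f
  ...   | inj₁ p = ⊥-elim (~⇒≢ a (sym p))
  ...   | inj₂ p = is-m₂ p
  nbr-m {u} a | M with s u in e
  ...   | M = is-v (meet e f)
  ...   | R = is-r e f
  ...   | L with s-closed e
  ...     | inj₁ p = is-y p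
  ...     | inj₂ p = is-y₂ p

  cut-meets-in-v : ∀ {σ} → Sep5 σ → σ v ≡ M → σ y ≡ M → ∀ {u} → s u ≡ M → σ u ≡ M → u ≡ v
  cut-meets-in-v {σ} pσ σv σy {u} e f
    with cell-closed s σ M M ([] ∷ []) ((s-v , σv) ∷ [])
           (≤-reflexive (Crossing4.MM≡1 (crossing sep pσ s-v σv v~y s-y σy only-y))) e f
    where
    only-y : ∀ {w} → v ~ w → s w ≡ L → w ≡ y
    only-y vw sw with s-closed sw
    ... | inj₁ p = p
    ... | inj₂ refl = ⊥-elim (v≁y₂ vw)
  ... | here p = p

  cut'-meets-in-v : ∀ {σ} → Sep5 σ → σ v ≡ M → σ m ≡ M → ∀ {u} → s' u ≡ M → σ u ≡ M → u ≡ v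
  cut'-meets-in-v {σ} pσ σv σm {u} e f
    with cell-closed s' σ M M ([] ∷ []) ((s'-v , σv) ∷ [])
           (≤-reflexive (Crossing4.MM≡1 (crossing sep' pσ s'-v σv v~m s'-m σm only-m))) e f
    where
    only-m : ∀ {w} → v ~ w → s' w ≡ L → w ≡ m
    only-m vw sw with s'-closed sw
    ... | inj₁ p = p
    ... | inj₂ refl = ⊥-elim (v≁m₂ vw)
  ... | here p = p

  module _ {σ : Colouring n} (pσ : Sep5 σ) (σy : σ y ≡ M) (σy₂ : σ y₂ ≡ M) (σv : σ v ≡ L) where
    private
      fm = refute₅ sep pσ
      LM≥2 : 2 ≤ cell s σ L M
      LM≥2 = cell-distinct s σ L M ((~⇒≢ y₂~y ∷ []) ∷ [] ∷ []) ((s-y₂ , σy₂) ∷ (s-y , σy) ∷ [])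
      L-in-M : ∀ {u} → s u ≡ L → σ u ≡ M
      L-in-M e with s-closed e
      ... | inj₁ refl = σy
      ... | inj₂ refl = σy₂

    -- Side `L` of `s` lies in the cut of `σ`, so `lm ≥ 2` and `LL` is empty. With `ml ≤ 1` the
    -- boundary at `RL` would have at most 4 vertices, `v` among them; a vertex there would have
    -- degree 4 and be adjacent to `v`. So column `L` would have at most one vertex.
    cut-in-L : 2 ≤ cell s σ M L
    cut-in-L = ≤-by-contra λ lt → fm
      (ll ≐ con 0 ∷ rl ≐ con 0 ∷ con 2 ≼ colᴸ ∷ con 1 ⊕ ml ≼ con 2 ∷ []) _
      (cell-empty s σ λ e f → absurd (L-in-M e) f)
      (cell-empty s σ λ e f → let cut = corner-small sep pσ right left
                                    (≤-by-contra λ gt → fm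
                                      (con 2 ≼ lm ∷ con 1 ⊕ ml ≼ con 2 ∷
                                       con 5 ≼ bᴿᴸ ∷ []) _ LM≥2 lt gt) e f
                              in close-4 (SmallCut.deg4 cut) v4 (side-≢ s e s-v) (inj₁ (SmallCut.nbrs cut v (cong₂ (join right left) s-v σv))))
      (col-L pσ s) lt

    -- The mirror image of `cut-in-L`; now `v` is not in the boundary, and `m` supplies the path of
    -- length two to it.
    cut-in-R : σ m ≡ M → 2 ≤ cell s σ M R
    cut-in-R σm = ≤-by-contra λ lt → fm
      (lr ≐ con 0 ∷ rr ≐ con 0 ∷ con 2 ≼ colᴿ ∷ con 1 ⊕ mr ≼ con 2 ∷ []) _
      (cell-empty s σ λ e f → absurd (L-in-M e) f)
      (cell-empty s σ λ e f → let cut = corner-small sep pσ right right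
                                    (≤-by-contra λ gt → fm
                                      (con 2 ≼ lm ∷ con 1 ⊕ mr ≼ con 2 ∷
                                       con 5 ≼ bᴿᴿ ∷ []) _ LM≥2 lt gt) e f
                              in close-4 (SmallCut.deg4 cut) v4 (side-≢ s e s-v)
                                   (inj₂ (m , SmallCut.nbrs cut m (cong₂ (join right right) s-m σm) , ~-sym v~m)))
      (col-R pσ s) lt

    cut-not-balanced : σ m ≡ M → 2 ≤ cell s σ M M → ⊥
    cut-not-balanced σm mm≥2 = fm
      (con 2 ≼ ml ∷ con 2 ≼ mm ∷ con 2 ≼ mr ∷ []) _
      cut-in-L mm≥2 (cut-in-R σm)

    cut-in-L-M : ∀ {u} → s u ≡ L → σ u ≡ M
    cut-in-L-M = L-in-M

  module _ {σ : Colouring n} (pσ : Sep5 σ) (σy₂ : σ y₂ ≡ M) (σm : σ m ≡ M) (σv : σ v ≡ L) (σm₂ : σ m₂ ≡ R) where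
    private
      σy : σ y ≡ M
      σy with σ y in e
      ... | L = ⊥-elim (valid pσ (~-sym m₂~y) e σm₂)
      ... | M = refl
      ... | R = ⊥-elim (valid pσ v~y σv e)
      only-v : ∀ {u} → m ~ u → σ u ≡ L → u ≡ v
      only-v a σu with nbr-m a
      ... | is-m₂ refl = absurd σm₂ σu
      ... | is-v p = p
      ... | is-y refl = absurd σy σu
      ... | is-y₂ refl = absurd σy₂ σu
      ... | is-r e f = ⊥-elim (valid pσ (~-sym (m₂~cut f (side-≢ s e s-v))) σu σm₂)
      -- As `v` is the only neighbour of `m` in `L`, exchanging the two gives again a separation of
      -- order 5, with `v` in the cut and `m` on side `R`.
      σ⁺ τ : Colouring n
      σ⁺ = recolour σ m R
      τ = recolour σ⁺ v M
      v≢m : v ≢ m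
      v≢m = side-≢ σ σv σm
      σ⁺v : σ⁺ v ≡ L
      σ⁺v = trans (recolour-off σ m R v≢m) σv
      τv : τ v ≡ M
      τv = recolour-at σ⁺ v M
      τm : τ m ≡ R
      τm = trans (recolour-off σ⁺ v M (≢-sym v≢m)) (recolour-at σ m R)
      τ-valid : Valid τ
      τ-valid {a} {b} ab τa τb with recolour⁻ σ⁺ v M a τa | recolour⁻ σ⁺ v M b τb
      ... | inj₂ (a≢v , σ⁺a) | inj₂ (_ , σ⁺b) with recolour⁻ σ m R a σ⁺a | recolour⁻ σ m R b σ⁺b
      ...   | inj₂ (_ , σa) | inj₁ (refl , _) = a≢v (only-v (~-sym ab) σa)
      ...   | inj₂ (_ , σa) | inj₂ (_ , σb) = valid pσ ab σa σb
      size-σ⁺ : size σ⁺ M ≡ 4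
      size-σ⁺ = suc-injective (trans (sym (recolour-lose σ m σm (λ ()))) (size-M pσ))
      size-τ : size τ M ≡ 5
      size-τ = trans (recolour-gain σ⁺ v (λ e → absurd σ⁺v e)) (cong suc size-σ⁺)
      τ-R : 3 ≤ size τ R
      τ-R = ≤-trans (s≤s (size-R pσ)) (≤-trans (≡⇒≥ (recolour-gain σ m (λ e → absurd σm e)))
        (size-mono (λ u e → trans (recolour-off σ⁺ v M (side-≢ σ⁺ e σ⁺v)) e)))
      τ-L : size σ L ≤ suc (size τ L)
      τ-L = ≤-trans (size-mono (λ u e → trans (recolour-off σ m R (side-≢ σ e σm)) e))
        (≤-reflexive (recolour-lose σ⁺ v σ⁺v (λ ())))

      -- After the exchange `m` is the only neighbour of `v` on side `R`, so that side would be a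
      -- pendant pair; but it has gained `m` and has at least 3 vertices.
      large : 3 ≤ size σ L → ⊥
      large l = too-large (pendant pτ (cong op τv) v~m (cong op τm) only-m)
        where
        pτ : Sep5 (flip τ)
        pτ = flip-sep (sep5 τ-valid size-τ (s≤s⁻¹ (≤-trans l τ-L)) (≤-trans (n≤1+n 2) τ-R))
        only-m : ∀ {u} → v ~ u → flip τ u ≡ L → u ≡ m
        only-m {u} vu e with recolour⁻ σ⁺ v M u (op-injective {j = R} e)
        ... | inj₂ (_ , f) with recolour⁻ σ m R u f
        ...   | inj₁ (p , _) = p
        ...   | inj₂ (_ , σu) = ⊥-elim (valid pσ vu σv σu)
        too-large : Pendant (flip τ) m → ⊥
        too-large P = <⇒≱ τ-R (≤-trans (≡⇒≥ (flip-size τ L)) (size-cover (flip τ) L (m ∷ Pendant.c P ∷ []) covered))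
          where
          covered : ∀ u → flip τ u ≡ L → u ∈ m ∷ Pendant.c P ∷ []
          covered u e with Pendant.closed P e
          ... | inj₁ p = here p
          ... | inj₂ p = there (here p)

      module TwoVertices {g : Fin n} (g≢v : g ≢ v) (σg : σ g ≡ L) (σ-L : ∀ {u} → σ u ≡ L → u ≡ g ⊎ u ≡ v) where
        g-nbr : ∀ u → g ~ u → u ≡ v ⊎ (σ u ≡ M × u ≢ m)
        g-nbr u a with σ u in e
        ... | R = ⊥-elim (valid pσ a σg e)
        ... | M = inj₂ (refl , λ { refl → g≢v (only-v (~-sym a) σg) })
        ... | L with σ-L e
        ...   | inj₁ refl = ⊥-elim (~-irrefl a)
        ...   | inj₂ p = inj₁ p
        off : ∀ {u} → σ u ≡ M → u ≢ m → σ⁺ u ≡ M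
        off e ne = trans (recolour-off σ m R ne) e
        y≢m : y ≢ m
        y≢m = side-≢ s s-y s-m
        y₂≢m : y₂ ≢ m
        y₂≢m = side-≢ s s-y₂ s-m
        -- Otherwise the neighbours of `g` are the four cut vertices other than `m`, so `g` has
        -- degree 4 and reaches `v` through `y`.
        g~v : g ~ v
        g~v with g ~? v
        ... | yes a = a
        ... | no na = ⊥-elim (close-4 (≤-antisym (≤-trans (deg-M σ⁺ in-4) (≤-reflexive size-σ⁺)) (4≤deg g))
            v4 g≢v (inj₂ (y , saturated-M σ⁺ in-4 (≤-trans (≤-reflexive size-σ⁺) (4≤deg g)) (off σy y≢m) , ~-sym v~y)))
          where
          in-4 : ∀ {u} → g ~ u → σ⁺ u ≡ M
          in-4 {u} a with g-nbr u a
          ... | inj₁ refl = ⊥-elim (na a)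
          ... | inj₂ (e , ne) = off e ne
        g~y₂ : g ~ y₂
        g~y₂ = saturated-M τ in-5 (≤-trans (≤-reflexive size-τ) (far-degree g≢v (inj₁ g~v)))
          (trans (recolour-off σ⁺ v M y₂≢v) (off σy₂ y₂≢m))
          where
          in-5 : ∀ {u} → g ~ u → τ u ≡ M
          in-5 {u} a with g-nbr u a
          ... | inj₁ refl = τv
          ... | inj₂ (e , ne) = trans (recolour-off σ⁺ v M (side-≢ σ e σv)) (off e ne)
        s-g : s g ≡ M × s' g ≡ R
        s-g with nbr-y₂ (~-sym g~y₂)
        ... | is-y refl = absurd σy σg
        ... | is-m refl = absurd σm σg
        ... | is-m₂ refl = absurd σm₂ σg
        ... | is-q e f = e , f

        module _ {b : Fin n} (v~b : v ~ b) (s-b : s b ≡ R) where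
          five-nbrs : ∀ {u} → v ~ u → u ≢ b → u ≢ g → u ≢ y → u ≢ m → ⊥
          five-nbrs {u} vu u≢b u≢g u≢y u≢m = <⇒≱ (≤-refl {5}) (≤-trans (deg-distinct v
            ((u≢b ∷ u≢g ∷ u≢y ∷ u≢m ∷ []) ∷
             (side-≢ s s-b (proj₁ s-g) ∷ side-≢ s s-b s-y ∷ side-≢ s s-b s-m ∷ []) ∷
             (side-≢ s (proj₁ s-g) s-y ∷ side-≢ s' (proj₂ s-g) s'-m ∷ []) ∷
             (y≢m ∷ []) ∷ [] ∷ [])
            (vu ∷ v~b ∷ ~-sym g~v ∷ v~y ∷ v~m ∷ [])) (≤-reflexive v4))
          only-b : ∀ {u} → v ~ u → flip s u ≡ L → u ≡ b
          only-b {u} vu e with u Fin.≟ b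
          ... | yes p = p
          ... | no ne = ⊥-elim (five-nbrs vu ne (side-≢ s s-u (proj₁ s-g)) (side-≢ s s-u s-y) (side-≢ s s-u s-m))
            where
            s-u : s u ≡ R
            s-u = op-injective e
          only-g : s' b ≡ M → ∀ {u} → v ~ u → flip s' u ≡ L → u ≡ g
          only-g s'-b {u} vu e with u Fin.≟ g
          ... | yes p = p
          ... | no ne = ⊥-elim (five-nbrs vu (side-≢ s' s'-u s'-b) ne (side-≢ s' s'-u s'-y) (side-≢ s' s'-u s'-m))
            where
            s'-u : s' u ≡ R
            s'-u = op-injective e
          -- Each of `q`, `b` and `r` has a neighbour in side `L` of `σ`, which is just `g` and `v`,
          -- so none lies in `R`; `r` is moreover adjacent to `m₂` in `R`. Hence all three join
          -- `y₂`, `y` and `m` in a cut of 5 vertices.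
          six : ∀ {r q} → s r ≡ R → r ≢ b → r ~ g → r ~ m₂ → s' b ≡ M → s' r ≡ M → s' q ≡ R → q ≢ g → q ~ g → ⊥
          six {r} {q} s-r r≢b r~g r~m₂ s'-b s'-r s'-q q≢g q~g = <⇒≱ (≤-refl {6}) (≤-trans (size-distinct σ M
            ((side-≢ s' s'-q s'-y₂ ∷ side-≢ s' s'-q s'-y ∷ side-≢ s' s'-q s'-m ∷ side-≢ s' s'-q s'-b ∷ side-≢ s' s'-q s'-r ∷ []) ∷
             (~⇒≢ y₂~y ∷ y₂≢m ∷ side-≢ s s-y₂ s-b ∷ side-≢ s s-y₂ s-r ∷ []) ∷
             (y≢m ∷ side-≢ s s-y s-b ∷ side-≢ s s-y s-r ∷ []) ∷
             (side-≢ s s-m s-b ∷ side-≢ s s-m s-r ∷ []) ∷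
             ((≢-sym r≢b) ∷ []) ∷ [] ∷ [])
            (σq ∷ σy₂ ∷ σy ∷ σm ∷ σb ∷ σr ∷ [])) (≤-reflexive (size-M pσ)))
            where
            σq : σ q ≡ M
            σq with σ q in e
            ... | M = refl
            ... | R = ⊥-elim (valid pσ (~-sym q~g) σg e)
            ... | L with σ-L e
            ...   | inj₁ p = ⊥-elim (q≢g p)
            ...   | inj₂ p = ⊥-elim (side-≢ s' s'-q s'-v p)
            σb : σ b ≡ M
            σb with σ b in e
            ... | M = refl
            ... | R = ⊥-elim (valid pσ v~b σv e)
            ... | L with σ-L e
            ...   | inj₁ p = ⊥-elim (side-≢ s s-b (proj₁ s-g) p)
            ...   | inj₂ p = ⊥-elim (side-≢ s s-b s-v p)
            σr : σ r ≡ M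
            σr with σ r in e
            ... | M = refl
            ... | R = ⊥-elim (valid pσ (~-sym r~g) σg e)
            ... | L = ⊥-elim (valid pσ r~m₂ e σm₂)
          -- Side `R` of `s` is the pair of `b` and its partner, and cell `RM` has two vertices, so
          -- both lie in the cut of `s'`. Then `g` is the only neighbour of `v` on side `R` of `s'`,
          -- which makes that side a pendant pair as well; its second vertex is the `q` of `six`.
          pendants : Pendant (flip s) b → ⊥
          pendants P with cell-fresh s s' R M [] (≤-trans (s≤s z≤n) (≡⇒≥ RM≡2))
          ... | i , s-i , s'-i , _ with cell-fresh s s' R M (i ∷ []) (≡⇒≥ RM≡2)
          ...   | j , s-j , s'-j , new = by-position (Pendant.closed P (cong op s-i)) (Pendant.closed P (cong op s-j))
            where
            c-R : s (Pendant.c P) ≡ R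
            c-R = op-injective (Pendant.at-c P)
            in-cut : s' b ≡ M → s' (Pendant.c P) ≡ M → ⊥
            in-cut s'-b s'-c = finish (pendant (flip-sep sep') (cong op s'-v) (~-sym g~v) (cong op (proj₂ s-g)) (only-g s'-b))
              where
              finish : Pendant (flip s') g → ⊥
              finish P' = six c-R (Pendant.c≢y P) (Pendant.c~cut P (cong op (proj₁ s-g)) g≢v)
                (Pendant.c~cut P (cong op s-m₂) m₂≢v) s'-b s'-c s'-q (Pendant.c≢y P') (q~g (Pendant.c~y P'))
                where
                q = Pendant.c P'
                s'-q : s' q ≡ R
                s'-q = op-injective (Pendant.at-c P')
                q~g : q ~ g ⊎ deg G q ≡ 4 → q ~ g
                q~g (inj₁ a) = a
                q~g (inj₂ d) = ⊥-elim (close-4 d v4 (side-≢ s' s'-q s'-v)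
                  (inj₂ (y , Pendant.c~cut P' (cong op s'-y) y≢v , ~-sym v~y)))
            by-position : i ≡ b ⊎ i ≡ Pendant.c P → j ≡ b ⊎ j ≡ Pendant.c P → ⊥
            by-position (inj₁ p) (inj₁ q) = new (here (trans q (sym p)))
            by-position (inj₁ p) (inj₂ q) = in-cut (trans (cong s' (sym p)) s'-i) (trans (cong s' (sym q)) s'-j)
            by-position (inj₂ p) (inj₁ q) = in-cut (trans (cong s' (sym q)) s'-j) (trans (cong s' (sym p)) s'-i)
            by-position (inj₂ p) (inj₂ q) = new (here (trans q (sym p)))

        contradiction : ⊥
        contradiction with nbr-R sep s-v
        ... | b , v~b , s-b = pendants v~b s-b (pendant (flip-sep sep) (cong op s-v) v~b (cong op s-b) (only-b v~b s-b))

      two : size σ L ≤ 2 → ⊥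
      two l with size-fresh σ L (v ∷ []) (size-L pσ)
      ... | g , σg , g∉ = TwoVertices.contradiction g≢v σg covered
        where
        g≢v : g ≢ v
        g≢v p = g∉ (here p)
        covered : ∀ {u} → σ u ≡ L → u ≡ g ⊎ u ≡ v
        covered e with size-closed σ L ((g≢v ∷ []) ∷ [] ∷ []) (σg ∷ σv ∷ []) l e
        ... | here p = inj₁ p
        ... | there (here p) = inj₂ p

    m₂-not-in-R : ⊥
    m₂-not-in-R with 3 ≤? size σ L
    ... | yes l = large l
    ... | no nl = two (s≤s⁻¹ (≰⇒> nl))

  record AlmostFull : Set where
    field
      {q}   : Fin n
      s-q   : s q ≡ M
      s'-q  : s' q ≡ R
      y≁q   : ¬ y ~ q
      y~cut : ∀ {u} → s u ≡ M → u ≢ q → y ~ u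

  -- Consider a cut through `y₂` and `m`; it misses `v`, say `v` is in `L`. If `m₂` were in `L`, no
  -- neighbour of `m` could be in `R`. With `m₂` in the cut, the neighbour of `y₂` in `R` must be in
  -- cell `MR`; this is `q`. Now `y` cannot be in the cut, by counting, so it is in `L` and misses
  -- `q`, and its degree forces all other adjacencies.
  almost-full : AlmostFull
  almost-full with uncontractible y₂ m y₂~m
  ... | inj₁ (g , g4 , gy₂ , gm) =
    ⊥-elim (close-4 g4 v4 (λ { refl → v≁y₂ gy₂ }) (inj₂ (m , gm , ~-sym v~m)))
  ... | inj₂ (σ , pσ , σy₂ , σm) = by-side
    where
    away : ∀ {σ} → Sep5 σ → σ y₂ ≡ M → σ m ≡ M → σ v ≡ L → AlmostFull
    away {σ} pσ σy₂ σm σv with σ m₂ in σm₂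
    ... | L with nbr-R pσ σm
    ...   | u , a , σu with nbr-m a
    ...     | is-m₂ refl = absurd σm₂ σu
    ...     | is-v refl = absurd σv σu
    ...     | is-y refl = ⊥-elim (valid pσ v~y σv σu)
    ...     | is-y₂ refl = absurd σy₂ σu
    ...     | is-r e f = ⊥-elim (valid pσ (m₂~cut f (side-≢ s e s-v)) σm₂ σu)
    away {σ} pσ σy₂ σm σv | M with nbr-R pσ σy₂
    ...   | u , a , σu with nbr-y₂ a
    ...     | is-y refl = ⊥-elim (valid pσ v~y σv σu)
    ...     | is-m refl = absurd σm σu
    ...     | is-m₂ refl = absurd σm₂ σu
    ...     | is-q s-u s'-u with σ y in σy
    ...       | R = ⊥-elim (valid pσ v~y σv σy)
    ...       | M = ⊥-elim (cut-not-balanced pσ σy σy₂ σv σm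
                (cell-distinct s σ M M ((~⇒≢ m₂~m ∷ []) ∷ [] ∷ []) ((s-m₂ , σm₂) ∷ (s-m , σm) ∷ [])))
    ...       | L = record { s-q = s-u ; s'-q = s'-u ; y≁q = y≁u ; y~cut = y~rest }
      where
      y≁u : ¬ y ~ u
      y≁u b = valid pσ b σy σu
      y~rest : ∀ {w} → s w ≡ M → w ≢ u → y ~ w
      y~rest = missing-one sep s-y₂ s-y (λ e → swap-⊎ (s-closed e)) s-u y≁u (far-degree y≢v (inj₁ (~-sym v~y)))
    away {σ} pσ σy₂ σm σv | R = ⊥-elim (m₂-not-in-R pσ σy₂ σm σv σm₂)
    by-side : AlmostFull
    by-side with σ v in σv
    ... | L = away pσ σy₂ σm σv
    ... | R = away (flip-sep pσ) (cong op σy₂) (cong op σm) (cong op σv)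
    ... | M = ⊥-elim (y₂≢v (cut'-meets-in-v pσ σv σm s'-y₂ σy₂))

  module _ (F : AlmostFull) where
      open AlmostFull F

      private
        q≢v : q ≢ v
        q≢v = side-≢ s' s'-q s'-v

        second-q : ∃[ q₂ ] (s q₂ ≡ M × s' q₂ ≡ R × q₂ ∉ q ∷ [])
        second-q = cell-fresh s s' M R (q ∷ []) (≡⇒≥ MR≡2)

        q-closed : ∀ {q₂} → s q₂ ≡ M → s' q₂ ≡ R → q₂ ≢ q → ∀ {u} → s u ≡ M → s' u ≡ R → u ≡ q ⊎ u ≡ q₂
        q-closed e f ne g h with cell-closed s s' M R ((ne ∷ []) ∷ [] ∷ []) ((e , f) ∷ (s-q , s'-q) ∷ []) (≤-reflexive MR≡2) g h
        ... | here p = inj₂ p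
        ... | there (here p) = inj₁ p

        -- Apart from `q` and `y` itself, every neighbour of `y₂` is also a neighbour of `y`, so
        -- with `y` in `L` nothing in `R` is adjacent to `y₂`.
        in-L⇒⊥ : ∀ {σ} → Sep5 σ → σ y₂ ≡ M → σ q ≡ M → σ y ≡ L → ⊥
        in-L⇒⊥ {σ} pσ σy₂ σq σy with nbr-R pσ σy₂
        ... | u , a , σu with nbr-y₂ a
        ...   | is-y refl = absurd σy σu
        ...   | is-m refl = valid pσ (y~cut s-m (side-≢ s' s'-m s'-q)) σy σu
        ...   | is-m₂ refl = valid pσ (~-sym m₂~y) σy σu
        ...   | is-q e f with u Fin.≟ q
        ...     | yes refl = absurd σq σu
        ...     | no ne = valid pσ (y~cut e ne) σy σu

      module _ {σ : Colouring n} (pσ : Sep5 σ) (σy₂ : σ y₂ ≡ M) (σq : σ q ≡ M) (σy : σ y ≡ M) (σv : σ v ≡ L)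
        {q₂ : Fin n} (s-q₂ : s q₂ ≡ M) (s'-q₂ : s' q₂ ≡ R) (q₂≢q : q₂ ≢ q) where
        private
          q≢m : q ≢ m
          q≢m = side-≢ s' s'-q s'-m
          σm≢R : σ m ≡ R → ⊥
          σm≢R = valid pσ v~m σv
          -- The edges `vm` and `m₂m` would force `m` into the cut, which then meets that of `s` in
          -- both `q` and `m`.
          σm₂≢R : σ m₂ ≡ R → ⊥
          σm₂≢R e with σ m in f
          ... | L = valid pσ (~-sym m₂~m) f e
          ... | R = σm≢R f
          ... | M = cut-not-balanced pσ σy σy₂ σv f (cell-distinct s σ M M ((q≢m ∷ []) ∷ [] ∷ []) ((s-q , σq) ∷ (s-m , f) ∷ []))
          cut-R : ∀ {u} → s u ≡ M → σ u ≡ R → u ≡ q₂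
          cut-R e f with cut-cases e
          ... | is-y₂ refl = absurd s-y₂ e
          ... | is-v refl = absurd σv f
          ... | is-m refl = ⊥-elim (σm≢R f)
          ... | is-m₂ refl = ⊥-elim (σm₂≢R f)
          ... | is-q e f' with q-closed s-q₂ s'-q₂ q₂≢q e f'
          ...   | inj₁ refl = absurd σq f
          ...   | inj₂ p = p
          σq₂ : σ q₂ ≡ R
          σq₂ with nbr-R pσ σy₂
          ... | u , a , σu with nbr-y₂ a
          ...   | is-y refl = absurd σy σu
          ...   | is-m refl = ⊥-elim (σm≢R σu)
          ...   | is-m₂ refl = ⊥-elim (σm₂≢R σu)
          ...   | is-q e _ = trans (cong σ (sym (cut-R e σu))) σu
          MR≤1 : cell s σ M R ≤ 1
          MR≤1 = ≤-by-contra λ lt → impossible (cell-fresh s σ M R (q₂ ∷ []) lt)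
            where
            impossible : ∃[ u ] (s u ≡ M × σ u ≡ R × u ∉ q₂ ∷ []) → ⊥
            impossible (u , e , f , new) = new (here (cut-R e f))
          fm = refute₅ sep pσ
          LR≡0 : cell s σ L R ≡ 0
          LR≡0 = cell-empty s σ (λ e f → absurd (cut-in-L-M pσ σy σy₂ σv e) f)
          LM≥2 : 2 ≤ cell s σ L M
          LM≥2 = cell-distinct s σ L M ((~⇒≢ y₂~y ∷ []) ∷ [] ∷ []) ((s-y₂ , σy₂) ∷ (s-y , σy) ∷ [])
          RR≥1 : 1 ≤ cell s σ R R
          RR≥1 = ≤-by-contra λ lt → fm
            (lr ≐ con 0 ∷ con 1 ⊕ rr ≼ con 1 ∷ mr ≼ con 1 ∷ con 2 ≼ colᴿ ∷ []) _ LR≡0 lt MR≤1 (col-R pσ s)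
          cut-small : boundary right right s σ ≤ 4
          cut-small = ≤-by-contra λ gt → fm
            (con 2 ≼ lm ∷ mr ≼ con 1 ∷ con 5 ≼ bᴿᴿ ∷ []) _
            LM≥2 MR≤1 gt

          module Corner {g : Fin n} (s-g : s g ≡ R) (σg : σ g ≡ R) (cut : SmallCut (corner right right s σ) g) where
            g4 = SmallCut.deg4 cut
            g≢v : g ≢ v
            g≢v = side-≢ s s-g s-v
            g~M : ∀ {u} → (s u ≡ L → ⊥) → σ u ≡ M → g ~ u
            g~M {u} nl e = SmallCut.nbrs cut u at
              where
              at : corner right right s σ u ≡ M
              at with s u in f
              ... | L = ⊥-elim (nl refl)
              ... | M rewrite e = refl
              ... | R rewrite e = refl
            g~q₂ : g ~ q₂
            g~q₂ = SmallCut.nbrs cut q₂ (cong₂ (join right right) s-q₂ σq₂)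
            g≁m : ¬ g ~ m
            g≁m a = close-4 g4 v4 g≢v (inj₂ (m , a , ~-sym v~m))
            σ-R : ∀ {u} → σ u ≡ R → u ≡ q₂ ⊎ u ≡ g
            σ-R {u} f with s u in e
            ... | L = absurd (cut-in-L-M pσ σy σy₂ σv e) f
            ... | M = inj₁ (cut-R e f)
            ... | R = inj₂ (SmallCut.unique cut u (cong₂ (join right right) e f))

            -- {w , c} is a pendant side at a cut through the degree 4 vertex g and its neighbour q₂.
            module _ {τ : Colouring n} (pτ : Sep5 τ) (τg : τ g ≡ M) (τq₂ : τ q₂ ≡ M)
              {w c : Fin n} (g~w : g ~ w) (τw : τ w ≡ L) (τc : τ c ≡ L) (g≁c : ¬ g ~ c) (c~q₂ : c ~ q₂) (c~w : c ~ w)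
              (closed : ∀ {u} → τ u ≡ L → u ≡ w ⊎ u ≡ c) where
              w-not-L : s w ≡ L → ⊥
              w-not-L e = valid sep (~-sym g~w) e s-g
              outside : ∀ {x u} → τ x ≡ L → x ~ u → u ≢ w → u ≢ c → τ u ≡ M
              outside {x} {u} τx a ne ne' with τ u in e
              ... | M = refl
              ... | R = ⊥-elim (valid pτ a τx e)
              ... | L with closed e
              ...   | inj₁ p = ⊥-elim (ne p)
              ...   | inj₂ p = ⊥-elim (ne' p)
              -- The edge to `q₂` keeps `c` out of `L`, and side `R` of `σ` consists of `q₂` and
              -- `g`, both in the cut of `τ`. So `c` is in the cut of `σ`, where `g` is adjacent to
              -- everything outside side `L` of `s`.
              c∈yy₂ : c ≡ y ⊎ c ≡ y₂
              c∈yy₂ with σ c in σc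
              ... | L = ⊥-elim (valid pσ c~q₂ σc σq₂)
              ... | R with σ-R σc
              ...   | inj₁ refl = absurd τc τq₂
              ...   | inj₂ refl = absurd τc τg
              c∈yy₂ | M with s c in s-c
              ...   | L = s-closed s-c
              ...   | M = ⊥-elim (g≁c (g~M (λ e → absurd s-c e) σc))
              ...   | R = ⊥-elim (g≁c (g~M (λ e → absurd s-c e) σc))
              -- If w is m₂, the neighbours of c and m₂ put six vertices into the cut of τ.
              overfull : ∀ {x x' x''} → s x ≡ L → s x' ≡ M → s x'' ≡ M → x' ≢ x'' → s' x' ≢ M →  s' x'' ≢ M →
                τ x ≡ M → τ x' ≡ M → τ x'' ≡ M → ∀ {z} → s z ≡ M → z ≢ x' → z ≢ x'' → τ z ≡ M →
                w ≡ m₂ → (∀ {r} → s r ≡ R → r ≢ c) → ⊥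
              overfull {x} {x'} {x''} sx sx' sx'' ne n' n'' τx τx' τx'' {z} sz zx' zx'' τz refl r≢c
                with cell-fresh s s' R M [] (≤-trans (s≤s z≤n) (≡⇒≥ RM≡2))
              ... | i , s-i , s'-i , _ with cell-fresh s s' R M (i ∷ []) (≡⇒≥ RM≡2)
              ...   | j , s-j , s'-j , new = <⇒≱ (≤-refl {6}) (≤-trans (size-distinct τ M
                ((side-≢ s sx sx' ∷ side-≢ s sx sx'' ∷ side-≢ s sx sz ∷ side-≢ s sx s-i ∷ side-≢ s sx s-j ∷ []) ∷
                 (ne ∷ (≢-sym zx') ∷ side-≢ s sx' s-i ∷ side-≢ s sx' s-j ∷ []) ∷
                 ((≢-sym zx'') ∷ side-≢ s sx'' s-i ∷ side-≢ s sx'' s-j ∷ []) ∷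
                 (side-≢ s sz s-i ∷ side-≢ s sz s-j ∷ []) ∷
                 ((λ p → new (here (sym p))) ∷ []) ∷ [] ∷ [])
                (τx ∷ τx' ∷ τx'' ∷ τz ∷ τr s-i s'-i ∷ τr s-j s'-j ∷ [])) (≤-reflexive (size-M pτ)))
                where
                τr : ∀ {r} → s r ≡ R → s' r ≡ M → τ r ≡ M
                τr e f = outside τw (m₂~cut f (side-≢ s e s-v)) (side-≢ s' f s'-m₂) (r≢c e)

              conclusion : ⊥
              conclusion with c∈yy₂
              ... | inj₁ refl = via-y (nbr-y c~w)
                where
                via-y : Nbr-y w → ⊥
                via-y (is-y₂ refl) = w-not-L s-y₂
                via-y (is-v refl) = close-4 g4 v4 g≢v (inj₁ g~w)
                via-y (is-m refl) = g≁m g~w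
                via-y (is-m₂ refl) = overfull s-y₂ s-m s-q₂ (side-≢ s' s'-m s'-q₂)
                  (λ e → absurd s'-m e) (λ e → absurd s'-q₂ e)
                  (outside τc (~-sym y₂~y) (side-≢ s s-y₂ s-m₂) (~⇒≢ y₂~y))
                  (outside τc (y~cut s-m (≢-sym q≢m)) (~⇒≢ (~-sym m₂~m)) (side-≢ s s-m s-y)) τq₂
                  s-v (≢-sym m≢v) (side-≢ s' s'-v s'-q₂)
                  (outside τc (~-sym v~y) (≢-sym m₂≢v) (≢-sym y≢v))
                  refl (λ e → side-≢ s e s-y)
                via-y (is-q e f) with q-closed s-q₂ s'-q₂ q₂≢q e f
                ... | inj₁ refl = y≁q c~w
                ... | inj₂ refl = absurd τw τq₂
              ... | inj₂ refl = via-y₂ (nbr-y₂ c~w)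
                where
                τ-cut : ∀ {u} → s u ≡ M → u ≢ v → u ≢ w → τ u ≡ M
                τ-cut e ne ne' = outside τc (y₂~cut e ne) ne' (side-≢ s e s-y₂)
                via-y₂ : Nbr-y₂ w → ⊥
                via-y₂ (is-y refl) = w-not-L s-y
                via-y₂ (is-m refl) = g≁m g~w
                via-y₂ (is-m₂ refl) = overfull s-y s-m s-q (≢-sym q≢m) (λ e → absurd s'-m e) (λ e → absurd s'-q e)
                  (outside τc y₂~y (side-≢ s s-y s-m₂) (~⇒≢ (~-sym y₂~y)))
                  (τ-cut s-m m≢v (~⇒≢ (~-sym m₂~m))) (τ-cut s-q q≢v (side-≢ s' s'-q s'-m₂))
                  s-q₂ (side-≢ s' s'-q₂ s'-m) q₂≢q τq₂
                  refl (λ e → side-≢ s e s-y₂)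
                via-y₂ (is-q e f) with q-closed s-q₂ s'-q₂ q₂≢q e f
                ... | inj₂ refl = absurd τw τq₂
                -- Here `w` is `q`. Its neighbours are `y₂` or in the cut of `τ`, which is now known
                -- vertex by vertex; `y` is missed by the choice of `q`, and `m`, `m₂` lie on the
                -- other side of `s'`. Three neighbours remain.
                ... | inj₁ refl = <⇒≱ (4≤deg w) (deg-cover w (y₂ ∷ q₂ ∷ g ∷ []) (λ u a → q-nbr u a (classify u a)))
                  where
                  cut-list : ∀ {u} → τ u ≡ M → u ∈ y ∷ m ∷ m₂ ∷ q₂ ∷ g ∷ []
                  cut-list = size-closed τ M
                    ((side-≢ s s-y s-m ∷ side-≢ s s-y s-m₂ ∷ side-≢ s s-y s-q₂ ∷ side-≢ s s-y s-g ∷ []) ∷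
                     (~⇒≢ (~-sym m₂~m) ∷ side-≢ s' s'-m s'-q₂ ∷ side-≢ s s-m s-g ∷ []) ∷
                     (side-≢ s' s'-m₂ s'-q₂ ∷ side-≢ s s-m₂ s-g ∷ []) ∷
                     (side-≢ s s-q₂ s-g ∷ []) ∷ [] ∷ [])
                    (outside τc y₂~y (side-≢ s s-y s-q) (~⇒≢ (~-sym y₂~y)) ∷
                     τ-cut s-m m≢v (≢-sym q≢m) ∷ τ-cut s-m₂ m₂≢v (side-≢ s' s'-m₂ s'-q) ∷ τq₂ ∷ τg ∷ [])
                    (≤-reflexive (size-M pτ))
                  classify : ∀ u → q ~ u → u ≡ y₂ ⊎ τ u ≡ M
                  classify u a with τ u in e
                  ... | M = inj₂ refl
                  ... | R = ⊥-elim (valid pτ a τw e)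
                  ... | L with closed e
                  ...   | inj₁ p = ⊥-elim (~⇒≢ a (sym p))
                  ...   | inj₂ p = inj₁ p
                  q-nbr : ∀ u → q ~ u → u ≡ y₂ ⊎ τ u ≡ M → u ∈ y₂ ∷ q₂ ∷ g ∷ []
                  q-nbr u a (inj₁ p) = here p
                  q-nbr u a (inj₂ e) with cut-list e
                  ... | here refl = ⊥-elim (y≁q (~-sym a))
                  ... | there (here refl) = ⊥-elim (valid sep' (~-sym a) s'-m s'-q)
                  ... | there (there (here refl)) = ⊥-elim (valid sep' (~-sym a) s'-m₂ s'-q)
                  ... | there (there (there (here p))) = there (here p)
                  ... | there (there (there (there (here p)))) = there (there (here p))

            impossible : ⊥
            impossible with separated-at g4 g~q₂
            ... | τ , pτ , τg , τq₂ with At.one-sided g4 pτ τg g~q₂ τq₂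
            ...   | o = from-pendant (At.pendant g4 (sep o) (same o τg) (adj o) (at-m o) (only o))
              where
              open At.OneSided
              q₂≢g : q₂ ≢ g
              q₂≢g = side-≢ s s-q₂ s-g
              from-pendant : At.Pendant g4 (s₁ o) (At.OneSided.m o) → ⊥
              from-pendant P = conclusion (sep o) (same o τg) (same o τq₂) (adj o) (at-m o) (at-c P) (v≁c P)
                (c~cut P (same o τq₂) q₂≢g) (adjacent (c~y P)) (closed P)
                where
                open At.Pendant
                adjacent : c P ~ At.OneSided.m o ⊎ deg G (c P) ≡ 4 → c P ~ At.OneSided.m o
                adjacent (inj₁ a) = a
                adjacent (inj₂ d) = ⊥-elim (close-4 d g4 (side-≢ (s₁ o) (at-c P) (same o τg))
                  (inj₂ (q₂ , c~cut P (same o τq₂) q₂≢g , ~-sym g~q₂)))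

        crossing-y₂q : ⊥
        crossing-y₂q with cell-fresh s σ R R [] RR≥1
        ... | g , s-g , σg , _ = Corner.impossible s-g σg (corner-small sep pσ right right cut-small s-g σg)

      -- A common neighbour of degree 4 would be a neighbour of `y₂`, and each of those is within
      -- distance two of `v`; so the edge lies in a cut, which `cut-meets-in-v` keeps away from `v`.
      edge-y₂q : ⊥
      edge-y₂q with second-q
      ... | q₂ , s-q₂ , s'-q₂ , new = by-edge (uncontractible y₂ q (y₂~cut s-q q≢v))
        where
        q₂≢q : q₂ ≢ q
        q₂≢q p = new (here p)
        σ-M : ∀ {σ} → Sep5 σ → σ y₂ ≡ M → σ q ≡ M → σ y ≡ M
        σ-M {σ} pσ σy₂ σq with σ y in σy
        ... | L = ⊥-elim (in-L⇒⊥ pσ σy₂ σq σy)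
        ... | M = refl
        ... | R = ⊥-elim (in-L⇒⊥ (flip-sep pσ) (cong op σy₂) (cong op σq) (cong op σy))
        by-edge : Common4 y₂ q ⊎ Separated y₂ q → ⊥
        by-edge (inj₁ (g , g4 , gy₂ , gq)) with nbr-y₂ (~-sym gy₂)
        ... | is-y refl = close-4 g4 v4 y≢v (inj₁ (~-sym v~y))
        ... | is-m refl = close-4 g4 v4 m≢v (inj₁ (~-sym v~m))
        ... | is-m₂ refl = close-4 g4 v4 m₂≢v (inj₂ (m , m₂~m , ~-sym v~m))
        ... | is-q e f = close-4 g4 v4 (side-≢ s' f s'-v) (inj₂ (y , ~-sym (y~cut e (~⇒≢ gq)) , ~-sym v~y))
        by-edge (inj₂ (σ , pσ , σy₂ , σq)) with σ v in σv
        ... | L = crossing-y₂q pσ σy₂ σq (σ-M pσ σy₂ σq) σv s-q₂ s'-q₂ q₂≢q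
        ... | R = crossing-y₂q (flip-sep pσ) (cong op σy₂) (cong op σq) (cong op (σ-M pσ σy₂ σq)) (cong op σv) s-q₂ s'-q₂ q₂≢q
        ... | M = q≢v (cut-meets-in-v pσ σv (σ-M pσ σy₂ σq) s-q σq)

no-degree-4 : ∀ {n : ℕ} (G : Graph n) (simple : IsSimple G) (quasi : QuasiConnected 5 G)
  (degrees : ∀ x y → Dist12 G x y → deg G x + deg G y ≥ 9) (uncontractible : Separation.Uncontractible G simple quasi degrees) →
  ∀ v → deg G v ≢ 4
no-degree-4 G simple quasi degrees uncontractible v v4 = edge-y₂q almost-full
  where
  open DegreeFour.At G simple quasi degrees uncontractible v4 using (configuration)
  open Configured G simple quasi degrees uncontractible v4 configuration

-- Smallest sides

module DegreeFive {n : ℕ} (G : Graph n) (simple : IsSimple G) (quasi : QuasiConnected 5 G)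
  (degrees : ∀ x y → Dist12 G x y → deg G x + deg G y ≥ 9)
  (uncontractible : Separation.Uncontractible G simple quasi degrees)
  (no-degree-4 : ∀ v → deg G v ≢ 4)
  where
  open Separation G simple quasi degrees

  5≤deg : ∀ v → 5 ≤ deg G v
  5≤deg v = ≤∧≢⇒< (4≤deg v) (λ e → no-degree-4 v (sym e))

  separated : ∀ {x y} → x ~ y → Separated x y
  separated {x} {y} a with uncontractible x y a
  ... | inj₁ (g , g4 , _) = ⊥-elim (no-degree-4 g g4)
  ... | inj₂ w = w

  no-4-cut : ∀ {s} → Valid s → size s M ≤ 4 → 2 ≤ size s R → ∀ {g} → s g ≡ L → ⊥
  no-4-cut val le r {g} e = no-degree-4 g (SmallCut.deg4 (small val le r e))

  corner-5 : ∀ {s s'} → Sep5 s → Sep5 s' → ∀ e e' {g} → s g ≡ side e → s' g ≡ side e' → 5 ≤ boundary e e' s s'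
  corner-5 p p' e e' {g} i j = ≤-by-contra λ lt →
    no-degree-4 g (SmallCut.deg4 (corner-small p p' e e' (s≤s⁻¹ lt) i j))

  far-empty : ∀ {s s'} → Sep5 s → Sep5 s' → ∀ e e' → boundary e e' s s' ≤ 4 → cell s s' (side e) (side e') ≡ 0
  far-empty {s} {s'} p p' e e' le = cell-empty s s' λ i j → <⇒≱ (corner-5 p p' e e' i j) le

  module _ {s s' : Colouring n} (p : Sep5 s) (p' : Sep5 s') (e e' : End) (le : boundary e e' s s' ≤ 5)
    {g : Fin n} (s-g : s g ≡ side e) (s'-g : s' g ≡ side e') (one : ∀ {u} → s u ≡ side e → s' u ≡ side e' → u ≡ g) where
    private
      κ = corner e e' s s'
      within : ∀ {u} → g ~ u → κ u ≡ M
      within {u} a with κ u in f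
      ... | M = refl
      ... | R = ⊥-elim (corner-valid {s} {s'} (valid p) (valid p') e e' a (join-L⁺ e e' s-g s'-g) f)
      ... | L with i , j ← join-L⁻ e e' {s u} {s' u} f = ⊥-elim (~⇒≢ a (sym (one i j)))
      size-κ : size κ M ≤ 5
      size-κ = ≤-trans (≤-reflexive (corner-M s s' e e')) le

    -- The neighbours of the only vertex of the corner lie in a boundary of at most 5 vertices, and
    -- there are at least 5 of them.
    corner-full : ∀ {u} → κ u ≡ M → g ~ u
    corner-full = saturated-M κ within (≤-trans size-κ (5≤deg g))

    corner-degree : deg G g ≡ 5
    corner-degree = ≤-antisym (≤-trans (deg-M κ within) size-κ) (5≤deg g)

  Minimal : ℕ → Set
  Minimal k = ∀ {s} → Sep5 s → k ≤ size s L

  record Crossing5 (s s' : Colouring n) : Set where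
    constructor crossing5
    field
      bLL≤5 : boundary left left s s' ≤ 5
      bLR≤5 : boundary left right s s' ≤ 5
      LL≤1  : cell s s' L L ≤ 1
      LR≤1  : cell s s' L R ≤ 1

  open Crossing5

  -- A boundary of 6 at `LL` means `lm > mr` and empties `RR`. Then side `R` of `s'` is `lr + mr`,
  -- by minimality at least `ll + lm + lr`, which gives `mr ≥ lm`. Once its boundary is at most 5, a
  -- left corner with two vertices would be a side below the minimum, because it omits `y`.
  crossing : ∀ {k s s'} → Minimal k → Sep5 s → size s L ≡ k → Sep5 s' → ∀ {y z} →
    s y ≡ L → s' y ≡ M → s z ≡ M → s' z ≡ M → Crossing5 s s'
  crossing {k} {s} {s'} min p size-k p' s-y s'-y s-z s'-z = crossing5 bLL bLR
      (near left (λ h → fm (con 1 ≼ lm ∷ rowᴸ ≼ ll ∷ []) _ a≥1 h) bLL)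
      (near right (λ h → fm (con 1 ≼ lm ∷ rowᴸ ≼ lr ∷ []) _ a≥1 h) bLR)
    where
    fm = refute₅ p p'
    a≥1 : 1 ≤ cell s s' L M
    a≥1 = cell-member s s' s-y s'-y
    k≡ : k ≡ total s s' (LL ∷ LM ∷ LR ∷ [])
    k≡ = trans (sym size-k) (Rows.rowL s s')
    bLL : boundary left left s s' ≤ 5
    bLL = ≤-by-contra λ gt → fm
      (con 6 ≼ bᴸᴸ ∷ rr ≐ con 0 ∷ rowᴸ ≼ colᴿ ∷ []) _
      gt
      (far-empty p p' right right (≤-by-contra λ h → fm
        (con 6 ≼ bᴸᴸ ∷ con 5 ≼ bᴿᴿ ∷ []) _ gt h))
      (≤-trans (≡⇒≥ k≡) (≤-trans (min (flip-sep p')) (≤-reflexive (trans (flip-size s' L) (Rows.colR s s')))))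
    bLR : boundary left right s s' ≤ 5
    bLR = ≤-by-contra λ gt → fm
      (con 6 ≼ bᴸᴿ ∷ rl ≐ con 0 ∷ rowᴸ ≼ colᴸ ∷ []) _
      gt
      (far-empty p p' right left (≤-by-contra λ h → fm
        (con 6 ≼ bᴸᴿ ∷ con 5 ≼ bᴿᴸ ∷ []) _ gt h))
      (≤-trans (≡⇒≥ k≡) (≤-trans (min p') (≤-reflexive (Rows.colL s s'))))
    near : ∀ e' → (total s s' (LL ∷ LM ∷ LR ∷ []) ≤ cell s s' L (side e') → ⊥) →
      boundary left e' s s' ≤ 5 → cell s s' L (side e') ≤ 1
    near e' proper le = ≤-by-contra λ two → proper (≤-trans (≡⇒≥ k≡)
      (≤-trans (min (sep5 (corner-valid {s} {s'} (valid p) (valid p') left e')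
        (trans (corner-M s s' left e') (≤-antisym le (five two)))
        (≤-trans two (≡⇒≥ (corner-L s s' left e'))) (corner-R p s' left e')))
        (≤-reflexive (corner-L s s' left e'))))
      where
      five : 2 ≤ cell s s' L (side e') → 5 ≤ boundary left e' s s'
      five two with g , i , j , _ ← cell-fresh s s' L (side e') [] (≤-trans (n≤1+n 1) two) = corner-5 p p' left e' i j

  inner-unique : ∀ {s s' : Colouring n} {i j} → cell s s' i j ≤ 1 → ∀ {g} → s g ≡ i → s' g ≡ j → ∀ {u} → s u ≡ i → s' u ≡ j → u ≡ g
  inner-unique {s} {s'} {i} {j} le e f e' f' with cell-closed s s' i j ([] ∷ []) ((e , f) ∷ []) le e' f'
  ... | here q = q

  -- Otherwise all neighbours of `i` are among at most 4 vertices, against degree at least 5.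
  nbr-M : ∀ {s} → Sep5 s → size s L ≤ 4 → ∀ {i} → s i ≡ L → ∃[ x ] (i ~ x × s x ≡ M)
  nbr-M {s} p le {i} e with any? (λ x → i ~? x ×-dec (s x ≟ˢ M))
  ... | yes w = w
  ... | no none = ⊥-elim (<⇒≱ (5≤deg i) (≤-trans (≤-trans (≤-reflexive (deg≡ i)) (#-mono within))
      (≤-trans (≡⇒≥ (size≡# s L)) le)))
    where
    within : ∀ u → i ~ u → T (is L (s u))
    within u a with s u in f
    ... | L = tt
    ... | M = ⊥-elim (none (u , a , f))
    ... | R = ⊥-elim (valid p a e f)

  -- Smallest sides with four vertices

  module Four {s : Colouring n} (p : Sep5 s) (size-4 : size s L ≡ 4) (min : Minimal 4) where

    record Corners (i x : Fin n) : Set where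
      field
        {a b}  : Fin n
        s-a    : s a ≡ L
        s-b    : s b ≡ L
        a≢b    : a ≢ b
        a≁b    : ¬ a ~ b
        i~a    : i ~ a
        i~b    : i ~ b
        a~x    : a ~ x
        b~x    : b ~ x
        only-x : ∀ {u} → s u ≡ M → a ~ u → b ~ u → u ≡ x
        {x'}   : Fin n
        s-x'   : s x' ≡ M
        x'≢x   : x' ≢ x
        a~x'   : a ~ x'

    -- As before `5 + 2·lm + mm ≤ 10`, and `lm ≥ 2` because each corner has at most one of the four
    -- vertices. So `lm = 2`, `mm = 1`, and each left corner is a single vertex adjacent to its
    -- whole boundary.
    corners : ∀ {i x} → s i ≡ L → s x ≡ M → i ~ x → Corners i x
    corners {i} {x} s-i s-x ix with separated ix
    ... | s' , p' , s'-i , s'-x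
      with X ← crossing min p size-4 p' s-i s'-i s-x s'-x = build
      where
      fm = refute₅ p p'
      H : List (Constraint 9)
      H = bᴸᴸ ≼ con 5 ∷ bᴸᴿ ≼ con 5 ∷
          ll ≼ con 1 ∷ lr ≼ con 1 ∷ rowᴸ ≐ con 4 ∷ con 1 ≼ mm ∷ []
      refute : ∀ c → Refutable (rowᴹ ≐ con 5 ∷ colᴹ ≐ con 5 ∷ c ∷ H) → Sat (cells s s') c → ⊥
      refute c t h = fm (c ∷ H) t h (bLL≤5 X) (bLR≤5 X) (LL≤1 X) (LR≤1 X)
        (trans (sym (Rows.rowL s s')) size-4) (cell-member s s' s-x s'-x)
      LL≥1 : 1 ≤ cell s s' L L
      LL≥1 = ≤-by-contra (refute (con 1 ⊕ ll ≼ con 1) _)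
      LR≥1 : 1 ≤ cell s s' L R
      LR≥1 = ≤-by-contra (refute (con 1 ⊕ lr ≼ con 1) _)
      MM≤1 : cell s s' M M ≤ 1
      MM≤1 = ≤-by-contra (refute (con 2 ≼ mm) _)
      ML≥1 : 1 ≤ cell s s' M L
      ML≥1 = ≤-by-contra (refute (con 1 ⊕ ml ≼ con 1) _)
      build : Corners i x
      build with cell-fresh s s' L L [] LL≥1 | cell-fresh s s' L R [] LR≥1 | cell-fresh s s' M L [] ML≥1
      ... | a , s-a , s'-a , _ | b , s-b , s'-b , _ | x' , s-x' , s'-x' , _ = record
        { s-a = s-a ; s-b = s-b ; a≢b = side-≢ s' s'-a s'-b ; a≁b = λ t → valid p' t s'-a s'-b
        ; i~a = ~-sym (a-full (cong₂ (join left left) s-i s'-i)) ; i~b = ~-sym (b-full (cong₂ (join left right) s-i s'-i))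
        ; a~x = a-full (cong₂ (join left left) s-x s'-x) ; b~x = b-full (cong₂ (join left right) s-x s'-x)
        ; only-x = only-x
        ; s-x' = s-x' ; x'≢x = side-≢ s' s'-x' s'-x ; a~x' = a-full (cong₂ (join left left) s-x' s'-x') }
        where
        a-full : ∀ {u} → corner left left s s' u ≡ M → a ~ u
        a-full = corner-full p p' left left (bLL≤5 X) s-a s'-a (inner-unique {s} {s'} (LL≤1 X) s-a s'-a)
        b-full : ∀ {u} → corner left right s s' u ≡ M → b ~ u
        b-full = corner-full p p' left right (bLR≤5 X) s-b s'-b (inner-unique {s} {s'} (LR≤1 X) s-b s'-b)
        only-x : ∀ {u} → s u ≡ M → a ~ u → b ~ u → u ≡ x
        only-x {u} e au bu with s' u in f
        ... | L = ⊥-elim (valid p' (~-sym bu) f s'-b)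
        ... | R = ⊥-elim (valid p' au s'-a f)
        ... | M = inner-unique {s} {s'} MM≤1 s-x s'-x e f

    open Corners

    -- The edges from `a` to `x` and to `x'` yield two pairs of neighbours of `a` inside the side.
    -- As `a` misses `b`, there are only two such neighbours, so the pairs agree; their only common
    -- neighbour in the cut would be both `x` and `x'`.
    impossible : ⊥
    impossible with size-fresh s L [] (≤-trans (s≤s z≤n) (≡⇒≥ size-4))
    ... | i , s-i , _ with nbr-M p (≤-reflexive size-4) s-i
    ... | x , ix , s-x = contradict (corners s-i s-x ix)
      where
      contradict : Corners i x → ⊥
      contradict C = compare (corners (s-a C) s-x (a~x C)) (corners (s-a C) (s-x' C) (a~x' C))
        where
        compare : Corners (a C) x → Corners (a C) (x' C) → ⊥
        compare D D' = x'≢x C (only-x D (s-x' C) (D~x' (a~x D') (b~x D') (∈D (s-a D') (i~a D')) (∈D (s-b D') (i~b D')) .proj₁)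
            (D~x' (a~x D') (b~x D') (∈D (s-a D') (i~a D')) (∈D (s-b D') (i~b D')) .proj₂))
          where
          ∈D : ∀ {u} → s u ≡ L → a C ~ u → u ≡ a D ⊎ u ≡ b D
          ∈D e t with size-closed s L
            (((λ q → ~⇒≢ (i~a D) q) ∷ (λ q → ~⇒≢ (i~b D) q) ∷ a≢b C ∷ []) ∷
             (a≢b D ∷ (λ q → a≁b C (subst (a C ~_) q (i~a D))) ∷ []) ∷
             ((λ q → a≁b C (subst (a C ~_) q (i~b D))) ∷ []) ∷ [] ∷ [])
            (s-a C ∷ s-a D ∷ s-b D ∷ s-b C ∷ []) (≤-reflexive size-4) e
          ... | here q = ⊥-elim (~⇒≢ t (sym q))
          ... | there (here q) = inj₁ q
          ... | there (there (here q)) = inj₂ q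
          ... | there (there (there (here q))) = ⊥-elim (a≁b C (subst (a C ~_) q t))
          D~x' : a D' ~ x' C → b D' ~ x' C → a D' ≡ a D ⊎ a D' ≡ b D → b D' ≡ a D ⊎ b D' ≡ b D →
            a D ~ x' C × b D ~ x' C
          D~x' t t' (inj₁ q) (inj₁ q') = ⊥-elim (a≢b D' (trans q (sym q')))
          D~x' t t' (inj₁ q) (inj₂ q') = subst (_~ x' C) q t , subst (_~ x' C) q' t'
          D~x' t t' (inj₂ q) (inj₁ q') = subst (_~ x' C) q' t' , subst (_~ x' C) q t
          D~x' t t' (inj₂ q) (inj₂ q') = ⊥-elim (a≢b D' (trans q (sym q')))

  -- Smallest sides with three vertices

  module Three {s : Colouring n} (p : Sep5 s) (size-3 : size s L ≡ 3) (min : Minimal 3) where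

    cut-nbr : Fin n → Fin n → Bool
    cut-nbr i u = G i u ∧ is M (s u)

    cut-nbr⁺ : ∀ {i u} → i ~ u → s u ≡ M → T (cut-nbr i u)
    cut-nbr⁺ {i} {u} a e = Equivalence.from (T-∧ {G i u}) (a , is⁺ e)

    cut-nbr⁻ : ∀ {i u} → T (cut-nbr i u) → i ~ u × s u ≡ M
    cut-nbr⁻ {i} {u} t with a , b ← Equivalence.to (T-∧ {G i u}) t = a , is⁻ b

    record Thin (i : Fin n) : Set where
      field
        s-i : s i ≡ L
        few : # (cut-nbr i) ≤ 3
        all : ∀ {u} → s u ≡ L → u ≢ i → i ~ u

    open Thin

    data Neighbour (i x : Fin n) : Set where
      thin : ∀ {a} → Thin a → i ~ a → a ~ x → Neighbour i x
      spread : ∀ {a b} → s a ≡ L → s b ≡ L → a ≢ b → ¬ a ~ b → i ~ a → i ~ b → 4 ≤ # (cut-nbr a) → Neighbour i x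

    -- The bound `5 + 2·lm + mm ≤ 10` rules out `lm = 3`. If just one left corner is occupied, its
    -- vertex has degree 5 with two neighbours in `LM`, hence three in the cut. If both are, the two
    -- corner vertices are not adjacent, and a boundary of 5 with `lm = 1` leaves four cut
    -- neighbours.
    neighbour : ∀ {i x} → s i ≡ L → s x ≡ M → i ~ x → Neighbour i x
    neighbour {i} {x} s-i s-x ix with separated ix
    ... | s' , p' , s'-i , s'-x
      with X ← crossing min p size-3 p' s-i s'-i s-x s'-x = build
      where
      fm = refute₅ p p'
      rL : total s s' (LL ∷ LM ∷ LR ∷ []) ≡ 3
      rL = trans (sym (Rows.rowL s s')) size-3
      at-corner : ∀ e' → cell s s' L (side (opp e')) ≡ 0 → cell s s' L M ≡ 2 → boundary left e' s s' ≤ 5 →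
        cell s s' L (side e') ≤ 1 →
        ∀ {a} → s a ≡ L → s' a ≡ side e' → Neighbour i x
      at-corner e' opposite LM≡2 bd one {a} s-a s'-a =
        thin (record { s-i = s-a ; few = few-a ; all = all-a }) (~-sym (full' (join-LM left e' s-i s'-i))) (full' (join-MM left e' s-x s'-x))
        where
        unique : ∀ {u} → s u ≡ L → s' u ≡ side e' → u ≡ a
        unique = inner-unique {s} {s'} one s-a s'-a
        full' : ∀ {u} → corner left e' s s' u ≡ M → a ~ u
        full' = corner-full p p' left e' bd s-a s'-a unique
        by-end : ∀ e' {j} → j ≡ M ⊎ j ≡ side e' ⊎ j ≡ side (opp e')
        by-end left {L} = inj₂ (inj₁ refl)
        by-end left {M} = inj₁ refl
        by-end left {R} = inj₂ (inj₂ refl)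
        by-end right {L} = inj₂ (inj₂ refl)
        by-end right {M} = inj₁ refl
        by-end right {R} = inj₂ (inj₁ refl)
        all-a : ∀ {u} → s u ≡ L → u ≢ a → a ~ u
        all-a {u} e ne with by-end e' {s' u}
        ... | inj₁ f = full' (join-LM left e' e f)
        ... | inj₂ (inj₁ f) = ⊥-elim (ne (unique e f))
        ... | inj₂ (inj₂ f) = ⊥-elim (<⇒≱ (cell-member s s' e f) (≤-reflexive opposite))
        few-a : # (cut-nbr a) ≤ 3
        few-a = +-cancelʳ-≤ 2 _ _ (≤-trans (+-monoʳ-≤ _ (≤-trans (≡⇒≥ (trans (sym (cell≡# s s' L M)) LM≡2)) (#-mono inner)))
          (≤-reflexive (trans (sym (#-⊎ (G a) (cut-nbr a) (λ u → G a u ∧ is L (s u)) split)) (trans (sym (deg≡ a)) deg-a))))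
          where
          deg-a : deg G a ≡ 5
          deg-a = corner-degree p p' left e' bd s-a s'-a unique
          inner : ∀ u → T (is L (s u) ∧ is M (s' u)) → T (G a u ∧ is L (s u))
          inner u t with e , f ← both⁻ {L} {M} t = Equivalence.from (T-∧ {G a u}) (full' (join-LM left e' e f) , is⁺ e)
          split : ∀ u → bit (G a u) ≡ bit (G a u ∧ is M (s u)) + bit (G a u ∧ is L (s u))
          split u with G a u in g | s u in e
          ... | false | _ = refl
          ... | true | L = refl
          ... | true | M = refl
          ... | true | R = ⊥-elim (valid p (subst T (sym g) tt) s-a e)
      H : List (Constraint 9)
      H = bᴸᴸ ≼ con 5 ∷ bᴸᴿ ≼ con 5 ∷
          ll ≼ con 1 ∷ lr ≼ con 1 ∷ rowᴸ ≐ con 3 ∷ con 1 ≼ mm ∷ []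
      refute : ∀ c d → Refutable (rowᴹ ≐ con 5 ∷ colᴹ ≐ con 5 ∷ c ∷ d ∷ H) → Sat (cells s s') d → Sat (cells s s') c → ⊥
      refute c d t k h = fm (c ∷ d ∷ H) t h k (bLL≤5 X) (bLR≤5 X) (LL≤1 X) (LR≤1 X) rL (cell-member s s' s-x s'-x)
      build : Neighbour i x
      build with 1 ≤? cell s s' L L | 1 ≤? cell s s' L R
      ... | no a | no b = ⊥-elim (refute (con 1 ⊕ ll ≼ con 1) (con 1 ⊕ lr ≼ con 1) _ (≰⇒> b) (≰⇒> a))
      ... | yes a | no b with cell-fresh s s' L L [] a
      ...   | g , s-g , s'-g , _ = at-corner left (n<1⇒n≡0 (≰⇒> b))
              (≡-by-contra (refute (con 3 ≼ lm) (con 1 ≼ ll) _ a) (refute (con 1 ⊕ lm ≼ con 2) (con 1 ⊕ lr ≼ con 1) _ (≰⇒> b)))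
              (bLL≤5 X) (LL≤1 X) s-g s'-g
      build | no a | yes b with cell-fresh s s' L R [] b
      ...   | g , s-g , s'-g , _ = at-corner right (n<1⇒n≡0 (≰⇒> a))
              (≡-by-contra (refute (con 3 ≼ lm) (con 1 ≼ lr) _ b) (refute (con 1 ⊕ lm ≼ con 2) (con 1 ⊕ ll ≼ con 1) _ (≰⇒> a)))
              (bLR≤5 X) (LR≤1 X) s-g s'-g
      build | yes a | yes b with cell-fresh s s' L L [] a | cell-fresh s s' L R [] b
      ...   | g , s-g , s'-g , _ | h , s-h , s'-h , _ = spread s-g s-h (side-≢ s' s'-g s'-h) (λ t → valid p' t s'-g s'-h)
              (~-sym (g-full (join-LM left left s-i s'-i))) (~-sym (corner-full p p' left right (bLR≤5 X) s-h s'-h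
                (inner-unique {s} {s'} (LR≤1 X) s-h s'-h) (join-LM left right s-i s'-i)))
              (≤-trans four (≤-trans (≡⇒≥ (by-cells s s' in-corner (MM ∷ ML ∷ []) tt)) (#-mono within)))
        where
        in-corner : Side → Side → Bool
        in-corner a b = is M a ∧ not (is R b)
        g-full : ∀ {u} → corner left left s s' u ≡ M → g ~ u
        g-full = corner-full p p' left left (bLL≤5 X) s-g s'-g (inner-unique {s} {s'} (LL≤1 X) s-g s'-g)
        four : 4 ≤ total s s' (MM ∷ ML ∷ [])
        four = ≤-by-contra λ h → fm
          (Σᵉ (mm ∷ ml ∷ []) ⊕ con 1 ≼ con 4 ∷ con 1 ≼ ll ∷ con 1 ≼ lr ∷ con 5 ≼ bᴸᴸ ∷ H) _
          (≤-trans (≤-reflexive (+-comm _ 1)) h) a b (corner-5 p p' left left s-g s'-g) (bLL≤5 X) (bLR≤5 X) (LL≤1 X) (LR≤1 X) rL (cell-member s s' s-x s'-x)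
        within : ∀ u → T (in-corner (s u) (s' u)) → T (cut-nbr g u)
        within u t with s u in e | s' u in f
        ... | M | L = cut-nbr⁺' (g-full (cong₂ (join left left) e f))
          where
          cut-nbr⁺' : g ~ u → T (G g u ∧ true)
          cut-nbr⁺' a = Equivalence.from (T-∧ {G g u}) (a , tt)
        ... | M | M = Equivalence.from (T-∧ {G g u}) (g-full (cong₂ (join left left) e f) , tt)

    -- In the other case the only neighbour of `a` inside the side is `i`. Applying `neighbour` to
    -- each edge from `a` to the cut must then return `i`: so `i` is thin, yet adjacent to all of
    -- the at least 4 cut neighbours of `a`.
    thin-neighbour : ∀ {i x} → s i ≡ L → s x ≡ M → i ~ x → ∃[ a ] (Thin a × i ~ a × a ~ x)
    thin-neighbour {i} {x} s-i s-x ix with neighbour s-i s-x ix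
    ... | thin t ia ax = _ , t , ia , ax
    ... | spread {a} {b} s-a s-b a≢b a≁b ia ib four = ⊥-elim (absurdly (#-fresh (cut-nbr a) [] (≤-trans (s≤s z≤n) four)))
      where
      ∈L : ∀ {u} → s u ≡ L → u ≡ a ⊎ u ≡ b ⊎ u ≡ i
      ∈L e with size-closed s L ((a≢b ∷ (≢-sym (~⇒≢ ia)) ∷ []) ∷ ((≢-sym (~⇒≢ ib)) ∷ []) ∷ [] ∷ [])
        (s-a ∷ s-b ∷ s-i ∷ []) (≤-reflexive size-3) e
      ... | here q = inj₁ q
      ... | there (here q) = inj₂ (inj₁ q)
      ... | there (there (here q)) = inj₂ (inj₂ q)
      only-i : ∀ {u} → s u ≡ L → a ~ u → u ≡ i
      only-i e t with ∈L e
      ... | inj₁ q = ⊥-elim (~⇒≢ t (sym q))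
      ... | inj₂ (inj₁ refl) = ⊥-elim (a≁b t)
      ... | inj₂ (inj₂ q) = q
      via-i : ∀ {u} → a ~ u → s u ≡ M → Thin i × i ~ u
      via-i {u} au e with neighbour s-a e au
      ... | thin {c} t ac cu with refl ← only-i (Thin.s-i t) ac = t , cu
      ... | spread s-c s-d c≢d _ ac ad _ = ⊥-elim (c≢d (trans (only-i s-c ac) (sym (only-i s-d ad))))
      absurdly : ∃[ u ] (T (cut-nbr a u) × u ∉ []) → ⊥
      absurdly (u , t , _) with cut-nbr⁻ t
      ... | au , e = <⇒≱ four (≤-trans (#-mono (λ w t' → let aw , f = cut-nbr⁻ t' in cut-nbr⁺ (proj₂ (via-i aw f)) f))
        (few (proj₁ (via-i au e))))

    -- Two thin vertices j and l have at least 5 cut neighbours together, so at least 4 belong to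
    -- exactly one of them; all those are adjacent to the third vertex, which is thin as well.
    module _ {j l k : Fin n} (tj : Thin j) (tl : Thin l) (j≢l : j ≢ l) (s-k : s k ≡ L) (k≢j : k ≢ j) (k≢l : k ≢ l) where
      ∈L : ∀ {u} → s u ≡ L → u ≡ j ⊎ u ≡ l ⊎ u ≡ k
      ∈L e with size-closed s L ((j≢l ∷ (≢-sym k≢j) ∷ []) ∷ ((≢-sym k≢l) ∷ []) ∷ [] ∷ [])
        (s-i tj ∷ s-i tl ∷ s-k ∷ []) (≤-reflexive size-3) e
      ... | here q = inj₁ q
      ... | there (here q) = inj₂ (inj₁ q)
      ... | there (there (here q)) = inj₂ (inj₂ q)

      either one-of : Fin n → Bool
      either u = cut-nbr j u ∨ cut-nbr l u
      one-of u = (cut-nbr j u ∧ not (cut-nbr l u)) ∨ (cut-nbr l u ∧ not (cut-nbr j u))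

      -- The thin neighbour obtained from the edge at `u` is adjacent to `u`, so it is neither the
      -- end of that edge nor the vertex that misses `u`.
      third : ∀ u → T (one-of u) → Thin k × T (cut-nbr k u)
      third u t with T? (cut-nbr j u) | T? (cut-nbr l u) | Equivalence.to (T-∨ {cut-nbr j u ∧ not (cut-nbr l u)}) t
      ... | yes yj | no nl | _ with ju , e ← cut-nbr⁻ {j} yj with a , ta , ja , au ← thin-neighbour (s-i tj) e ju with ∈L (s-i ta)
      ...   | inj₁ refl = ⊥-elim (~-irrefl ja)
      ...   | inj₂ (inj₁ refl) = ⊥-elim (nl (cut-nbr⁺ au e))
      ...   | inj₂ (inj₂ refl) = ta , cut-nbr⁺ au e
      third u t | no nj | yes yl | _ with lu , e ← cut-nbr⁻ {l} yl with a , ta , la , au ← thin-neighbour (s-i tl) e lu with ∈L (s-i ta)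
      ...   | inj₁ refl = ⊥-elim (nj (cut-nbr⁺ au e))
      ...   | inj₂ (inj₁ refl) = ⊥-elim (~-irrefl la)
      ...   | inj₂ (inj₂ refl) = ta , cut-nbr⁺ au e
      third u t | yes yj | yes yl | inj₁ q = ⊥-elim (T-not (cut-nbr l u) yl (proj₂ (Equivalence.to (T-∧ {cut-nbr j u}) q)))
      third u t | yes yj | yes yl | inj₂ q = ⊥-elim (T-not (cut-nbr j u) yj (proj₂ (Equivalence.to (T-∧ {cut-nbr l u}) q)))
      third u t | no nj | no nl | inj₁ q = ⊥-elim (nj (proj₁ (Equivalence.to (T-∧ {cut-nbr j u}) q)))
      third u t | no nj | no nl | inj₂ q = ⊥-elim (nl (proj₁ (Equivalence.to (T-∧ {cut-nbr l u}) q)))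

      cut-off : Colouring n
      cut-off u with s u | u Fin.≟ k | T? (either u)
      ... | L | yes _ | _ = M
      ... | L | no _ | _ = L
      ... | M | _ | yes _ = M
      ... | M | _ | no _ = R
      ... | R | _ | _ = R

      cut-off-L⁺ : ∀ {u} → s u ≡ L → u ≢ k → cut-off u ≡ L
      cut-off-L⁺ {u} e ne rewrite e with u Fin.≟ k
      ... | yes q = ⊥-elim (ne q)
      ... | no _ = refl

      cut-off-L : ∀ {u} → cut-off u ≡ L → u ≡ j ⊎ u ≡ l
      cut-off-L {u} f with s u in e | u Fin.≟ k | T? (either u)
      ... | L | no ne | _ with ∈L e
      ...   | inj₁ q = inj₁ q
      ...   | inj₂ (inj₁ q) = inj₂ q
      ...   | inj₂ (inj₂ q) = ⊥-elim (ne q)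
      cut-off-L {u} () | L | yes _ | _
      cut-off-L {u} () | M | _ | yes _
      cut-off-L {u} () | M | _ | no _
      cut-off-L {u} () | R | _ | _

      cut-off-M : ∀ {u} → cut-off u ≡ M → u ≡ k ⊎ T (either u)
      cut-off-M {u} f with s u | u Fin.≟ k | T? (either u)
      ... | L | yes q | _ = inj₁ q
      ... | M | _ | yes t = inj₂ t
      cut-off-M {u} () | L | no _ | _
      cut-off-M {u} () | M | _ | no _
      cut-off-M {u} () | R | _ | _

      cut-off-R : ∀ {u} → cut-off u ≡ R → s u ≡ R ⊎ (s u ≡ M × ¬ T (either u))
      cut-off-R {u} f with s u | u Fin.≟ k | T? (either u)
      ... | R | _ | _ = inj₁ refl
      ... | M | _ | no nt = inj₂ (refl , nt)
      cut-off-R {u} () | L | yes _ | _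
      cut-off-R {u} () | L | no _ | _
      cut-off-R {u} () | M | _ | yes _

      cut-off-R⁺ : ∀ u → s u ≡ R → cut-off u ≡ R
      cut-off-R⁺ u e rewrite e = refl

      cut-off-valid : Valid cut-off
      cut-off-valid {u} {w} a e f with cut-off-L e | cut-off-R f
      ... | inj₁ refl | inj₁ q = valid p a (s-i tj) q
      ... | inj₂ refl | inj₁ q = valid p a (s-i tl) q
      ... | inj₁ refl | inj₂ (q , nt) = nt (Equivalence.from (T-∨ {cut-nbr j w}) (inj₁ (cut-nbr⁺ a q)))
      ... | inj₂ refl | inj₂ (q , nt) = nt (Equivalence.from (T-∨ {cut-nbr j w}) (inj₂ (cut-nbr⁺ a q)))

      -- With 5 vertices the cut would have the side `j`, `l`, below the minimum 3; fewer do not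
      -- separate in this way at all.
      six : 6 ≤ size cut-off M
      six = ≤-by-contra λ lt → not-small lt
        where
        R≥2 : 2 ≤ size cut-off R
        R≥2 = ≤-trans (size-R p) (size-mono cut-off-R⁺)
        L≡2 : size cut-off L ≤ 2
        L≡2 = size-cover cut-off L (j ∷ l ∷ []) (λ u e → covered (cut-off-L e))
          where
          covered : ∀ {u} → u ≡ j ⊎ u ≡ l → u ∈ j ∷ l ∷ []
          covered (inj₁ q) = here q
          covered (inj₂ q) = there (here q)
        L≥2 : 2 ≤ size cut-off L
        L≥2 = size-distinct cut-off L ((j≢l ∷ []) ∷ [] ∷ [])
          (cut-off-L⁺ (s-i tj) (≢-sym k≢j) ∷ cut-off-L⁺ (s-i tl) (≢-sym k≢l) ∷ [])
        not-small : suc (size cut-off M) ≤ 6 → ⊥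
        not-small lt with size cut-off M ≤? 4
        ... | yes le = no-4-cut cut-off-valid le R≥2 (cut-off-L⁺ (s-i tj) (≢-sym k≢j))
        ... | no gt = <⇒≱ (min (sep5 cut-off-valid (≤-antisym (s≤s⁻¹ lt) (≰⇒> gt)) L≥2 R≥2)) L≡2

      either≥5 : 5 ≤ # either
      either≥5 = s≤s⁻¹ (≤-trans six (≤-trans (≤-reflexive (size≡# cut-off M)) (≤-trans
        (#-mono {q = λ u → ⌊ u Fin.≟ k ⌋ ∨ either u} within)
        (≤-trans (≤-reflexive (#-∖ (λ u → ⌊ u Fin.≟ k ⌋ ∨ either u) k at-k)) (s≤s (#-mono rest))))))
        where
        within : ∀ u → T (is M (cut-off u)) → T (⌊ u Fin.≟ k ⌋ ∨ either u)
        within u t with cut-off-M {u} (is⁻ t)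
        ... | inj₁ q = Equivalence.from (T-∨ {⌊ u Fin.≟ k ⌋}) (inj₁ (fromWitness q))
        ... | inj₂ t' = Equivalence.from (T-∨ {⌊ u Fin.≟ k ⌋}) (inj₂ t')
        at-k : T (⌊ k Fin.≟ k ⌋ ∨ either k)
        at-k = Equivalence.from (T-∨ {⌊ k Fin.≟ k ⌋}) (inj₁ (fromWitness refl))
        rest : ∀ u → T (((λ u → ⌊ u Fin.≟ k ⌋ ∨ either u) ∖ k) u) → T (either u)
        rest u t with ∖⁻ (λ u → ⌊ u Fin.≟ k ⌋ ∨ either u) {k} {u} t
        ... | t' , ne with Equivalence.to (T-∨ {⌊ u Fin.≟ k ⌋}) t'
        ...   | inj₁ q = ⊥-elim (ne (toWitness q))
        ...   | inj₂ e = e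

      counts : # one-of + (# (cut-nbr j) + # (cut-nbr l)) ≡ # either + # either
      counts = #-balance one-of (cut-nbr j) (cut-nbr l) either (λ u → table (cut-nbr j u) (cut-nbr l u))
        where
        table : ∀ a b → bit ((a ∧ not b) ∨ (b ∧ not a)) + (bit a + bit b) ≡ bit (a ∨ b) + bit (a ∨ b)
        table true true = refl
        table true false = refl
        table false true = refl
        table false false = refl

      two-thin : ⊥
      two-thin with #-fresh one-of [] (≤-trans (s≤s z≤n) four)
        where
        four : 4 ≤ # one-of
        four = ≤-by-contra λ h → fourier-motzkin (# one-of ∷ # (cut-nbr j) ∷ # (cut-nbr l) ∷ # either ∷ [])
          (con 1 ⊕ var 0F ≼ con 4 ∷ var 1F ≼ con 3 ∷ var 2F ≼ con 3 ∷ con 5 ≼ var 3F ∷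
           var 0F ⊕ (var 1F ⊕ var 2F) ≐ var 3F ⊕ var 3F ∷ []) _ h (few tj) (few tl) either≥5 counts
      ... | u , t , _ = fourier-motzkin (# one-of ∷ # (cut-nbr j) ∷ # (cut-nbr l) ∷ # either ∷ [])
          (var 0F ≼ con 3 ∷ var 1F ≼ con 3 ∷ var 2F ≼ con 3 ∷ con 5 ≼ var 3F ∷
           var 0F ⊕ (var 1F ⊕ var 2F) ≐ var 3F ⊕ var 3F ∷ []) _
          (≤-trans (#-mono (λ w t' → proj₂ (third w t'))) (few (proj₁ (third u t)))) (few tj) (few tl) either≥5 counts

    impossible : ⊥
    impossible with size-fresh s L [] (≤-trans (s≤s z≤n) (≡⇒≥ size-3))
    ... | i , s-i' , _ with nbr-M p (≤-trans (≤-reflexive size-3) (n≤1+n 3)) s-i'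
    ... | x , ix , s-x with thin-neighbour s-i' s-x ix
    ... | j , tj , _ , _ with nbr-M p (≤-trans (≤-reflexive size-3) (n≤1+n 3)) (s-i tj)
    ... | x' , jx' , s-x' with thin-neighbour (s-i tj) s-x' jx'
    ... | l , tl , jl , _ with size-fresh s L (j ∷ l ∷ []) (≡⇒≥ size-3)
    ... | k , s-k , new = two-thin tj tl (~⇒≢ jl) s-k (λ q → new (here q)) (λ q → new (there (here q)))

-- Sides with two vertices

module PairSide {n : ℕ} (G : Graph n) (simple : IsSimple G) (quasi : QuasiConnected 5 G)
  (degrees : ∀ x y → Dist12 G x y → deg G x + deg G y ≥ 9)
  (uncontractible : Separation.Uncontractible G simple quasi degrees)
  (no-degree-4 : ∀ v → deg G v ≢ 4)
  where
  open Separation G simple quasi degrees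
  open DegreeFive G simple quasi degrees uncontractible no-degree-4

  record Pair (s : Colouring n) (z w : Fin n) : Set where
    field
      sep    : Sep5 s
      s-z    : s z ≡ L
      s-w    : s w ≡ L
      z≢w    : z ≢ w
      closed : ∀ {u} → s u ≡ L → u ≡ z ⊎ u ≡ w

  swap : ∀ {s z w} → Pair s z w → Pair s w z
  swap P = record { sep = sep ; s-z = s-w ; s-w = s-z ; z≢w = λ q → z≢w (sym q) ; closed = λ e → swap-⊎ (closed e) }
    where
    open Pair P

  -- The case where the cut through an edge from the pair to `x` swallows the whole pair.
  record Good (s : Colouring n) (x : Fin n) : Set where
    field
      {σ}   : Colouring n
      sepσ  : Sep5 σ
      s-x   : s x ≡ M
      σ-x   : σ x ≡ M
      L⊆M   : ∀ {u} → s u ≡ L → σ u ≡ M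
      only  : ∀ {u} → s u ≡ M → σ u ≡ M → u ≡ x
      ML≡2  : cell s σ M L ≡ 2
      MR≡2  : cell s σ M R ≡ 2

  -- The other case: the cut through `z` and `x` leaves `w` alone in a corner, so `w` is adjacent to
  -- the whole boundary, which omits only `k` from the cut of `s`.
  record Bad (s : Colouring n) (z w x : Fin n) : Set where
    field
      {σ} : Colouring n
      {k} : Fin n
      sepσ   : Sep5 σ
      σ-z    : σ z ≡ M
      σ-x    : σ x ≡ M
      σ-w    : σ w ≡ L
      s-k    : s k ≡ M
      σ-k    : σ k ≡ R
      w~z    : w ~ z
      w~cut  : ∀ {u} → s u ≡ M → u ≢ k → w ~ u

  pair-from : ∀ {s z w} → Sep5 s → size s L ≤ 2 → s z ≡ L → s w ≡ L → z ≢ w → Pair s z w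
  pair-from {s} {z} {w} p le s-z s-w ne = record { sep = p ; s-z = s-z ; s-w = s-w ; z≢w = ne ; closed = closed }
    where
    closed : ∀ {u} → s u ≡ L → u ≡ z ⊎ u ≡ w
    closed e with size-closed s L ((ne ∷ []) ∷ [] ∷ []) (s-z ∷ s-w ∷ []) le e
    ... | here q = inj₁ q
    ... | there (here q) = inj₂ q

  minimal-2 : Minimal 2
  minimal-2 = size-L

  module Edges {s : Colouring n} {z w : Fin n} (P : Pair s z w) where
    open Pair P

    size-2 : size s L ≡ 2
    size-2 = ≤-antisym (size-cover s L (z ∷ w ∷ []) (λ u e → covered (closed e))) (size-L sep)
      where
      covered : ∀ {u} → u ≡ z ⊎ u ≡ w → u ∈ z ∷ w ∷ []
      covered (inj₁ q) = here q
      covered (inj₂ q) = there (here q)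

    good-from : ∀ {σ x} → Sep5 σ → σ z ≡ M → σ w ≡ M → s x ≡ M → σ x ≡ M → Good s x
    good-from {σ} {x} pσ σz σw s-x σx with crossing minimal-2 sep size-2 pσ s-z σz s-x σx
    ... | X = record
      { sepσ = pσ ; s-x = s-x ; σ-x = σx ; L⊆M = L⊆M ; only = λ e f → inner-unique {s} {σ} MM≤1 s-x σx e f
      ; ML≡2 = ≡-by-contra (λ h → fm (con 3 ≼ ml ∷ H) _ h bLL bLR LM≥2 t≥1) (λ h → fm (con 1 ⊕ ml ≼ con 2 ∷ H) _ h bLL bLR LM≥2 t≥1)
      ; MR≡2 = ≡-by-contra (λ h → fm (con 3 ≼ mr ∷ H) _ h bLL bLR LM≥2 t≥1) (λ h → fm (con 1 ⊕ mr ≼ con 2 ∷ H) _ h bLL bLR LM≥2 t≥1) }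
      where
      open Crossing5 X renaming (bLL≤5 to bLL; bLR≤5 to bLR)
      fm = refute₅ sep pσ
      t≥1 = cell-member s σ s-x σx
      LM≥2 : 2 ≤ cell s σ L M
      LM≥2 = cell-distinct s σ L M ((z≢w ∷ []) ∷ [] ∷ []) ((s-z , σz) ∷ (s-w , σw) ∷ [])
      H : List (Constraint 9)
      H = bᴸᴸ ≼ con 5 ∷ bᴸᴿ ≼ con 5 ∷
          con 2 ≼ lm ∷ con 1 ≼ mm ∷ []
      MM≤1 : cell s σ M M ≤ 1
      MM≤1 = ≤-by-contra λ h → fm (con 2 ≼ mm ∷ H) _ h bLL bLR LM≥2 t≥1
      L⊆M : ∀ {u} → s u ≡ L → σ u ≡ M
      L⊆M e with closed e
      ... | inj₁ refl = σz
      ... | inj₂ refl = σw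

    -- Here `LM` is just `z`, and the corner of `w` has boundary exactly 5, so `ml + mm = 4` and a
    -- single vertex `k` is left for `MR`.
    bad-from : ∀ {σ x} → Sep5 σ → σ z ≡ M → σ w ≡ L → s x ≡ M → σ x ≡ M → Bad s z w x
    bad-from {σ} {x} pσ σz σw s-x σx with crossing minimal-2 sep size-2 pσ s-z σz s-x σx
    ... | X = build (cell-fresh s σ M R [] MR≥1)
      where
      open Crossing5 X
      fm = refute₅ sep pσ
      bLL≥5 = corner-5 sep pσ left left s-w σw
      LM≥1 : 1 ≤ cell s σ L M
      LM≥1 = cell-member s σ s-z σz
      LM≤1 : cell s σ L M ≤ 1
      LM≤1 = ≤-by-contra λ h → two (cell-fresh s σ L M (z ∷ []) h)
        where
        two : ∃[ u ] (s u ≡ L × σ u ≡ M × u ∉ z ∷ []) → ⊥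
        two (u , e , f , new) with closed e
        ... | inj₁ q = new (here q)
        ... | inj₂ refl = absurd σw f
      MR≥1 : 1 ≤ cell s σ M R
      MR≥1 = ≤-by-contra λ h → fm
        (con 1 ⊕ mr ≼ con 1 ∷ bᴸᴸ ≼ con 5 ∷ con 1 ≼ lm ∷ []) _
        h bLL≤5 LM≥1
      MR≤1 : cell s σ M R ≤ 1
      MR≤1 = ≤-by-contra λ h → fm
        (con 2 ≼ mr ∷ con 5 ≼ bᴸᴸ ∷ lm ≼ con 1 ∷ []) _
        h bLL≥5 LM≤1
      w-full : ∀ {u} → corner left left s σ u ≡ M → w ~ u
      w-full = corner-full sep pσ left left bLL≤5 s-w σw (inner-unique {s} {σ} LL≤1 s-w σw)
      build : ∃[ k ] (s k ≡ M × σ k ≡ R × k ∉ []) → Bad s z w x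
      build (k , s-k , σk , _) = record
        { sepσ = pσ ; σ-z = σz ; σ-x = σx ; σ-w = σw ; s-k = s-k ; σ-k = σk
        ; w~z = w-full (cong₂ (join left left) s-z σz) ; w~cut = w~cut }
        where
        w~cut : ∀ {u} → s u ≡ M → u ≢ k → w ~ u
        w~cut {u} e ne with σ u in f
        ... | L = w-full (cong₂ (join left left) e f)
        ... | M = w-full (cong₂ (join left left) e f)
        ... | R = ⊥-elim (ne (inner-unique {s} {σ} MR≤1 s-k σk e f))

    dichotomy : ∀ {x} → s x ≡ M → z ~ x → Good s x ⊎ Bad s z w x
    dichotomy {x} s-x zx with separated zx
    ... | σ , pσ , σz , σx with σ w in σw
    ...   | L = inj₂ (bad-from pσ σz σw s-x σx)
    ...   | M = inj₁ (good-from pσ σz σw s-x σx)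
    ...   | R = inj₂ (bad-from (flip-sep pσ) (cong op σz) (cong op σw) s-x (cong op σx))

    cut-adjacent : ∀ {x} → s x ≡ M → z ~ x ⊎ w ~ x
    cut-adjacent s-x with nbr-L sep s-x
    ... | y , xy , s-y with closed s-y
    ...   | inj₁ refl = inj₁ (~-sym xy)
    ...   | inj₂ refl = inj₂ (~-sym xy)

    -- Such a `k` is adjacent to `z`. A bad cut through `zk` would make `w` adjacent to every cut
    -- vertex but one off that cut, hence to `k`.
    good-nonneighbour : ∀ {k} → s k ≡ M → ¬ w ~ k → Good s k
    good-nonneighbour {k} s-k w≁k with cut-adjacent s-k
    ... | inj₂ a = ⊥-elim (w≁k a)
    ... | inj₁ a with dichotomy s-k a
    ...   | inj₁ good = good
    ...   | inj₂ bad with k Fin.≟ Bad.k bad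
    ...     | yes q = absurd (trans (cong (Bad.σ bad) (sym q)) (Bad.σ-x bad)) (Bad.σ-k bad)
    ...     | no ne = ⊥-elim (w≁k (Bad.w~cut bad s-k ne))

    half : ∀ {x} (g : Good s x) e → cell s (Good.σ g) M (side e) ≡ 2
    half g left = Good.ML≡2 g
    half g right = Good.MR≡2 g

    -- The cut of s minus x splits into two pairs with no edges between them.
    no-path : ∀ {x a b c} → Good s x → s a ≡ M → s b ≡ M → s c ≡ M → a ≢ x → b ≢ x → c ≢ x →
      a ≢ b → b ≢ c → a ≢ c → a ~ b → b ~ c → ⊥
    no-path {x} {a} {b} {c} good s-a s-b s-c ax bx cx ab bc ac a~b b~c = by-side (σ b) refl
      where
      open Good good
      same : ∀ e {u} → σ b ≡ side e → s u ≡ M → u ≢ x → b ~ u → σ u ≡ side e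
      same left {u} f e ne t with σ u in g
      ... | L = refl
      ... | M = ⊥-elim (ne (only e g))
      ... | R = ⊥-elim (valid sepσ t f g)
      same right {u} f e ne t with σ u in g
      ... | L = ⊥-elim (valid sepσ (~-sym t) g f)
      ... | M = ⊥-elim (ne (only e g))
      ... | R = refl
      three : ∀ e → σ b ≡ side e → ⊥
      three e f = <⇒≱ (cell-distinct s σ M (side e) ((ab ∷ ac ∷ []) ∷ (bc ∷ []) ∷ [] ∷ [])
        ((s-a , same e f s-a ax (~-sym a~b)) ∷ (s-b , f) ∷ (s-c , same e f s-c cx b~c) ∷ [])) (≤-reflexive (half good e))
      by-side : ∀ i → σ b ≡ i → ⊥
      by-side L f = three left f
      by-side M f = bx (only s-b f)
      by-side R f = three right f

    -- z and w have no neighbour in such a side, so they can be dropped from its boundary.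
    no-hidden : ∀ {κ} → Valid κ → κ z ≡ M → κ w ≡ M → (∀ {u} → s u ≡ M → κ u ≡ L → ⊥) → size κ M ≤ 6 → 2 ≤ size κ R →
      ∀ {g} → κ g ≡ L → ⊥
    no-hidden {κ} val κz κw none le r {g} κg = no-4-cut {κ₂}
      (drop-valid {κ₁} {w} (drop-valid {κ} {z} val (λ a f → hidden s-z a f)) (λ a f → hidden s-w a (off-z f)))
      (s≤s⁻¹ (≤-trans (≡⇒≥ (recolour-lose κ₁ w κ₁w (λ ())))
        (s≤s⁻¹ (≤-trans (≡⇒≥ (recolour-lose κ z κz (λ ()))) le))))
      (≤-trans r (size-mono λ u f → trans (recolour-off κ₁ w R (side-≢ κ f κw)) (trans (recolour-off κ z R (side-≢ κ f κz)) f)))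
      (trans (recolour-off κ₁ w R (side-≢ κ κg κw)) (trans (recolour-off κ z R (side-≢ κ κg κz)) κg))
      where
      κ₁ κ₂ : Colouring n
      κ₁ = recolour κ z R
      κ₂ = recolour κ₁ w R
      κ₁w : κ₁ w ≡ M
      κ₁w = trans (recolour-off κ z R (≢-sym z≢w)) κw
      off-z : ∀ {u} → κ₁ u ≡ L → κ u ≡ L
      off-z {u} f with recolour⁻ κ z R u f
      ... | inj₂ (_ , q) = q
      hidden : ∀ {x u} → s x ≡ L → x ~ u → κ u ≡ L → ⊥
      hidden {x} {u} s-x a f with s u in e
      ... | M = none e f
      ... | R = valid sep a s-x e
      ... | L with closed e
      ...   | inj₁ refl = absurd κz f
      ...   | inj₂ refl = absurd κw f

  open Good

  module _ {s : Colouring n} {z w : Fin n} (P : Pair s z w) where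
    open Pair P
    open Edges P

    -- Some k in the cut is not adjacent to a, so the cut minus k splits into two pairs; but z, w, x are connected.
    no-attached-pair : ∀ {σ a t x} → Pair σ a t → σ z ≡ M → σ w ≡ M → σ x ≡ M → s x ≡ M → deg G a ≡ 5 →
      a ~ t → a ~ z → a ~ w → a ~ x → ⊥
    no-attached-pair {σ} {a} {t} {x} Q σz σw σx s-x a5 at az aw ax
      with any? (λ k → (σ k ≟ˢ M) ×-dec ¬? (a ~? k))
    -- Otherwise `a` is adjacent to five cut vertices and to `t`, against degree 5.
    ... | no none = <⇒≱ (≤-refl {6}) (≤-trans (≡⇒≥ size-6) (≤-trans (M-deg _ adjacent) (≤-reflexive a5)))
      where
      size-6 : size (recolour σ t M) M ≡ 6
      size-6 = trans (recolour-gain σ t (λ e → absurd (Pair.s-w Q) e)) (cong suc (size-M (Pair.sep Q)))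
      adjacent : ∀ {u} → recolour σ t M u ≡ M → a ~ u
      adjacent {u} i with recolour⁻ σ t M u i
      ... | inj₁ (refl , _) = at
      ... | inj₂ (_ , e) with a ~? u
      ...   | yes au = au
      ...   | no na = ⊥-elim (none (u , e , na))
    ... | yes (k , σk , a≁k) = path (z ~? w)
      where
      good : Good σ k
      good = Edges.good-nonneighbour (swap Q) σk a≁k
      ≢k : ∀ {u} → a ~ u → u ≢ k
      ≢k au refl = a≁k au
      x≢z : x ≢ z
      x≢z = side-≢ s s-x s-z
      x≢w : x ≢ w
      x≢w = side-≢ s s-x s-w
      joined : ∀ {v u} → (∀ {y} → v ~ y → s y ≡ M) → s u ≡ M → v ~ u
      joined {v} within = saturated-M s within (≤-trans (≤-reflexive (size-M sep)) (5≤deg v))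
      z-in-M : ¬ z ~ w → ∀ {y} → z ~ y → s y ≡ M
      z-in-M nzw {y} zy with s y in e
      ... | M = refl
      ... | R = ⊥-elim (valid sep zy s-z e)
      ... | L with closed e
      ...   | inj₁ refl = ⊥-elim (~-irrefl zy)
      ...   | inj₂ refl = ⊥-elim (nzw zy)
      w-in-M : ¬ z ~ w → ∀ {y} → w ~ y → s y ≡ M
      w-in-M nzw {y} wy with s y in e
      ... | M = refl
      ... | R = ⊥-elim (valid sep wy s-w e)
      ... | L with closed e
      ...   | inj₁ refl = ⊥-elim (nzw (~-sym wy))
      ...   | inj₂ refl = ⊥-elim (~-irrefl wy)
      -- Either the edge `zw` extends to `x`, or `z` and `w` miss each other and then, by degree,
      -- both are adjacent to all five cut vertices, `x` included.
      path : Dec (z ~ w) → ⊥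
      path (yes zw) with cut-adjacent s-x
      ... | inj₁ zx = Edges.no-path Q good σx σz σw (≢k ax) (≢k az) (≢k aw) x≢z z≢w x≢w (~-sym zx) zw
      ... | inj₂ wx = Edges.no-path Q good σx σw σz (≢k ax) (≢k aw) (≢k az) x≢w (≢-sym z≢w) x≢z (~-sym wx) (~-sym zw)
      path (no nzw) = Edges.no-path Q good σz σx σw (≢k az) (≢k ax) (≢k aw) (≢-sym x≢z) x≢w z≢w
        (joined (z-in-M nzw) s-x) (~-sym (joined (w-in-M nzw) s-x))

    module Two {σ₁ σ₂ : Colouring n} (p₁ : Sep5 σ₁) (p₂ : Sep5 σ₂) (L⊆₁ : ∀ {u} → s u ≡ L → σ₁ u ≡ M) (L⊆₂ : ∀ {u} → s u ≡ L → σ₂ u ≡ M) where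
      in-corner : ∀ e e' {u} → s u ≡ L → corner e e' σ₁ σ₂ u ≡ M
      in-corner e e' i = join-MM e e' (L⊆₁ i) (L⊆₂ i)

      κ : End → End → Colouring n
      κ e e' = corner e e' σ₁ σ₂

      κ-valid : ∀ e e' → Valid (κ e e')
      κ-valid = corner-valid {σ₁} {σ₂} (valid p₁) (valid p₂)

      -- Both cuts contain `z` and `w`; if the corner avoids the cut of `s`, these two have no
      -- neighbour in it and 6 drops to 4.
      empty-corner : ∀ e e' → boundary e e' σ₁ σ₂ ≤ 6 → (∀ {u} → s u ≡ M → σ₁ u ≡ side e → σ₂ u ≡ side e' → ⊥) →
        cell σ₁ σ₂ (side e) (side e') ≡ 0
      empty-corner e e' le none = cell-empty σ₁ σ₂ λ i j → no-hidden {κ e e'} (κ-valid e e')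
        (in-corner e e' s-z) (in-corner e e' s-w)
        (λ {u} f g → none f (proj₁ (join-L⁻ e e' {σ₁ u} {σ₂ u} g)) (proj₂ (join-L⁻ e e' {σ₁ u} {σ₂ u} g)))
        (≤-trans (≤-reflexive (corner-M σ₁ σ₂ e e')) le) (corner-R p₁ σ₂ e e') (join-L⁺ e e' i j)

      -- Putting `a` into the boundary raises 5 to 6 and leaves no vertex of the cut of `s` inside,
      -- so `no-hidden` applies to whatever remains.
      singleton-corner : ∀ e e' → boundary e e' σ₁ σ₂ ≤ 5 → ∀ {a} → σ₁ a ≡ side e → σ₂ a ≡ side e' →
        (∀ {u} → s u ≡ M → σ₁ u ≡ side e → σ₂ u ≡ side e' → u ≡ a) → s a ≡ M →
        ∀ {u} → σ₁ u ≡ side e → σ₂ u ≡ side e' → u ≡ a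
      singleton-corner e e' le {a} i j only s-a {u} i' j' with u Fin.≟ a
      ... | yes q = q
      ... | no ne = ⊥-elim (no-hidden {κ'} κ'-valid
          (trans (recolour-off _ a M (side-≢ s s-z s-a)) (in-corner e e' s-z))
          (trans (recolour-off _ a M (side-≢ s s-w s-a)) (in-corner e e' s-w))
          none
          (≤-trans (≤-reflexive (recolour-gain (κ e e') a λ f → absurd (join-L⁺ e e' i j) f))
            (s≤s (≤-trans (≤-reflexive (corner-M σ₁ σ₂ e e')) le)))
          (≤-trans (corner-R p₁ σ₂ e e') (size-mono λ v f → trans (recolour-off _ a M (λ q → absurd (trans (cong (κ e e') (sym q)) f) (join-L⁺ e e' i j))) f))
          (trans (recolour-off _ a M ne) (join-L⁺ e e' i' j')))
        where
        κ' = recolour (κ e e') a M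
        κ'-valid : Valid κ'
        κ'-valid {x} {y} t f g with recolour⁻ (κ e e') a M x f | recolour⁻ (κ e e') a M y g
        ... | inj₂ (_ , f') | inj₂ (_ , g') = κ-valid e e' t f' g'
        none : ∀ {v} → s v ≡ M → κ' v ≡ L → ⊥
        none {v} h f with recolour⁻ (κ e e') a M v f
        ... | inj₂ (v≢a , f') with k , l ← join-L⁻ e e' {σ₁ v} {σ₂ v} f' = v≢a (only h k l)

    flip-good : ∀ {x} → Good s x → Good s x
    flip-good g = record
      { sepσ = flip-sep (sepσ g) ; s-x = s-x g ; σ-x = cong op (σ-x g) ; L⊆M = λ e → cong op (L⊆M g e)
      ; only = λ e f → only g e (op-injective f)
      ; ML≡2 = trans (cell-flip s (σ g) M L) (MR≡2 g) ; MR≡2 = trans (cell-flip s (σ g) M R) (ML≡2 g) }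

    to-right : ∀ {x y} → Good s x → s y ≡ M → y ≢ x → ∃[ g ] σ {s} {x} g y ≡ R
    to-right {x} {y} g s-y ne with σ g y in e
    ... | R = g , e
    ... | L = flip-good g , cong op e
    ... | M = ⊥-elim (ne (only g s-y e))

    record Mate {x : Fin n} (g : Good s x) (e : End) (y : Fin n) : Set where
      field
        {a}   : Fin n
        s-a   : s a ≡ M
        σ-a   : σ g a ≡ side e
        a≢y   : a ≢ y
        cover : ∀ {u} → s u ≡ M → σ g u ≡ side e → u ≡ y ⊎ u ≡ a

    mate : ∀ {x y} (g : Good s x) e → s y ≡ M → σ g y ≡ side e → Mate g e y
    mate {x} {y} g e s-y σy with cell-fresh s (σ g) M (side e) (y ∷ []) (≡⇒≥ (half g e))
    ... | a , s-a , σa , new = record { s-a = s-a ; σ-a = σa ; a≢y = λ q → new (here q) ; cover = cover }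
      where
      cover : ∀ {u} → s u ≡ M → σ g u ≡ side e → u ≡ y ⊎ u ≡ a
      cover h i with cell-closed s (σ g) M (side e) (((λ q → new (here (sym q))) ∷ []) ∷ [] ∷ []) ((s-y , σy) ∷ (s-a , σa) ∷ [])
        (≤-reflexive (half g e)) h i
      ... | here q = inj₁ q
      ... | there (here q) = inj₂ q

    module _ {s₁ s₂ a b : Fin n} (g₁ : Good s s₁) (g₂ : Good s s₂) (s-a : s a ≡ M)
      (₁-s₂ : σ g₁ s₂ ≡ R) (₁-a : σ g₁ a ≡ R) (₂-s₁ : σ g₂ s₁ ≡ R) (₂-a : σ g₂ a ≡ R)
      (₁-cover : ∀ {u} → s u ≡ M → σ g₁ u ≡ R → u ≡ s₂ ⊎ u ≡ a)
      (₂-cover : ∀ {u} → s u ≡ M → σ g₂ u ≡ R → u ≡ s₁ ⊎ u ≡ a)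
      (₁-b : σ g₁ b ≡ L) (₂-b : σ g₂ b ≡ L) where
      private
        σ₁ = σ g₁
        σ₂ = σ g₂
        p₁ = sepσ g₁
        p₂ = sepσ g₂
        module T₁₂ = Two p₁ p₂ (L⊆M g₁) (L⊆M g₂)
        fm = refute₅ p₁ p₂
        bLL≥5 = corner-5 p₁ p₂ left left ₁-b ₂-b
        bRR≥5 = corner-5 p₁ p₂ right right ₁-a ₂-a
        bRR≤5 : boundary right right σ₁ σ₂ ≤ 5
        bRR≤5 = ≤-by-contra λ h → fm
          (con 5 ≼ bᴸᴸ ∷ con 6 ≼ bᴿᴿ ∷ []) _ bLL≥5 h
        MM≥2 : 2 ≤ cell σ₁ σ₂ M M
        MM≥2 = cell-distinct σ₁ σ₂ M M ((z≢w ∷ []) ∷ [] ∷ []) ((L⊆M g₁ s-z , L⊆M g₂ s-z) ∷ (L⊆M g₁ s-w , L⊆M g₂ s-w) ∷ [])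
        single : ∀ {u} → σ₁ u ≡ R → σ₂ u ≡ R → u ≡ a
        single = T₁₂.singleton-corner right right bRR≤5 ₁-a ₂-a only-a s-a
          where
          only-a : ∀ {u} → s u ≡ M → σ₁ u ≡ R → σ₂ u ≡ R → u ≡ a
          only-a e f g with ₁-cover e f
          ... | inj₁ refl = absurd (σ-x g₂) g
          ... | inj₂ q = q
        RR≤1 : cell σ₁ σ₂ R R ≤ 1
        RR≤1 = cell-unique σ₁ σ₂ single
        full-a : ∀ {u} → corner right right σ₁ σ₂ u ≡ M → a ~ u
        full-a = corner-full p₁ p₂ right right bRR≤5 ₁-a ₂-a single
        a5 : deg G a ≡ 5
        a5 = corner-degree p₁ p₂ right right bRR≤5 ₁-a ₂-a single
        a~z : a ~ z
        a~z = full-a (T₁₂.in-corner right right s-z)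
        a~w : a ~ w
        a~w = full-a (T₁₂.in-corner right right s-w)
        a~s₁ : a ~ s₁
        a~s₁ = full-a (cong₂ (join right right) (σ-x g₁) ₂-s₁)
        a~s₂ : a ~ s₂
        a~s₂ = full-a (cong₂ (join right right) ₁-s₂ (σ-x g₂))

        pair : ∀ {τ t} → Sep5 τ → size τ R ≤ 2 → τ a ≡ R → τ t ≡ R → a ~ t → Pair (flip τ) a t
        pair {τ} pτ le τa τt at = pair-from (flip-sep pτ) (≤-trans (≤-reflexive (flip-size τ L)) le) (cong op τa) (cong op τt) (~⇒≢ at)

      -- The corners of `a` and `b` have boundary at least 5, so exactly 5, and `RR` is just `a`,
      -- adjacent to `z`, `w`, `s₁` and `s₂`. One of the other two boundaries is at most 5; its
      -- corner is empty, which shrinks a side to `a` and one of `s₁`, `s₂`. That pair is attached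
      -- to `z`, `w` and the other one.
      no-overlap : ⊥
      no-overlap with boundary right left σ₁ σ₂ ≤? 5
      ... | yes bRL = no-attached-pair (pair p₁ two ₁-a ₁-s₂ a~s₂)
            (cong op (L⊆M g₁ s-z)) (cong op (L⊆M g₁ s-w)) (cong op (σ-x g₁)) (s-x g₁) a5 a~s₂ a~z a~w a~s₁
        where
        RL≡0 : cell σ₁ σ₂ R L ≡ 0
        RL≡0 = T₁₂.empty-corner right left (≤-trans bRL (n≤1+n 5)) none
          where
          none : ∀ {u} → s u ≡ M → σ₁ u ≡ R → σ₂ u ≡ L → ⊥
          none e f g with ₁-cover e f
          ... | inj₁ refl = absurd (σ-x g₂) g
          ... | inj₂ refl = absurd ₂-a g
        two : size σ₁ R ≤ 2
        two = ≤-trans (≤-reflexive (Rows.rowR σ₁ σ₂)) (≤-by-contra λ h → fm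
          (con 3 ≼ rowᴿ ∷ con 5 ≼ bᴸᴸ ∷ con 5 ≼ bᴿᴿ ∷
           bᴿᴸ ≼ con 5 ∷ con 2 ≼ mm ∷ rl ≐ con 0 ∷ rr ≼ con 1 ∷ []) _ h bLL≥5 bRR≥5 bRL MM≥2 RL≡0 RR≤1)
      ... | no bRL = no-attached-pair (pair p₂ two ₂-a ₂-s₁ a~s₁)
            (cong op (L⊆M g₂ s-z)) (cong op (L⊆M g₂ s-w)) (cong op (σ-x g₂)) (s-x g₂) a5 a~s₁ a~z a~w a~s₂
        where
        bLR : boundary left right σ₁ σ₂ ≤ 5
        bLR = ≤-by-contra λ h → fm
          (con 6 ≼ bᴸᴿ ∷ con 6 ≼ bᴿᴸ ∷ []) _ h (≰⇒> bRL)
        LR≡0 : cell σ₁ σ₂ L R ≡ 0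
        LR≡0 = T₁₂.empty-corner left right (≤-trans bLR (n≤1+n 5)) none
          where
          none : ∀ {u} → s u ≡ M → σ₁ u ≡ L → σ₂ u ≡ R → ⊥
          none e f g with ₂-cover e g
          ... | inj₁ refl = absurd (σ-x g₁) f
          ... | inj₂ refl = absurd ₁-a f
        two : size σ₂ R ≤ 2
        two = ≤-trans (≤-reflexive (Rows.colR σ₁ σ₂)) (≤-by-contra λ h → fm
          (con 3 ≼ colᴿ ∷ con 5 ≼ bᴸᴸ ∷ con 5 ≼ bᴿᴿ ∷
           bᴸᴿ ≼ con 5 ∷ con 2 ≼ mm ∷ lr ≐ con 0 ∷ rr ≼ con 1 ∷ []) _ h bLL≥5 bRR≥5 bLR MM≥2 LR≡0 RR≤1)

    data InCut (s₁ s₂ a b c u : Fin n) : Set where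
      is-s₁ : u ≡ s₁ → InCut s₁ s₂ a b c u
      is-s₂ : u ≡ s₂ → InCut s₁ s₂ a b c u
      is-a  : u ≡ a → InCut s₁ s₂ a b c u
      is-b  : u ≡ b → InCut s₁ s₂ a b c u
      is-c  : u ≡ c → InCut s₁ s₂ a b c u

    -- The cut is {s₁ , s₂ , a , b , c}; without s₁ it splits into {s₂ , a} and {b , c},
    -- without s₂ into {a , c} and {s₁ , b}.
    record Shape (s₁ s₂ : Fin n) : Set where
      field
        {a b c} : Fin n
        g₁ : Good s s₁
        g₂ : Good s s₂
        s-a : s a ≡ M
        s-b : s b ≡ M
        s-c : s c ≡ M
        ₁-s₂ : σ g₁ s₂ ≡ R
        ₁-a : σ g₁ a ≡ R
        ₁-b : σ g₁ b ≡ L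
        ₁-c : σ g₁ c ≡ L
        ₂-a : σ g₂ a ≡ R
        ₂-c : σ g₂ c ≡ R
        ₂-s₁ : σ g₂ s₁ ≡ L
        ₂-b : σ g₂ b ≡ L
        b≢c : b ≢ c
        cover : ∀ {u} → s u ≡ M → InCut s₁ s₂ a b c u

    -- The first cut is oriented to have `s₂` in `R`, with mate `a`, and the second to have `a` in
    -- `R`. If the mate of `a` there is `s₁`, the two halves overlap as in `no-overlap`; any other
    -- mate is the vertex `c`.
    shape : ∀ {s₁ s₂} → Good s s₁ → Good s s₂ → s₁ ≢ s₂ → Shape s₁ s₂
    shape {s₁} {s₂} h₁ h₂ ne with to-right h₁ (s-x h₂) (≢-sym ne)
    ... | g₁ , ₁-s₂ with mate g₁ right (s-x h₂) ₁-s₂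
    ... | A with to-right h₂ (Mate.s-a A) (Mate.a≢y A)
    ... | g₂ , ₂-a with mate g₂ right (Mate.s-a A) ₂-a
    ... | C with Mate.a C Fin.≟ s₁
    ... | yes refl = ⊥-elim (second (cell-fresh s (σ g₁) M L [] (≤-trans (s≤s z≤n) (≡⇒≥ (ML≡2 g₁)))))
      where
      second : ∃[ b ] (s b ≡ M × σ g₁ b ≡ L × b ∉ []) → ⊥
      second (b , s-b , ₁-b , _) with σ g₂ b in ₂-b
      ... | L = no-overlap g₁ g₂ (Mate.s-a A) ₁-s₂ (Mate.σ-a A) (Mate.σ-a C) ₂-a (Mate.cover A)
              (λ e f → swap-⊎ (Mate.cover C e f)) ₁-b ₂-b
      ... | M with refl ← only g₂ s-b ₂-b = absurd ₁-s₂ ₁-b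
      ... | R with Mate.cover C s-b ₂-b
      ...   | inj₁ refl = absurd (Mate.σ-a A) ₁-b
      ...   | inj₂ refl = absurd (σ-x g₁) ₁-b
    ... | no c≢s₁ = complete (mate g₁ left (Mate.s-a C) ₁-c)
      where
      a = Mate.a A
      c = Mate.a C
      ₁-c : σ g₁ c ≡ L
      ₁-c with σ g₁ c in e
      ... | L = refl
      ... | M = ⊥-elim (c≢s₁ (only g₁ (Mate.s-a C) e))
      ... | R with Mate.cover A (Mate.s-a C) e
      ...   | inj₁ q = absurd (trans (cong (σ g₂) q) (σ-x g₂)) (Mate.σ-a C)
      ...   | inj₂ q = ⊥-elim (Mate.a≢y C q)
      ₂-s₁ : σ g₂ s₁ ≡ L
      ₂-s₁ with σ g₂ s₁ in e
      ... | L = refl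
      ... | M = ⊥-elim (ne (only g₂ (s-x g₁) e))
      ... | R with Mate.cover C (s-x g₁) e
      ...   | inj₁ q = absurd (trans (cong (σ g₁) q) (Mate.σ-a A)) (σ-x g₁)
      ...   | inj₂ q = ⊥-elim (c≢s₁ (sym q))
      complete : Mate g₁ left c → Shape s₁ s₂
      complete B = record
        { g₁ = g₁ ; g₂ = g₂ ; s-a = Mate.s-a A ; s-b = Mate.s-a B ; s-c = Mate.s-a C
        ; ₁-s₂ = ₁-s₂ ; ₁-a = Mate.σ-a A ; ₁-b = Mate.σ-a B ; ₁-c = ₁-c
        ; ₂-a = ₂-a ; ₂-c = Mate.σ-a C ; ₂-s₁ = ₂-s₁ ; ₂-b = ₂-b ; b≢c = Mate.a≢y B ; cover = cover }
        where
        ₂-b : σ g₂ (Mate.a B) ≡ L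
        ₂-b with σ g₂ (Mate.a B) in e
        ... | L = refl
        ... | M = absurd (trans (cong (σ g₁) (only g₂ (Mate.s-a B) e)) ₁-s₂) (Mate.σ-a B)
        ... | R with Mate.cover C (Mate.s-a B) e
        ...   | inj₁ q = absurd (trans (cong (σ g₁) q) (Mate.σ-a A)) (Mate.σ-a B)
        ...   | inj₂ q = ⊥-elim (Mate.a≢y B q)
        cover : ∀ {u} → s u ≡ M → InCut s₁ s₂ a (Mate.a B) c u
        cover {u} e with σ g₁ u in f
        ... | M = is-s₁ (only g₁ e f)
        ... | L with Mate.cover B e f
        ...   | inj₁ q = is-c q
        ...   | inj₂ q = is-b q
        cover {u} e | R with Mate.cover A e f
        ...   | inj₁ q = is-s₂ q
        ...   | inj₂ q = is-a q

    module Shapes {s₁ s₂ : Fin n} (S : Shape s₁ s₂) where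
      open Shape S
      σ₁ σ₂ : Colouring n
      σ₁ = σ g₁
      σ₂ = σ g₂
      p₁ : Sep5 σ₁
      p₁ = sepσ g₁
      p₂ : Sep5 σ₂
      p₂ = sepσ g₂
      module T₁₂ = Two p₁ p₂ (L⊆M g₁) (L⊆M g₂)

      private
        fm = refute₅ p₁ p₂

      bLL≥5 : 5 ≤ boundary left left σ₁ σ₂
      bLL≥5 = corner-5 p₁ p₂ left left ₁-b ₂-b
      bRR≥5 : 5 ≤ boundary right right σ₁ σ₂
      bRR≥5 = corner-5 p₁ p₂ right right ₁-a ₂-a
      bLR≥5 : 5 ≤ boundary left right σ₁ σ₂
      bLR≥5 = corner-5 p₁ p₂ left right ₁-c ₂-c
      bRR≤5 : boundary right right σ₁ σ₂ ≤ 5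
      bRR≤5 = ≤-by-contra λ h → fm
        (con 5 ≼ bᴸᴸ ∷ con 6 ≼ bᴿᴿ ∷ []) _ bLL≥5 h
      bLL≤5 : boundary left left σ₁ σ₂ ≤ 5
      bLL≤5 = ≤-by-contra λ h → fm
        (con 6 ≼ bᴸᴸ ∷ con 5 ≼ bᴿᴿ ∷ []) _ h bRR≥5
      bRL≤5 : boundary right left σ₁ σ₂ ≤ 5
      bRL≤5 = ≤-by-contra λ h → fm
        (con 5 ≼ bᴸᴿ ∷ con 6 ≼ bᴿᴸ ∷ []) _ bLR≥5 h

      single-a : ∀ {u} → σ₁ u ≡ R → σ₂ u ≡ R → u ≡ a
      single-a = T₁₂.singleton-corner right right bRR≤5 ₁-a ₂-a only-a s-a
        where
        only-a : ∀ {u} → s u ≡ M → σ₁ u ≡ R → σ₂ u ≡ R → u ≡ a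
        only-a e f g with cover e
        ... | is-s₁ refl = absurd (σ-x g₁) f
        ... | is-s₂ refl = absurd (σ-x g₂) g
        ... | is-a q = q
        ... | is-b refl = absurd ₁-b f
        ... | is-c refl = absurd ₁-c f
      single-b : ∀ {u} → σ₁ u ≡ L → σ₂ u ≡ L → u ≡ b
      single-b = T₁₂.singleton-corner left left bLL≤5 ₁-b ₂-b only-b s-b
        where
        only-b : ∀ {u} → s u ≡ M → σ₁ u ≡ L → σ₂ u ≡ L → u ≡ b
        only-b e f g with cover e
        ... | is-s₁ refl = absurd (σ-x g₁) f
        ... | is-s₂ refl = absurd ₁-s₂ f
        ... | is-a refl = absurd ₁-a f
        ... | is-b q = q
        ... | is-c refl = absurd ₂-c g
      a~s₂ : a ~ s₂
      a~s₂ = corner-full p₁ p₂ right right bRR≤5 ₁-a ₂-a single-a (cong₂ (join right right) ₁-s₂ (σ-x g₂))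
      b~s₁ : b ~ s₁
      b~s₁ = corner-full p₁ p₂ left left bLL≤5 ₁-b ₂-b single-b (cong₂ (join left left) (σ-x g₁) ₂-s₁)

      -- Being adjacent, `b` and `s₁` form one half at `c`. This half and the half `b`, `c` at `s₁`
      -- share `b`, and `a` is opposite to both: again `no-overlap`.
      no-third-good : Good s c → ⊥
      no-third-good good with to-right good (s-x g₁) (side-≢ σ₁ (σ-x g₁) ₁-c)
      ... | g₃ , ₃-s₁ = no-overlap (flip-good g₁) g₃ s-b (cong op ₁-c) (cong op ₁-b) ₃-s₁ ₃-b flip-cover cover₃ (cong op ₁-a) ₃-a
        where
        b≢s₁ : b ≢ s₁
        b≢s₁ = side-≢ σ₁ ₁-b (σ-x g₁)
        ₃-b : σ g₃ b ≡ R
        ₃-b with σ g₃ b in e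
        ... | R = refl
        ... | L = ⊥-elim (valid (sepσ g₃) b~s₁ e ₃-s₁)
        ... | M = ⊥-elim (b≢c (only g₃ s-b e))
        flip-cover : ∀ {u} → s u ≡ M → flip σ₁ u ≡ R → u ≡ c ⊎ u ≡ b
        flip-cover {u} e f with cover e
        ... | is-s₁ refl = absurd (cong op (σ-x g₁)) f
        ... | is-s₂ refl = absurd (cong op ₁-s₂) f
        ... | is-a refl = absurd (cong op ₁-a) f
        ... | is-b q = inj₂ q
        ... | is-c q = inj₁ q
        cover₃ : ∀ {u} → s u ≡ M → σ g₃ u ≡ R → u ≡ s₁ ⊎ u ≡ b
        cover₃ e f = through (mate g₃ right (s-x g₁) ₃-s₁)
          where
          through : Mate g₃ right s₁ → _ ≡ s₁ ⊎ _ ≡ b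
          through m with Mate.cover m e f | Mate.cover m s-b ₃-b
          ... | inj₁ q | _ = inj₁ q
          ... | inj₂ q | inj₁ r = ⊥-elim (b≢s₁ r)
          ... | inj₂ q | inj₂ r = inj₂ (trans q (sym r))
        ₃-a : σ g₃ a ≡ L
        ₃-a with σ g₃ a in e
        ... | L = refl
        ... | M = ⊥-elim (side-≢ σ₁ ₁-a ₁-c (only g₃ s-a e))
        ... | R with cover₃ s-a e
        ...   | inj₁ q = ⊥-elim (side-≢ σ₁ ₁-a (σ-x g₁) q)
        ...   | inj₂ q = ⊥-elim (side-≢ σ₁ ₁-a ₁-b q)

      module _ (z≁s₂ : ¬ z ~ s₂) (w≁s₁ : ¬ w ~ s₁)
        (z~cut : ∀ {u} → s u ≡ M → u ≢ s₂ → z ~ u) (w~cut : ∀ {u} → s u ≡ M → u ≢ s₁ → w ~ u) where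
        private
          MM≥2 : 2 ≤ cell σ₁ σ₂ M M
          MM≥2 = cell-distinct σ₁ σ₂ M M ((z≢w ∷ []) ∷ [] ∷ []) ((L⊆M g₁ s-z , L⊆M g₂ s-z) ∷ (L⊆M g₁ s-w , L⊆M g₂ s-w) ∷ [])
          RL≡0 : cell σ₁ σ₂ R L ≡ 0
          RL≡0 = T₁₂.empty-corner right left (≤-trans bRL≤5 (n≤1+n 5)) none
            where
            none : ∀ {u} → s u ≡ M → σ₁ u ≡ R → σ₂ u ≡ L → ⊥
            none e f g with cover e
            ... | is-s₁ refl = absurd (σ-x g₁) f
            ... | is-s₂ refl = absurd (σ-x g₂) g
            ... | is-a refl = absurd ₂-a g
            ... | is-b refl = absurd ₁-b f
            ... | is-c refl = absurd ₁-c f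
          H : List (Constraint 9)
          H = con 5 ≼ bᴸᴸ ∷ con 5 ≼ bᴿᴿ ∷
              con 5 ≼ bᴸᴿ ∷ con 2 ≼ mm ∷ rl ≐ con 0 ∷ []
          side₁ : size σ₁ R ≤ 2
          side₁ = ≤-trans (≤-reflexive (Rows.rowR σ₁ σ₂)) (≤-by-contra λ h → fm
            (con 3 ≼ rowᴿ ∷ rr ≼ con 1 ∷ H) _ h (cell-unique σ₁ σ₂ single-a) bLL≥5 bRR≥5 bLR≥5 MM≥2 RL≡0)
          side₂ : size σ₂ L ≤ 2
          side₂ = ≤-trans (≤-reflexive (Rows.colL σ₁ σ₂)) (≤-by-contra λ h → fm
            (con 3 ≼ colᴸ ∷ ll ≼ con 1 ∷ H) _ h (cell-unique σ₁ σ₂ single-b) bLL≥5 bRR≥5 bLR≥5 MM≥2 RL≡0)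

          P₁ : Pair (flip σ₁) a s₂
          P₁ = pair-from (flip-sep p₁) (≤-trans (≤-reflexive (flip-size σ₁ L)) side₁) (cong op ₁-a) (cong op ₁-s₂) (~⇒≢ a~s₂)
          P₂ : Pair σ₂ b s₁
          P₂ = pair-from p₂ side₂ ₂-b ₂-s₁ (~⇒≢ b~s₁)

          s₂~ : ∀ {u} → σ₁ u ≡ M → u ≢ z → s₂ ~ u
          s₂~ e = missing-one (Pair.sep P₁) (Pair.s-z P₁) (Pair.s-w P₁) (Pair.closed P₁) (cong op (L⊆M g₁ s-z)) (λ a → z≁s₂ (~-sym a)) (5≤deg s₂) (cong op e)
          s₁~ : ∀ {u} → σ₂ u ≡ M → u ≢ w → s₁ ~ u
          s₁~ = missing-one p₂ ₂-b ₂-s₁ (Pair.closed P₂) (L⊆M g₂ s-w) (λ a → w≁s₁ (~-sym a)) (5≤deg s₁)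
          s₂~s₁ : s₂ ~ s₁
          s₂~s₁ = s₂~ (σ-x g₁) (side-≢ s (s-x g₁) s-z)
          s₂≢s₁ : s₂ ≢ s₁
          s₂≢s₁ = ~⇒≢ s₂~s₁
          z~a : z ~ a
          z~a = z~cut s-a (side-≢ σ₂ ₂-a (σ-x g₂))
          w~b : w ~ b
          w~b = w~cut s-b (side-≢ σ₁ ₁-b (σ-x g₁))
          w~s₂ : w ~ s₂
          w~s₂ = w~cut (s-x g₂) s₂≢s₁
          w~c : w ~ c
          w~c = w~cut s-c (side-≢ σ₁ ₁-c (σ-x g₁))

          -- The path from `s₂` through `s₁` to `b` would lie in a half of two vertices.
          not-good : Good s a → ⊥
          not-good good = no-path good (s-x g₂) (s-x g₁) s-b (side-≢ σ₂ (σ-x g₂) ₂-a) (side-≢ σ₁ (σ-x g₁) ₁-a)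
            (side-≢ σ₁ ₁-b ₁-a) s₂≢s₁ (side-≢ σ₁ (σ-x g₁) ₁-b) (side-≢ σ₁ ₁-s₂ ₁-b) s₂~s₁ (~-sym b~s₁)

          module _ {τ : Colouring n} (pτ : Sep5 τ) (τz : τ z ≡ M) (τa : τ a ≡ M) (τw : τ w ≡ L) (τs₁ : τ s₁ ≡ R) where
            τs₂ : τ s₂ ≡ M
            τs₂ with τ s₂ in e
            ... | L = ⊥-elim (valid pτ s₂~s₁ e τs₁)
            ... | M = refl
            ... | R = ⊥-elim (valid pτ w~s₂ τw e)
            τb : τ b ≡ M
            τb with τ b in e
            ... | L = ⊥-elim (valid pτ b~s₁ e τs₁)
            ... | M = refl
            ... | R = ⊥-elim (valid pτ w~b τw e)
            -- With `c` in the cut, none of `w`, `z`, `b` keeps a neighbour in `L`, so all three can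
            -- go to `R`. The cut gains `c` and loses `z` and `b`: 4 vertices.
            τ₁ τ₂ τ₃ τ₄ : Colouring n
            τ₁ = recolour τ c M
            τ₂ = recolour τ₁ w R
            τ₃ = recolour τ₂ z R
            τ₄ = recolour τ₃ b R
            z≢c : z ≢ c
            z≢c = side-≢ s s-z s-c
            b≢z : b ≢ z
            b≢z = side-≢ s s-b s-z
            τ₁-L : ∀ {u} → τ₁ u ≡ L → τ u ≡ L × u ≢ c
            τ₁-L {u} e with recolour⁻ τ c M u e
            ... | inj₂ (ne , f) = f , ne
            τ₂-L : ∀ {u} → τ₂ u ≡ L → τ u ≡ L × u ≢ c × u ≢ w
            τ₂-L {u} e with recolour⁻ τ₁ w R u e
            ... | inj₂ (ne , f) = proj₁ (τ₁-L f) , proj₂ (τ₁-L f) , ne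
            τ₃-L : ∀ {u} → τ₃ u ≡ L → τ u ≡ L × u ≢ c × u ≢ w
            τ₃-L {u} e with recolour⁻ τ₂ z R u e
            ... | inj₂ (_ , f) = τ₂-L f
            τ₁-valid : Valid τ₁
            τ₁-valid {x} {y} t f g with recolour⁻ τ c M y g
            ... | inj₂ (_ , h) = valid pτ t (proj₁ (τ₁-L f)) h
            outside : ∀ {x u} → s x ≡ L → x ~ u → τ u ≡ L → u ≢ c → u ≢ w → u ≢ x → ⊥
            outside {x} {u} s-x' t f u≢c u≢w u≢x with s u in e
            ... | R = valid sep t s-x' e
            ... | L with closed e
            ...   | inj₁ refl = absurd τz f
            ...   | inj₂ q = u≢w q
            outside {x} {u} s-x' t f u≢c u≢w u≢x | M with cover e
            ... | is-s₁ refl = absurd τs₁ f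
            ... | is-s₂ refl = absurd τs₂ f
            ... | is-a refl = absurd τa f
            ... | is-b refl = absurd τb f
            ... | is-c q = u≢c q
            -- Side `L` of `σ₂` is the pair `b`, `s₁`, and all of its cut except `w` is adjacent to
            -- `s₁`, which `τ` puts in `R`.
            b-outside : ∀ {u} → b ~ u → τ u ≡ L → u ≢ w → ⊥
            b-outside {u} t f u≢w with σ₂ u in e
            ... | R = valid p₂ t ₂-b e
            ... | M = valid pτ (~-sym (s₁~ e u≢w)) f τs₁
            ... | L with Pair.closed P₂ e
            ...   | inj₁ refl = ~-irrefl t
            ...   | inj₂ refl = absurd τs₁ f
            τ₂-valid : Valid τ₂
            τ₂-valid = drop-valid {τ₁} {w} τ₁-valid λ t f → let g , ne = τ₁-L f in
              outside s-w t g ne (≢-sym (~⇒≢ t)) (≢-sym (~⇒≢ t))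
            τ₃-valid : Valid τ₃
            τ₃-valid = drop-valid {τ₂} {z} τ₂-valid λ t f → let g , ne , ne' = τ₂-L f in
              outside s-z t g ne ne' (≢-sym (~⇒≢ t))
            τ₄-valid : Valid τ₄
            τ₄-valid = drop-valid {τ₃} {b} τ₃-valid λ t f → let g , _ , ne' = τ₃-L f in b-outside t g ne'
            τ₂z : τ₂ z ≡ M
            τ₂z = trans (recolour-off τ₁ w R z≢w) (trans (recolour-off τ c M z≢c) τz)
            τ₃b : τ₃ b ≡ M
            τ₃b = trans (recolour-off τ₂ z R b≢z) (trans (recolour-off τ₁ w R (side-≢ τ τb τw)) (trans (recolour-off τ c M b≢c) τb))
            τ₄-M : size τ₄ M ≤ 4
            τ₄-M = s≤s⁻¹ (≤-trans (≡⇒≥ (recolour-lose τ₃ b τ₃b (λ ())))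
              (s≤s⁻¹ (≤-trans (≡⇒≥ (recolour-lose τ₂ z τ₂z (λ ()))) (≤-trans (recolour-≤ τ₁ w (λ ()))
                (≤-trans (recolour-≤suc τ c) (s≤s (≤-reflexive (size-M pτ))))))))
            keep-R : ∀ {κ : Colouring n} {x u} → κ u ≡ R → recolour κ x R u ≡ R
            keep-R {κ} {x} {u} e with u Fin.≟ x
            ... | yes refl = recolour-at κ x R
            ... | no ne = trans (recolour-off κ x R ne) e
            τ₄-R : 2 ≤ size τ₄ R
            τ₄-R = ≤-trans (size-R pτ) (size-mono λ u e → keep-R {τ₃} (keep-R {τ₂} (keep-R {τ₁}
              (trans (recolour-off τ c M (λ q → valid pτ w~c τw (trans (cong τ (sym q)) e))) e))))

            -- It remains to see that `τ₄` has a vertex in `L`: `τ` contains the pair `a`, `s₂`, so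
            -- it is good for that pair and has two vertices of the cut of `σ₁` in `L`, of which one
            -- is not `w`.
            no-bad-cut : ⊥
            no-bad-cut = from-cell (≡⇒≥ (Good.ML≡2 (Edges.good-from P₁ pτ τa τs₂ (cong op (L⊆M g₁ s-z)) τz)))
              where
              from-cell : 2 ≤ cell (flip σ₁) τ M L → ⊥
              from-cell two with cell-fresh (flip σ₁) τ M L (w ∷ []) two
              ... | u , e , τu , new = no-4-cut {τ₄} τ₄-valid τ₄-M τ₄-R
                (trans (recolour-off τ₃ b R (side-≢ τ τu τb)) (trans (recolour-off τ₂ z R (side-≢ τ τu τz))
                  (trans (recolour-off τ₁ w R (λ q → new (here q))) (trans (recolour-off τ c M u≢c) τu))))
                where
                u≢c : u ≢ c
                u≢c = side-≢ σ₁ (op-injective e) ₁-c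

        both-miss : ⊥
        both-miss with dichotomy s-a z~a
        ... | inj₁ good = not-good good
        ... | inj₂ bad with Bad.k bad Fin.≟ s₁
        ...   | yes q = no-bad-cut (Bad.sepσ bad) (Bad.σ-z bad) (Bad.σ-x bad) (Bad.σ-w bad) (trans (cong (Bad.σ bad) (sym q)) (Bad.σ-k bad))
        ...   | no ne = w≁s₁ (Bad.w~cut bad (s-x g₁) (≢-sym ne))

  -- The vertices `k` missed by `w` and `k'` missed by `z` both carry good cuts, and they differ
  -- since every cut vertex has a neighbour in the pair; this is the situation of `both-miss`.
  no-two-bad : ∀ {s z w x} → Pair s z w → Bad s z w x → Bad s w z x → ⊥
  no-two-bad {s} {z} {w} P bad bad' = Shapes.both-miss P (shape P good good' k≢k') z≁k' w≁k
    (λ e ne → Bad.w~cut bad' e ne) (λ e ne → Bad.w~cut bad e ne)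
    where
    open Pair P
    w≁k : ¬ w ~ Bad.k bad
    w≁k a = valid (Bad.sepσ bad) a (Bad.σ-w bad) (Bad.σ-k bad)
    z≁k' : ¬ z ~ Bad.k bad'
    z≁k' a = valid (Bad.sepσ bad') a (Bad.σ-w bad') (Bad.σ-k bad')
    good : Good s (Bad.k bad)
    good = Edges.good-nonneighbour P (Bad.s-k bad) w≁k
    good' : Good s (Bad.k bad')
    good' = Edges.good-nonneighbour (swap P) (Bad.s-k bad') z≁k'
    k≢k' : Bad.k bad ≢ Bad.k bad'
    k≢k' q with Edges.cut-adjacent P (Bad.s-k bad)
    ... | inj₁ a = z≁k' (subst (z ~_) q a)
    ... | inj₂ a = w≁k a

  -- If the cut through `zx` is bad, then `w` is adjacent to `x` and the edge `wx` gives a second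
  -- chance.
  good-via : ∀ {s z w x} → Pair s z w → s x ≡ M → z ~ x → Good s x
  good-via {s} {z} {w} {x} P s-x a with Edges.dichotomy P s-x a
  ... | inj₁ good = good
  ... | inj₂ bad with Edges.dichotomy (swap P) s-x (Bad.w~cut bad s-x x≢k)
    where
    x≢k : x ≢ Bad.k bad
    x≢k = side-≢ (Bad.σ bad) (Bad.σ-x bad) (Bad.σ-k bad)
  ...   | inj₁ good = good
  ...   | inj₂ bad' = ⊥-elim (no-two-bad P bad bad')

  all-good : ∀ {s z w} → Pair s z w → ∀ {x} → s x ≡ M → Good s x
  all-good P s-x with Edges.cut-adjacent P s-x
  ... | inj₁ a = good-via P s-x a
  ... | inj₂ a = good-via (swap P) s-x a

  no-pair : ∀ {s z w} → Pair s z w → ⊥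
  no-pair {s} P with size-fresh s M [] (≤-trans (s≤s z≤n) (≡⇒≥ (size-M (Pair.sep P))))
  ... | x , s-x , _ with size-fresh s M (x ∷ []) (≤-trans (s≤s (s≤s z≤n)) (≡⇒≥ (size-M (Pair.sep P))))
  ... | y , s-y , new = Shapes.no-third-good P S (all-good P (Shape.s-c S))
    where
    S = shape P (all-good P s-x) (all-good P s-y) (λ q → new (here (sym q)))

  -- A smallest side has at most 4 vertices, since an edge from it to the cut
  -- yields a cut that meets it in at most 2 vertices and isolates at most 2 others.
  no-minimal : ∀ {s k} → Sep5 s → size s L ≡ k → Minimal k → ⊥
  no-minimal {s} {k} p size-k min with size-L p
  ... | l with size-fresh s L [] (≤-trans (s≤s z≤n) l)
  ... | z , s-z , _ with size-fresh s L (z ∷ []) l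
  ... | w , s-w , new with size s L ≤? 2
  ... | yes le = no-pair (pair-from p le s-z s-w λ q → new (here (sym q)))
  ... | no gt with size s L ≟ 3
  ...   | yes e = Three.impossible p e (subst Minimal (trans (sym size-k) e) min)
  ...   | no ne3 with size s L ≟ 4
  ...     | yes e = Four.impossible p e (subst Minimal (trans (sym size-k) e) min)
  ...     | no ne4 = ne4 (≤-antisym (at-most-4 (nbr-L p s-m)) (≤∧≢⇒< (≰⇒> gt) (λ e → ne3 (sym e))))
    where
    cut-vertex = size-fresh s M [] (≤-trans (s≤s z≤n) (≡⇒≥ (size-M p)))
    s-m = proj₁ (proj₂ cut-vertex)
    at-most-4 : ∃[ y ] (proj₁ cut-vertex ~ y × s y ≡ L) → size s L ≤ 4
    at-most-4 (y , a , s-y) with separated a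
    ... | σ , pσ , σm , σy with crossing min p size-k pσ s-y σy s-m σm
    ...   | X = ≤-trans (≤-reflexive (Rows.rowL s σ)) (≤-by-contra λ h → refute₅ p pσ
      (con 5 ≼ rowᴸ ∷ bᴸᴸ ≼ con 5 ∷
       bᴸᴿ ≼ con 5 ∷ ll ≼ con 1 ∷ lr ≼ con 1 ∷ con 1 ≼ mm ∷ []) _
      h (Crossing5.bLL≤5 X) (Crossing5.bLR≤5 X) (Crossing5.LL≤1 X) (Crossing5.LR≤1 X) (cell-member s σ s-m σm))

  -- Minimality comes from the induction hypothesis, since a smaller side would already be
  -- contradictory.
  no-sep5 : ∀ {s} → ¬ Sep5 s
  no-sep5 {s} p = descend (<-wellFounded (size s L)) p refl
    where
    descend : ∀ {k} → Acc _<_ k → ∀ {s} → Sep5 s → size s L ≡ k → ⊥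
    descend (acc rec) {s} p refl = no-minimal p refl λ q → ≮⇒≥ λ lt → descend (rec lt) q refl

  contradiction : Fin n → ⊥
  contradiction v with nbr-fresh v [] (≤-trans (s≤s z≤n) (5≤deg v))
  ... | u , a , _ with separated a
  ... | _ , p , _ = no-sep5 p

-- Contracting an edge

infixr 5 _◂_
_◂_ : ∀ {n} → Side → Colouring n → Colouring (suc n)
(i ◂ s) zero = i
(i ◂ s) (suc v) = s v

-- Colourings are functions compared pointwise, hence the requirement that `P` respect pointwise
-- equality.
any-colouring? : ∀ {n} {P : Colouring n → Set} → (∀ {s t} → (∀ v → s v ≡ t v) → P s → P t) →
  (∀ s → Dec (P s)) → Dec (∃ P)
any-colouring? {zero} ext P? with P? (λ ())
... | yes p = yes ((λ ()) , p)
... | no np = no λ (s , p) → np (ext (λ ()) p)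
any-colouring? {suc n} {P} ext P? with first L | first M | first R
  where
  first : ∀ i → Dec (∃[ s ] P (i ◂ s))
  first i = any-colouring? (λ h → ext λ { zero → refl ; (suc v) → h v }) (λ s → P? (i ◂ s))
... | yes (s , p) | _ | _ = yes (L ◂ s , p)
... | no _ | yes (s , p) | _ = yes (M ◂ s , p)
... | no _ | no _ | yes (s , p) = yes (R ◂ s , p)
... | no nl | no nm | no nr = no λ (s , p) → by-head s p (s zero) refl
  where
  split : ∀ s i → s zero ≡ i → ∀ v → s v ≡ (i ◂ (s ∘ suc)) v
  split s i e zero = e
  split s i e (suc v) = refl
  by-head : ∀ s → P s → ∀ i → s zero ≡ i → ⊥
  by-head s p L e = nl (_ , ext (split s L e) p)
  by-head s p M e = nm (_ , ext (split s M e) p)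
  by-head s p R e = nr (_ , ext (split s R e) p)

-- The goal in `connected` is a contradiction, so finitely many instances of excluded middle for
-- reachability may be assumed there.
¬¬-all-dec : ∀ {n} (P : Fin n → Set) → ¬ ¬ (∀ i → Dec (P i))
¬¬-all-dec {zero} P k = k λ ()
¬¬-all-dec {suc n} P k = ¬¬-all-dec (P ∘ suc) λ rest →
  k λ { zero → no (λ p → k λ { zero → yes p ; (suc i) → rest i }) ; (suc i) → rest i }

module Decide {n : ℕ} (G : Graph n) (simple : IsSimple G) (quasi : QuasiConnected 5 G)
  (degrees : ∀ x y → Dist12 G x y → deg G x + deg G y ≥ 9) where
  open Separation G simple quasi degrees

  common4? : ∀ x y → Dec (Common4 x y)
  common4? x y = any? λ g → (deg G g ≟ 4) ×-dec ((g ~? x) ×-dec (g ~? y))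

  valid? : ∀ s → Dec (Valid s)
  valid? s with all? (λ u → all? (λ v → (u ~? v) →-dec ((s u ≟ˢ L) →-dec ¬? (s v ≟ˢ R))))
  ... | yes h = yes λ {u} {v} a e f → h u v a e f
  ... | no nh = no λ val → nh λ u v a e f → val a e f

  sep5? : ∀ s → Dec (Sep5 s)
  sep5? s with valid? s | size s M ≟ 5 | 2 ≤? size s L | 2 ≤? size s R
  ... | yes a | yes b | yes c | yes d = yes (sep5 a b c d)
  ... | no a | _ | _ | _ = no λ p → a (valid p)
  ... | yes _ | no b | _ | _ = no λ p → b (size-M p)
  ... | yes _ | yes _ | no c | _ = no λ p → c (size-L p)
  ... | yes _ | yes _ | yes _ | no d = no λ p → d (size-R p)

  sep5-ext : ∀ {s t} → (∀ v → s v ≡ t v) → Sep5 s → Sep5 t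
  sep5-ext {s} {t} h p = sep5 (λ {u} {v} a e f → valid p a (trans (h u) e) (trans (h v) f))
    (trans (sym (same M)) (size-M p))
    (≤-trans (size-L p) (≤-reflexive (same L))) (≤-trans (size-R p) (≤-reflexive (same R)))
    where
    same : ∀ i → size s i ≡ size t i
    same i = trans (size≡# s i) (trans (#-cong λ v → cong (is i) (h v)) (sym (size≡# t i)))

  separated? : ∀ x y → Dec (Separated x y)
  separated? x y = any-colouring? (λ h (p , e , f) → sep5-ext h p , trans (sym (h x)) e , trans (sym (h y)) f)
    (λ s → sep5? s ×-dec ((s x ≟ˢ M) ×-dec (s y ≟ˢ M)))

module Contraction {m : ℕ} (G : Graph (suc m)) (simple : IsSimple G) (quasi : QuasiConnected 5 G)
  (degrees : ∀ x y → Dist12 G x y → deg G x + deg G y ≥ 9) {x y : Fin (suc m)} (xy : E G x y)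
  (not-common : ¬ Separation.Common4 G simple quasi degrees x y)
  (not-separated : ¬ Separation.Separated G simple quasi degrees x y) where
  open Separation G simple quasi degrees

  y≢x : y ≢ x
  y≢x q = ~⇒≢ xy (sym q)

  G/xy : Graph m
  G/xy = contract G x y

  -- The quotient map of the contraction; `y` goes where `x` goes.
  φ : Fin (suc m) → Fin m
  φ v with y Fin.≟ v
  ... | yes _ = punchOut y≢x
  ... | no ne = punchOut ne

  merged : Fin m
  merged = φ y

  φ-y : φ y ≡ punchOut y≢x
  φ-y with y Fin.≟ y
  ... | yes _ = refl
  ... | no ne = ⊥-elim (ne refl)

  φ-x : φ x ≡ merged
  φ-x with y Fin.≟ x
  ... | yes q = ⊥-elim (y≢x q)
  ... | no ne = trans (punchOut-cong y refl) (sym φ-y)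

  punchIn-merged : punchIn y merged ≡ x
  punchIn-merged = trans (cong (punchIn y) φ-y) (punchIn-punchOut y≢x)

  punchIn-φ : ∀ {v} → y ≢ v → punchIn y (φ v) ≡ v
  punchIn-φ {v} ne with y Fin.≟ v
  ... | yes q = ⊥-elim (ne q)
  ... | no ne' = punchIn-punchOut ne'

  φ-punchIn : ∀ a → φ (punchIn y a) ≡ a
  φ-punchIn a with y Fin.≟ punchIn y a
  ... | yes q = ⊥-elim (punchInᵢ≢i y a (sym q))
  ... | no ne = trans (punchOut-cong y refl) (punchOut-punchIn y)

  φ-edge : ∀ {u v} → u ~ v → φ u ≢ φ v → E G/xy (φ u) (φ v)
  φ-edge {u} {v} a ne = Equivalence.from (T-∧ {not ⌊ φ u Fin.≟ φ v ⌋}) (distinct , by-cases (y Fin.≟ u) (y Fin.≟ v))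
    where
    distinct : T (not ⌊ φ u Fin.≟ φ v ⌋)
    distinct with φ u Fin.≟ φ v
    ... | yes q = ne q
    ... | no _ = tt
    u' v' : Fin (suc m)
    u' = punchIn y (φ u)
    v' = punchIn y (φ v)
    is-x : ∀ {w} → w ≡ x → T ⌊ w Fin.≟ x ⌋
    is-x {w} e with w Fin.≟ x
    ... | yes _ = tt
    ... | no ne' = ne' e
    by-cases : Dec (y ≡ u) → Dec (y ≡ v) → T (G u' v' ∨ (⌊ u' Fin.≟ x ⌋ ∧ G y v') ∨ (⌊ v' Fin.≟ x ⌋ ∧ G u' y))
    by-cases (yes refl) (yes refl) = ⊥-elim (ne refl)
    by-cases (no nu) (no nv) = Equivalence.from (T-∨ {G u' v'})
      (inj₁ (subst₂ (λ a b → T (G a b)) (sym (punchIn-φ nu)) (sym (punchIn-φ nv)) a))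
    by-cases (yes refl) (no nv) = Equivalence.from (T-∨ {G u' v'}) (inj₂ (Equivalence.from (T-∨ {⌊ u' Fin.≟ x ⌋ ∧ G y v'})
      (inj₁ (Equivalence.from (T-∧ {⌊ u' Fin.≟ x ⌋}) (is-x punchIn-merged , subst (λ b → T (G y b)) (sym (punchIn-φ nv)) a)))))
    by-cases (no nu) (yes refl) = Equivalence.from (T-∨ {G u' v'}) (inj₂ (Equivalence.from (T-∨ {⌊ u' Fin.≟ x ⌋ ∧ G y v'})
      (inj₂ (Equivalence.from (T-∧ {⌊ v' Fin.≟ x ⌋}) (is-x punchIn-merged , subst (λ b → T (G b y)) (sym (punchIn-φ nu)) a)))))

  Valid/ : Colouring m → Set
  Valid/ κ = ∀ {a b} → E G/xy a b → κ a ≡ L → κ b ≡ R → ⊥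

  lift-valid : ∀ {κ} → Valid/ κ → Valid (κ ∘ φ)
  lift-valid {κ} val {u} {v} a e f = val (φ-edge a (side-≢ κ e f)) e f

  -- Every fibre of `φ` has one vertex other than `y`; the extra bit counts `y`, which shares the
  -- fibre of `x`.
  lift-size : ∀ κ i → size (κ ∘ φ) i ≡ bit (is i (κ merged)) + size κ i
  lift-size κ i = trans (size≡# (κ ∘ φ) i) (trans (#-punchIn y (λ v → is i (κ (φ v))))
    (cong (bit (is i (κ merged)) +_) (trans (#-cong λ a → cong (λ b → is i (κ b)) (φ-punchIn a)) (sym (size≡# κ i)))))

  lift-size-in : ∀ κ → κ merged ≡ M → size (κ ∘ φ) M ≡ suc (size κ M)
  lift-size-in κ eq = trans (lift-size κ M) (cong (λ i → bit (is M i) + size κ M) eq)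

  lift-size-out : ∀ κ → κ merged ≢ M → size (κ ∘ φ) M ≡ size κ M
  lift-size-out κ ne = trans (lift-size κ M) (cong (_+ size κ M) (bit-¬T λ t → ne (is⁻ t)))

  lift-at : ∀ (κ : Colouring m) a {i} → κ a ≡ i → (κ ∘ φ) (punchIn y a) ≡ i
  lift-at κ a e = trans (cong κ (φ-punchIn a)) e

  lift-size-≥ : ∀ κ i → size κ i ≤ size (κ ∘ φ) i
  lift-size-≥ κ i = ≤-trans (m≤n+m _ _) (≡⇒≥ (lift-size κ i))

  -- A side with a single vertex makes it a neighbour of degree 4 of both `x` and `y`, which
  -- `not-common` excludes.
  no-4-cut-through : ∀ {σ} → Valid σ → σ x ≡ M → σ y ≡ M → size σ M ≤ 4 → ∀ {u v} → σ u ≡ L → σ v ≡ R → ⊥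
  no-4-cut-through {σ} val σx σy le e f with 2 ≤? size σ L | 2 ≤? size σ R
  ... | no small-L | _ with singleton-side val le e (size-1-unique σ e (s≤s⁻¹ (≰⇒> small-L)))
  ...   | g4 , nbrs = not-common (_ , g4 , nbrs x σx , nbrs y σy)
  no-4-cut-through {σ} val σx σy le e f | yes _ | no small-R
    with singleton-side (flip-valid {σ} val) (≤-trans (≤-reflexive (flip-size σ M)) le) (cong op f)
           (size-1-unique (flip σ) (cong op f) (≤-trans (≤-reflexive (flip-size σ L)) (s≤s⁻¹ (≰⇒> small-R))))
  ...   | g4 , nbrs = not-common (_ , g4 , nbrs x (cong op σx) , nbrs y (cong op σy))
  no-4-cut-through {σ} val σx σy le e f | yes l | yes r with size σ M ≤? 3
  ...   | yes le3 = no-3-cut val le3 e f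
  ...   | no gt3 = no-nontrivial-4-cut val (≤-antisym le (≰⇒> gt3)) l r

  no-3-cut/ : ∀ {κ} → Valid/ κ → size κ M ≤ 3 → ∀ {a b} → κ a ≡ L → κ b ≡ R → ⊥
  no-3-cut/ {κ} val le {a} {b} e f with κ merged ≟ˢ M
  ... | yes eq = no-4-cut-through (lift-valid {κ} val) (trans (cong κ φ-x) eq) eq
              (≤-trans (≤-reflexive (lift-size-in κ eq)) (s≤s le)) {punchIn y a} {punchIn y b} (lift-at κ a e) (lift-at κ b f)
  ... | no ne = no-3-cut (lift-valid {κ} val) (≤-trans (≤-reflexive (lift-size-out κ ne)) le)
              {punchIn y a} {punchIn y b} (lift-at κ a e) (lift-at κ b f)

  no-nontrivial-4-cut/ : ∀ {κ} → Valid/ κ → size κ M ≡ 4 → 2 ≤ size κ L → 2 ≤ size κ R → ⊥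
  no-nontrivial-4-cut/ {κ} val size-4 l r with κ merged ≟ˢ M
  ... | yes eq = not-separated (κ ∘ φ , sep5 (lift-valid {κ} val) (trans (lift-size-in κ eq) (cong suc size-4))
      (≤-trans l (lift-size-≥ κ L)) (≤-trans r (lift-size-≥ κ R)) , trans (cong κ φ-x) eq , eq)
  ... | no ne = no-nontrivial-4-cut (lift-valid {κ} val) (trans (lift-size-out κ ne) size-4)
      (≤-trans l (lift-size-≥ κ L)) (≤-trans r (lift-size-≥ κ R))

  deg≤m : ∀ v → deg G v ≤ m
  deg≤m v = ≤-trans (≤-reflexive (deg≡ v)) (≤-trans (#-mono others)
    (≤-reflexive (suc-injective (trans (sym (#-∖ (λ _ → true) v tt)) (#-all (suc m))))))
    where
    others : ∀ u → v ~ u → T (((λ _ → true) ∖ v) u)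
    others u a = ∖⁺ (λ _ → true) {v} {u} tt (λ q → ~⇒≢ a (sym q))

  -- The ends of the edge have degree sum at least 9, so one of them has at least 5 neighbours among
  -- the other `m` vertices.
  4<m : 4 < m
  4<m with m ≤? 4
  ... | no gt = ≰⇒> gt
  ... | yes le = ⊥-elim (<⇒≱ (≤-refl {9}) (≤-trans (degrees x y (~⇒≢ xy , inj₁ xy))
      (+-mono-≤ (≤-trans (deg≤m x) le) (≤-trans (deg≤m y) le))))

  ∣∣≡# : ∀ (S : Subset m) → ∣ S ∣ ≡ # (Vec.lookup S)
  ∣∣≡# S = trans (cong ∣_∣ (sym (tabulate∘lookup S))) (∣tabulate∣ (Vec.lookup S))

  paint : Subset m → {P : Fin m → Set} → (∀ v → Dec (P v)) → Colouring m
  paint S P? v with Vec.lookup S v | P? v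
  ... | true | _ = M
  ... | false | yes _ = L
  ... | false | no _ = R

  module _ (S : Subset m) {P : Fin m → Set} (P? : ∀ v → Dec (P v)) where
    paint-M : size (paint S P?) M ≡ ∣ S ∣
    paint-M = trans (size≡# (paint S P?) M) (trans (#-cong same) (sym (∣∣≡# S)))
      where
      same : ∀ v → is M (paint S P? v) ≡ Vec.lookup S v
      same v with Vec.lookup S v | P? v
      ... | true | _ = refl
      ... | false | yes _ = refl
      ... | false | no _ = refl

    outside : ∀ {v} → Vec.lookup S v ≡ false → v Subset.∉ S
    outside e mem with () ← trans (sym e) ([]=⇒lookup mem)

    paint-L⁻ : ∀ {v} → paint S P? v ≡ L → v Subset.∉ S × P v
    paint-L⁻ {v} e with Vec.lookup S v in eq | P? v
    ... | false | yes p = outside eq , p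

    paint-R⁻ : ∀ {v} → paint S P? v ≡ R → v Subset.∉ S × ¬ P v
    paint-R⁻ {v} e with Vec.lookup S v in eq | P? v
    ... | false | no np = outside eq , np

    paint-L⁺ : ∀ {v} → v Subset.∉ S → P v → paint S P? v ≡ L
    paint-L⁺ {v} nm p with Vec.lookup S v in eq | P? v
    ... | true | _ = ⊥-elim (nm (lookup⇒[]= v S eq))
    ... | false | yes _ = refl
    ... | false | no np = ⊥-elim (np p)

    paint-R⁺ : ∀ {v} → v Subset.∉ S → ¬ P v → paint S P? v ≡ R
    paint-R⁺ {v} nm np with Vec.lookup S v in eq | P? v
    ... | true | _ = ⊥-elim (nm (lookup⇒[]= v S eq))
    ... | false | yes p = ⊥-elim (np p)
    ... | false | no _ = refl

  connected : ∀ S → ∣ S ∣ < 4 → ¬ IsCut G/xy S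
  connected S lt (u , v , u∉ , v∉ , unreachable) = ¬¬-all-dec (Reach G/xy S u) λ reach? →
    no-3-cut/ {paint S reach?}
      (λ {a} {b} ab e f → proj₂ (paint-R⁻ S reach? {b} f) (step (proj₂ (paint-L⁻ S reach? {a} e)) ab (proj₁ (paint-R⁻ S reach? {b} f))))
      (s≤s⁻¹ (≤-trans (≤-reflexive (cong suc (paint-M S reach?))) lt))
      (paint-L⁺ S reach? u∉ (here u∉)) (paint-R⁺ S reach? v∉ unreachable)

  no-nontrivial : ∀ S → ∣ S ∣ ≡ 4 → ¬ NontrivialCut G/xy S
  no-nontrivial S size-4 (_ , A , disjoint , separated , l , r) =
    no-nontrivial-4-cut/ {paint S A?}
      (λ {a} {b} ab e f → separated a b (proj₂ (paint-L⁻ S A? {a} e)) (proj₂ (paint-R⁻ S A? {b} f)) (proj₁ (paint-R⁻ S A? {b} f)) ab)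
      (trans (paint-M S A?) size-4)
      (≤-trans l (≤-trans (≤-reflexive (∣∣≡# A)) (≤-trans (#-mono in-L) (≡⇒≥ (size≡# (paint S A?) L)))))
      (≤-trans r (≤-trans (≤-reflexive (∣∣≡# (∁ (A ∪ S)))) (≤-trans (#-mono in-R) (≡⇒≥ (size≡# (paint S A?) R)))))
    where
    A? : ∀ v → Dec (v Subset.∈ A)
    A? v = v ∈ˢ? A
    in-L : ∀ v → T (Vec.lookup A v) → T (is L (paint S A? v))
    in-L v t = is⁺ (paint-L⁺ S A? (disjoint v mem) mem)
      where mem = lookup⇒[]= v A (Equivalence.to T-≡ t)
    in-R : ∀ v → T (Vec.lookup (∁ (A ∪ S)) v) → T (is R (paint S A? v))
    in-R v t = is⁺ (paint-R⁺ S A? (λ mem → rest (x∈p∪q⁺ (inj₂ mem))) (λ mem → rest (x∈p∪q⁺ (inj₁ mem))))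
      where
      rest : v Subset.∉ A ∪ S
      rest = x∈∁p⇒x∉p (lookup⇒[]= v (∁ (A ∪ S)) (Equivalence.to T-≡ t))

  contractible : QuasiConnected 5 G/xy
  contractible = (4<m , connected) , no-nontrivial

theorem2 : {n : ℕ} (G : Graph n) → IsSimple G → QuasiConnected 5 G →
    (∀ x y → Dist12 G x y → deg G x + deg G y ≥ 9) →
    ∃[ x ] ∃[ y ] (E G x y × QuasiContractible 5 G x y)
theorem2 {zero} G simple quasi degrees = ⊥-elim (n≮0 (proj₁ (proj₁ quasi)))
theorem2 {suc m} G simple quasi degrees
  with any? (λ x → any? (λ y → T? (G x y) ×-dec (¬? (common4? x y) ×-dec ¬? (separated? x y))))
  where open Decide G simple quasi degrees
... | yes (x , y , xy , nc , ns) = x , y , xy , Contraction.contractible G simple quasi degrees xy nc ns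
... | no none = ⊥-elim (PairSide.contradiction G simple quasi degrees uncontractible
    (no-degree-4 G simple quasi degrees uncontractible) zero)
  where
  open Decide G simple quasi degrees
  open Separation G simple quasi degrees using (Uncontractible)
  uncontractible : Uncontractible
  uncontractible x y xy with common4? x y | separated? x y
  ... | yes c | _ = inj₁ c
  ... | no _ | yes s = inj₂ s
  ... | no nc | no ns = ⊥-elim (none (x , y , xy , nc , ns))
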